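{- Let $k,l\geq 2$ be integers. Then \[ \mathrm{ex}(n,P_l,\textnormal{rainbow- }C_{2k})= \begin{cases} \Theta(n^{\lceil (l+1)/2\rceil}) & \text{if } k\geq 3,\\ \Theta(n^{l/2+1}) & \text{if } k=2. \end{cases} \]
   Context: A proper edge-colouring of a graph assigns colours to edges so that any two edges sharing a vertex receive different colours. A subgraph of an edge-coloured graph is rainbow if all its edges have distinct colours. For graphs $H,F$, $\mathrm{ex}(n,H,\textnormal{rainbow- }F)$ denotes the maximum number of copies of $H$ (subgraphs isomorphic to $H$) in a properly edge-coloured graph on $n$ vertices that contains no rainbow subgraph isomorphic to $F$. $P_l$ denotes the path with $l$ edges and $l+1$ vertices, and $C_m$ the cycle of length $m$. The constants implied by $\Theta$ may depend on $k$ and $l$. -}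

module Defs where

open import Data.Nat using (ℕ; zero; suc; _+_; _*_; _^_; _≤_; _/_; ⌈_/2⌉)
open import Data.Nat.DivMod using (_mod_)
open import Data.Fin using (Fin; toℕ) renaming (_≟_ to _≟ᶠ_)
open import Data.List using (List; []; _∷_; [_]; map; concatMap; filterᵇ; length; allFin)
open import Data.Maybe using (Maybe; just; nothing)
open import Data.Bool using (Bool; true; false; _∧_; not)
open import Data.Product using (Σ; ∃; _×_; _,_)
open import Relation.Nullary using (¬_; does)
open import Relation.Binary.PropositionalEquality using (_≡_)
open import Function.Definitions using (Injective)

-- A properly edge-coloured (simple) graph on vertex set Fin n.
-- col u v ≡ nothing : uv is not an edge; col u v ≡ just c : uv is an edge of colour c.
record PCGraph (n : ℕ) : Set where
  field
    col    : Fin n → Fin n → Maybe ℕ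
    sym    : ∀ u v → col u v ≡ col v u
    irrefl : ∀ u → col u u ≡ nothing
    proper : ∀ u v w c → col u v ≡ just c → col u w ≡ just c → v ≡ w
open PCGraph public

csuc : {m : ℕ} → Fin m → Fin m
csuc {suc m} i = suc (toℕ i) mod (suc m)

RainbowCycle : {n : ℕ} → PCGraph n → ℕ → Set
RainbowCycle {n} G m =
  Σ (Fin m → Fin n) λ v → Σ (Fin m → ℕ) λ c →
    Injective _≡_ _≡_ v × Injective _≡_ _≡_ c ×
    (∀ i → col G (v i) (v (csuc i)) ≡ just (c i))

allLists : ℕ → (n : ℕ) → List (List (Fin n))
allLists zero n = [ [] ]
allLists (suc m) n = concatMap (λ x → map (x ∷_) (allLists m n)) (allFin n)

memᵇ : {n : ℕ} → Fin n → List (Fin n) → Bool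
memᵇ x [] = false
memᵇ x (y ∷ ys) = does (x ≟ᶠ y) Data.Bool.∨ memᵇ x ys

distinctᵇ : {n : ℕ} → List (Fin n) → Bool
distinctᵇ [] = true
distinctᵇ (x ∷ xs) = not (memᵇ x xs) ∧ distinctᵇ xs

isEdgeᵇ : {n : ℕ} → PCGraph n → Fin n → Fin n → Bool
isEdgeᵇ G u v with col G u v
... | just _  = true
... | nothing = false

consecEdgesᵇ : {n : ℕ} → PCGraph n → List (Fin n) → Bool
consecEdgesᵇ G [] = true
consecEdgesᵇ G (x ∷ []) = true
consecEdgesᵇ G (x ∷ y ∷ ys) = isEdgeᵇ G x y ∧ consecEdgesᵇ G (y ∷ ys)

pathSeqCount : {n : ℕ} → PCGraph n → ℕ → ℕ
pathSeqCount {n} G l =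
  length (filterᵇ (λ vs → distinctᵇ vs ∧ consecEdgesᵇ G vs) (allLists (suc l) n))

-- number of copies (subgraphs) of P_l (l ≥ 1): each copy corresponds to exactly
-- two such sequences (the two traversal directions)
copiesP : {n : ℕ} → PCGraph n → ℕ → ℕ
copiesP G l = pathSeqCount G l / 2

-- ex(n, P_l, rainbow-C_{2k}) = Θ(n^(a/2)), with constants as positive naturals
-- (squared to allow half-integer exponents), for all sufficiently large n:
--  upper: every host graph has  copies² ≤ B · n^a
--  lower: some host graph has   n^a ≤ A · copies²
ExThetaHalf : ℕ → ℕ → ℕ → Set
ExThetaHalf k l a =
  ∃ λ A → ∃ λ B → ∃ λ n₀ → 1 ≤ A × 1 ≤ B ×
    (∀ n → n₀ ≤ n →
      ((G : PCGraph n) → ¬ RainbowCycle G (2 * k) → copiesP G l ^ 2 ≤ B * n ^ a)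
      × Σ (PCGraph n) (λ G → ¬ RainbowCycle G (2 * k) × n ^ a ≤ A * copiesP G l ^ 2))

{-# OPTIONS --safe #-}
module Submission where

-- Upper bounds. Call a pair of vertices heavy if it has more than D common neighbours, D a large
-- constant. If more than D · deg x paths x y w had w heavy to x, a subfamily of large minimum degree
-- would contain, by greedy choice, a rainbow C_2k through x. Hence every vertex starts O(n) walks of
-- length 2, which settles even l, and with Cauchy–Schwarz also odd l for k = 2. For k ≥ 3 it remains
-- to bound the number of walks x u y z of length 3 by O(n²). Those with (x , y) or (u , z) heavy, or
-- with xu and yz of the same colour, are negligible by the above. Counting the closed walks
-- x u y z y′ u′ in which uy and u′y′ have the same colour c by first choosing uy and then u′ (y′ is
-- the c-neighbour of u′) shows that at most half of the walks x u y z share the colour of their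
-- middle edge with many other walks from x to z. If the rest were too many, a subfamily of large
-- minimum degree would again yield a rainbow C_2k greedily.
--
-- Lower bounds. For k ≥ 3, blow up every other vertex of a path: the result has no cycle longer
-- than 4. For k = 2, take the polarity graph of the affine plane over ℤ/p, which has no 4-cycle, for
-- a prime p of order √n; such primes exist by a Chebyshev-type estimate.

open import Defs
open import Data.Nat using (ℕ; zero; suc; _+_; _*_; _∸_; _^_; _/_; _%_; _≤_; _<_; _<ᵇ_; z≤n; s≤s;
  _≤?_; _<?_; >-nonZero; >-nonZero⁻¹; nonTrivial⇒n>1; ⌈_/2⌉; _!; NonZero) renaming (_≟_ to
  _≟ⁿ_)
open import Data.Nat.Properties hiding (_≟_)
open import Data.Nat.Tactic.RingSolver using (solve-∀)
open import Data.Fin using (Fin; toℕ; fromℕ<) renaming (zero to fzero; suc to fsuc; _≟_ to _≟ᶠ_)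
open import Data.Fin.Properties using (toℕ-injective; toℕ<n; toℕ-fromℕ<)
open import Data.List using (List; []; _∷_; [_]; _++_; map; concatMap; filterᵇ; length; allFin;
  cartesianProduct)
open import Data.List.Properties using (length-map; length-++; length-tabulate)
open import Data.List.Membership.Propositional using (_∈_; _∉_)
open import Data.List.Membership.Propositional.Properties using (∈-allFin; ∈-map⁺; ∈-++⁺ˡ;
  ∈-++⁺ʳ; ∈-cartesianProduct⁺)
open import Data.List.Relation.Unary.Any using (here; there)
open import Data.List.Relation.Unary.All as All using (All; []; _∷_)
open import Data.List.Relation.Unary.All.Properties as AllP using ()
open import Data.List.Relation.Unary.AllPairs using ([]; _∷_)
open import Data.List.Relation.Unary.Unique.Propositional using (Unique)
open import Data.List.Relation.Unary.Unique.Propositional.Properties using (allFin⁺; cartesianProduct⁺)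
open import Data.Bool using (Bool; true; false; _∧_; _∨_; not; T)
open import Data.Bool.Properties using (∧-comm; ∨-comm; ∨-zeroʳ)
open import Data.Maybe using (Maybe; just; nothing)
open import Data.Maybe.Properties using (≡-dec)
open import Data.Product using (Σ; ∃; _×_; _,_; proj₁; proj₂)
open import Data.Sum as Sum using (_⊎_; inj₁; inj₂)
open import Data.Empty using (⊥; ⊥-elim)
open import Data.Unit using (tt)
open import Relation.Nullary using (¬_; Dec; yes; no; does)
open import Relation.Nullary.Decidable using (dec-true; dec-false)
open import Relation.Binary.PropositionalEquality using (_≡_; _≢_; refl; trans; cong; cong₂; subst;
  subst₂) renaming (sym to ≡-sym)
open import Function using (id)
open import Data.Nat.DivMod using (m<n⇒m%n≡m; n%n≡0; m%n<n; %-distribˡ-+; m%n%n≡m%n; [m+n]%n≡m%n;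
  m≡m%n+[m/n]*n; m/n≤m; m/n*n≤m; m<n⇒m/n≡0; +-distrib-/-∣ˡ; m*n/n≡m; +-distrib-/-∣ʳ;
  [m+kn]%n≡m%n; m<n*o⇒m/o<n; m≥n⇒m/n>0; /-monoˡ-≤)
open import Data.Product.Properties using () renaming (≡-dec to ×-≡-dec)
open import Data.Nat.Combinatorics using (_C_; nC1≡n; nCk+nC[k+1]≡[n+1]C[k+1]; k>n⇒nCk≡0)
open import Data.Nat.Divisibility using (_∣_; _∤_; divides; _∣?_; ∣-trans; ∣-refl; ∣⇒≤;
  ∣m+n∣m⇒∣n; ∣m∣n⇒∣m+n; n∣m*n; m∣m*n; ∣m⇒∣m*n; ∣n⇒∣m*n; *-pres-∣;
  *-cancelˡ-∣; m≤n⇒m!∣n!; 1∣_)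
open import Data.Nat.Induction using (<-rec)
open import Data.Nat.Primality using (Prime; prime?; euclidsLemma; prime⇒nonZero; prime⇒nonTrivial)
open import Data.Nat.Primality.Factorisation using (factorise; PrimeFactorisation)

-- Finite sums and counting

-- Greedy growth works because properness lets each used vertex or colour rule out few continuations
-- from a given vertex. The obstacle arises when a walk `x u y z` has to return from `z` to a
-- prescribed `x`. A used vertex, or a used colour on `xu` or `yz`, fixes `u` or `y`, after which
-- lightness of a pair leaves at most `D` walks; but a used colour on the middle edge `uy` fixes
-- neither end. Only for this reason are the walks with a popular middle colour set apart. The
-- number of walks sharing the middle colour averages at most `2 * D`, so the threshold `4 * D`
-- costs at most half of all walks, an amount that can be moved to the other side. Such a cycle
-- leaves `x` and returns to it by three edges, so it has length at least 6: this is where `k ≥ 3`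
-- enters.
--
-- Walks rather than paths are bounded because walks are counted by powers of the adjacency operator
-- and can be cut at any vertex. In the lower bounds the graphs contain no cycle of length `2 * k`
-- at all, rainbow or not, so that any proper colouring serves.

private variable
  A B : Set

∑ : List A → (A → ℕ) → ℕ
∑ []       f = 0
∑ (x ∷ xs) f = f x + ∑ xs f

𝟙 : Bool → ℕ
𝟙 true  = 1
𝟙 false = 0

# : List A → (A → Bool) → ℕ
# xs p = ∑ xs (λ x → 𝟙 (p x))

∑-cong : (xs : List A) {f g : A → ℕ} → (∀ x → f x ≡ g x) → ∑ xs f ≡ ∑ xs g
∑-cong []       e = refl
∑-cong (x ∷ xs) e = cong₂ _+_ (e x) (∑-cong xs e)

∑-mono : (xs : List A) {f g : A → ℕ} → (∀ x → f x ≤ g x) → ∑ xs f ≤ ∑ xs g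
∑-mono []       e = z≤n
∑-mono (x ∷ xs) e = +-mono-≤ (e x) (∑-mono xs e)

∑-+ : (xs : List A) (f g : A → ℕ) → ∑ xs (λ x → f x + g x) ≡ ∑ xs f + ∑ xs g
∑-+ []       f g = refl
∑-+ (x ∷ xs) f g = trans (cong (f x + g x +_) (∑-+ xs f g)) (+-interchange (f x) (g x) (∑ xs f) (∑ xs g))
  where
  +-interchange : ∀ a b c d → (a + b) + (c + d) ≡ (a + c) + (b + d)
  +-interchange = solve-∀

∑-*ˡ : (xs : List A) (c : ℕ) (f : A → ℕ) → ∑ xs (λ x → c * f x) ≡ c * ∑ xs f
∑-*ˡ []       c f = ≡-sym (*-zeroʳ c)
∑-*ˡ (x ∷ xs) c f = trans (cong (c * f x +_) (∑-*ˡ xs c f)) (≡-sym (*-distribˡ-+ c (f x) (∑ xs f)))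

∑-*ʳ : (xs : List A) (c : ℕ) (f : A → ℕ) → ∑ xs (λ x → f x * c) ≡ ∑ xs f * c
∑-*ʳ xs c f = trans (∑-cong xs (λ x → *-comm (f x) c)) (trans (∑-*ˡ xs c f) (*-comm c (∑ xs f)))

∑-const : (xs : List A) (c : ℕ) → ∑ xs (λ _ → c) ≡ length xs * c
∑-const []       c = refl
∑-const (x ∷ xs) c = cong (c +_) (∑-const xs c)

∑-zero : (xs : List A) → ∑ xs (λ _ → 0) ≡ 0
∑-zero xs = trans (∑-const xs 0) (*-zeroʳ (length xs))

∑-swap : (xs : List A) (ys : List B) (f : A → B → ℕ) →
  ∑ xs (λ x → ∑ ys (f x)) ≡ ∑ ys (λ y → ∑ xs (λ x → f x y))
∑-swap []       ys f = ≡-sym (∑-zero ys)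
∑-swap (x ∷ xs) ys f = trans (cong (∑ ys (f x) +_) (∑-swap xs ys f)) (≡-sym (∑-+ ys (f x) _))

∑-++ : (xs ys : List A) (f : A → ℕ) → ∑ (xs ++ ys) f ≡ ∑ xs f + ∑ ys f
∑-++ []       ys f = refl
∑-++ (x ∷ xs) ys f = trans (cong (f x +_) (∑-++ xs ys f)) (≡-sym (+-assoc (f x) _ _))

∑-map : (g : A → B) (xs : List A) (f : B → ℕ) → ∑ (map g xs) f ≡ ∑ xs (λ x → f (g x))
∑-map g []       f = refl
∑-map g (x ∷ xs) f = cong (f (g x) +_) (∑-map g xs f)

∑-concatMap : (g : A → List B) (xs : List A) (f : B → ℕ) → ∑ (concatMap g xs) f ≡ ∑ xs (λ x → ∑ (g x) f)
∑-concatMap g []       f = refl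
∑-concatMap g (x ∷ xs) f = trans (∑-++ (g x) _ f) (cong (∑ (g x) f +_) (∑-concatMap g xs f))

∑-cartesianProduct : (xs : List A) (ys : List B) (f : A × B → ℕ) →
  ∑ (cartesianProduct xs ys) f ≡ ∑ xs (λ x → ∑ ys (λ y → f (x , y)))
∑-cartesianProduct []       ys f = refl
∑-cartesianProduct (x ∷ xs) ys f =
  trans (∑-++ (map (x ,_) ys) _ f) (cong₂ _+_ (∑-map (x ,_) ys f) (∑-cartesianProduct xs ys f))

term≤∑ : {xs : List A} {x : A} (f : A → ℕ) → x ∈ xs → f x ≤ ∑ xs f
term≤∑ f (here refl) = m≤m+n _ _
term≤∑ f (there i)   = ≤-trans (term≤∑ f i) (m≤n+m _ _)

length-filterᵇ : (p : A → Bool) (xs : List A) → length (filterᵇ p xs) ≡ # xs p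
length-filterᵇ p []       = refl
length-filterᵇ p (x ∷ xs) with p x
... | true  = cong suc (length-filterᵇ p xs)
... | false = length-filterᵇ p xs

∈-filterᵇ : (p : A → Bool) {xs : List A} {x : A} → x ∈ xs → p x ≡ true → x ∈ filterᵇ p xs
∈-filterᵇ p {x ∷ xs} (here refl) px rewrite px = here refl
∈-filterᵇ p {y ∷ xs} (there i)   px with p y
... | true  = there (∈-filterᵇ p i px)
... | false = ∈-filterᵇ p i px

𝟙≤1 : ∀ b → 𝟙 b ≤ 1
𝟙≤1 true  = ≤-refl
𝟙≤1 false = z≤n

𝟙-∧ : ∀ a b → 𝟙 (a ∧ b) ≡ 𝟙 a * 𝟙 b
𝟙-∧ true  b = ≡-sym (+-identityʳ _)
𝟙-∧ false b = refl

𝟙-mono : ∀ {a b} → (a ≡ true → b ≡ true) → 𝟙 a ≤ 𝟙 b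
𝟙-mono {false} h = z≤n
𝟙-mono {true}  h rewrite h refl = ≤-refl

∧-split : ∀ {a b} → a ∧ b ≡ true → a ≡ true × b ≡ true
∧-split {true} {true} _ = refl , refl

∧-join : ∀ {a b} → a ≡ true → b ≡ true → a ∧ b ≡ true
∧-join refl refl = refl

𝟙-split : ∀ a b → 𝟙 a ≡ 𝟙 (a ∧ b) + 𝟙 (a ∧ not b)
𝟙-split true  true  = refl
𝟙-split true  false = refl
𝟙-split false b     = refl

true≢false : ∀ {b} → b ≡ true → b ≡ false → ⊥
true≢false refl ()

#-mono : (xs : List A) {p q : A → Bool} → (∀ x → p x ≡ true → q x ≡ true) → # xs p ≤ # xs q
#-mono xs h = ∑-mono xs (λ x → 𝟙-mono (h x))

#≤length : (xs : List A) (p : A → Bool) → # xs p ≤ length xs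
#≤length xs p = ≤-trans (∑-mono xs (λ x → 𝟙≤1 (p x))) (≤-reflexive (trans (∑-const xs 1) (*-identityʳ _)))

#-exists : (xs : List A) (p : A → Bool) → 0 < # xs p → ∃ λ x → x ∈ xs × p x ≡ true
#-exists (x ∷ xs) p h with p x in eq
... | true  = x , here refl , eq
... | false with #-exists xs p h
...   | y , i , py = y , there i , py

#-none : (xs : List A) (p : A → Bool) → (∀ {x} → x ∈ xs → p x ≡ true → ⊥) → # xs p ≡ 0
#-none []       p h = refl
#-none (x ∷ xs) p h with p x in eq
... | true  = ⊥-elim (h (here refl) eq)
... | false = #-none xs p (λ i → h (there i))

-- Codegree and colour bounds are known only for walks that survive, so a member of the family must
-- be in hand before its bound can be applied to the whole family.
#≤-by-member : (xs : List A) (p : A → Bool) (r : ℕ) →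
  (∀ x → p x ≡ true → # xs p ≤ r) → # xs p ≤ r
#≤-by-member xs p r h with 0 <? # xs p
... | no  n  = ≤-trans (≮⇒≥ n) z≤n
... | yes 0< with #-exists xs p 0<
...   | x , _ , px = h x px

#≤1 : {xs : List A} (p : A → Bool) → Unique xs →
  (∀ x y → p x ≡ true → p y ≡ true → x ≡ y) → # xs p ≤ 1
#≤1 {xs = []}     p _          h = z≤n
#≤1 {xs = x ∷ xs} p (x∉ ∷ uxs) h with p x in eq
... | false = #≤1 p uxs h
... | true  = s≤s (≤-reflexive (#-none xs p (λ {y} i py → All.lookup x∉ i (h x y eq py))))

does-sound : {P : Set} (d : Dec P) → does d ≡ true → P
does-sound (yes p) _ = p

#-injection : {xs : List A} {ys : List B} (_≟_ : (b b′ : B) → Dec (b ≡ b′)) (p : A → Bool) (q : B → Bool)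
  (f : A → B) → Unique xs → (∀ x → f x ∈ ys) →
  (∀ x → p x ≡ true → q (f x) ≡ true) →
  (∀ x y → p x ≡ true → p y ≡ true → f x ≡ f y → x ≡ y) →
  # xs p ≤ # ys q
#-injection {A} {B} {xs} {ys} _≟_ p q f u f∈ pq inj = begin
  # xs p                                                     ≤⟨ ∑-mono xs one ⟩
  ∑ xs (λ x → ∑ ys (λ v → 𝟙 (q v) * 𝟙 (hits v x)))          ≡⟨ ∑-swap xs ys _ ⟩
  ∑ ys (λ v → ∑ xs (λ x → 𝟙 (q v) * 𝟙 (hits v x)))          ≡⟨ ∑-cong ys (λ v → ∑-*ˡ xs (𝟙 (q v)) _) ⟩
  ∑ ys (λ v → 𝟙 (q v) * # xs (hits v))                       ≤⟨ ∑-mono ys (λ v → *-monoʳ-≤ (𝟙 (q v)) (few v)) ⟩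
  ∑ ys (λ v → 𝟙 (q v) * 1)                                   ≡⟨ ∑-cong ys (λ v → *-identityʳ _) ⟩
  # ys q                                                     ∎
  where
  open ≤-Reasoning
  hits : B → A → Bool
  hits v x = p x ∧ does (f x ≟ v)
  hit-eq : ∀ v x → hits v x ≡ true → f x ≡ v
  hit-eq v x h = does-sound (f x ≟ v) (proj₂ (∧-split {p x} h))
  few : ∀ v → # xs (hits v) ≤ 1
  few v = #≤1 (hits v) u (λ x y hx hy →
    inj x y (proj₁ (∧-split hx)) (proj₁ (∧-split hy)) (trans (hit-eq v x hx) (≡-sym (hit-eq v y hy))))
  one : ∀ x → 𝟙 (p x) ≤ ∑ ys (λ v → 𝟙 (q v) * 𝟙 (hits v x))
  one x with p x in eq
  ... | false = z≤n
  ... | true  = ≤-trans (≤-reflexive (≡-sym e)) (term≤∑ _ (f∈ x))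
    where
    e : 𝟙 (q (f x)) * 𝟙 (does (f x ≟ f x)) ≡ 1
    e rewrite pq x eq | dec-true (f x ≟ f x) refl = refl

-- Each property in `ks` excludes at most `r` objects, so the strict inequality persists when one
-- property is dealt with and removed from the list.
avoid : (xs : List A) (p : A → Bool) (r : ℕ) (ks : List (A → Bool)) →
  All (λ κ → # xs (λ x → p x ∧ κ x) ≤ r) ks → r * length ks < # xs p →
  ∃ λ x → p x ≡ true × All (λ κ → κ x ≡ false) ks
avoid xs p r [] [] h with #-exists xs p (≤-trans (s≤s z≤n) h)
... | x , _ , px = x , px , []
avoid {A} xs p r (κ ∷ ks) (b ∷ bs) h with avoid xs p′ r ks bs′ h′
  where
  p′ : A → Bool
  p′ x = p x ∧ not (κ x)
  bs′ : All (λ κ → # xs (λ x → p′ x ∧ κ x) ≤ r) ks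
  bs′ = All.map (λ {κ′} → ≤-trans (#-mono xs (λ x e →
    ∧-join (proj₁ (∧-split (proj₁ (∧-split e)))) (proj₂ (∧-split {p′ x} e))))) bs
  h′ : r * length ks < # xs p′
  h′ = +-cancelˡ-< r _ _ (<-≤-trans
    (subst (_< # xs p) (*-suc r (length ks)) h)
    (≤-trans (≤-reflexive (trans (∑-cong xs (λ x → 𝟙-split (p x) (κ x))) (∑-+ xs _ _)))
      (+-monoˡ-≤ _ b)))
... | x , px , al = x , proj₁ (∧-split px) , not-false (proj₂ (∧-split {p x} px)) ∷ al
  where
  not-false : ∀ {b} → not b ≡ true → b ≡ false
  not-false {false} _ = refl

removeAt-∈ : {x : A} {xs : List A} → x ∈ xs → List A
removeAt-∈ {xs = x ∷ xs} (here _)  = xs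
removeAt-∈ {xs = x ∷ xs} (there i) = x ∷ removeAt-∈ i

length-removeAt-∈ : {x : A} {xs : List A} (i : x ∈ xs) → length xs ≡ suc (length (removeAt-∈ i))
length-removeAt-∈ (here _)  = refl
length-removeAt-∈ (there i) = cong suc (length-removeAt-∈ i)

∈-removeAt-∈ : {x y : A} {xs : List A} (i : x ∈ xs) → y ∈ xs → y ≡ x ⊎ y ∈ removeAt-∈ i
∈-removeAt-∈ (here refl) (here refl) = inj₁ refl
∈-removeAt-∈ (here refl) (there j)   = inj₂ j
∈-removeAt-∈ (there i)   (here e)    = inj₂ (here e)
∈-removeAt-∈ (there i)   (there j)   with ∈-removeAt-∈ i j
... | inj₁ e = inj₁ e
... | inj₂ k = inj₂ (there k)

-- The analogue of passing to a subgraph of large minimum degree: labels meeting at most D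
-- objects are discarded together with these objects until none is left.
cleaning : {K : Set} (xs : List A) (D : ℕ) (inc : K → A → Bool) (L : List K) (p : A → Bool) →
  D * length L < # xs p →
  ∃ λ (q : A → Bool) → (∀ x → q x ≡ true → p x ≡ true) × 0 < # xs q ×
    (∀ ℓ → ℓ ∈ L → ∀ x → q x ≡ true → inc ℓ x ≡ true → D < # xs (λ y → q y ∧ inc ℓ y))
cleaning {A} {K} xs D inc L p h = go (length L) L refl p h
  where
  Clean : List K → (A → Bool) → Set
  Clean L p = ∃ λ (q : A → Bool) → (∀ x → q x ≡ true → p x ≡ true) × 0 < # xs q ×
    (∀ ℓ → ℓ ∈ L → ∀ x → q x ≡ true → inc ℓ x ≡ true → D < # xs (λ y → q y ∧ inc ℓ y))
  scan : (p : A → Bool) (L : List K) →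
    (∃ λ ℓ → ℓ ∈ L × # xs (λ y → p y ∧ inc ℓ y) ≤ D) ⊎ (∀ ℓ → ℓ ∈ L → D < # xs (λ y → p y ∧ inc ℓ y))
  scan p [] = inj₂ (λ ℓ ())
  scan p (ℓ ∷ L) with # xs (λ y → p y ∧ inc ℓ y) ≤? D | scan p L
  ... | yes s | _ = inj₁ (ℓ , here refl , s)
  ... | no _  | inj₁ (ℓ′ , i , s) = inj₁ (ℓ′ , there i , s)
  ... | no ns | inj₂ f = inj₂ (λ { ℓ (here refl) → ≰⇒> ns ; ℓ (there i) → f ℓ i })
  -- A discarded label takes at most `D` objects with it, so `D * length L < # xs p` persists; in
  -- particular, objects remain even if all labels go.
  go : ∀ m (L : List K) → length L ≡ m → (p : A → Bool) → D * length L < # xs p → Clean L p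
  go m L eq p h with scan p L
  ... | inj₂ f = p , (λ _ e → e) , ≤-trans (s≤s z≤n) h , (λ ℓ i x _ _ → f ℓ i)
  go zero [] eq p h | inj₁ (ℓ , () , s)
  go (suc m) L eq p h | inj₁ (ℓ , i , s) = extend (go m L′ eq′ p′ h′)
    where
    L′ = removeAt-∈ i
    eq′ : length L′ ≡ m
    eq′ = suc-injective (trans (≡-sym (length-removeAt-∈ i)) eq)
    p′ : A → Bool
    p′ x = p x ∧ not (inc ℓ x)
    h′ : D * length L′ < # xs p′
    h′ = +-cancelˡ-< D _ _ (<-≤-trans
      (subst (_< # xs p) (trans (cong (D *_) (length-removeAt-∈ i)) (*-suc D (length L′))) h)
      (≤-trans (≤-reflexive (trans (∑-cong xs (λ x → 𝟙-split (p x) (inc ℓ x))) (∑-+ xs _ _)))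
        (+-monoˡ-≤ _ s)))
    extend : Clean L′ p′ → Clean L p
    extend (q , sub , pos , big) = q , (λ x qx → proj₁ (∧-split (sub x qx))) , pos , big′
      where
      big′ : ∀ ℓ₁ → ℓ₁ ∈ L → ∀ x → q x ≡ true → inc ℓ₁ x ≡ true → D < # xs (λ y → q y ∧ inc ℓ₁ y)
      big′ ℓ₁ j x qx ix with ∈-removeAt-∈ i j
      ... | inj₂ k = big ℓ₁ k x qx ix
      -- This label was discarded together with all objects meeting it, so no survivor `x` meets it.
      ... | inj₁ refl with inc ℓ x | proj₂ (∧-split {p x} (sub x qx))
      big′ ℓ₁ j x qx () | inj₁ refl | false | _
      big′ ℓ₁ j x qx _ | inj₁ refl | true | ()

-- Rainbow paths and cycles

nth : {A : Set} → A → List A → ℕ → A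
nth d []       i       = d
nth d (x ∷ xs) zero    = x
nth d (x ∷ xs) (suc i) = nth d xs i

nth-∈ : {A : Set} (d : A) (xs : List A) (i : ℕ) → i < length xs → nth d xs i ∈ xs
nth-∈ d (x ∷ xs) zero    _       = here refl
nth-∈ d (x ∷ xs) (suc i) (s≤s h) = there (nth-∈ d xs i h)

nth-length : {A : Set} (d : A) (xs : List A) → nth d xs (length xs) ≡ d
nth-length d []       = refl
nth-length d (x ∷ xs) = nth-length d xs

nth-injective : {A : Set} (d : A) {xs : List A} → Unique xs → ∀ {i j} → i < length xs → j < length xs →
  nth d xs i ≡ nth d xs j → i ≡ j
nth-injective d (_ ∷ _)  {zero}  {zero}  _ _ _ = refl
nth-injective d {x ∷ xs} (x∉ ∷ _) {zero}  {suc j} _ (s≤s hj) e = ⊥-elim (All.lookup x∉ (nth-∈ d xs j hj) e)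
nth-injective d {x ∷ xs} (x∉ ∷ _) {suc i} {zero}  (s≤s hi) _ e = ⊥-elim (All.lookup x∉ (nth-∈ d xs i hi) (≡-sym e))
nth-injective d (_ ∷ u) {suc i} {suc j} (s≤s hi) (s≤s hj) e = cong suc (nth-injective d u hi hj e)

toℕ-csuc : ∀ {m} (i : Fin (suc m)) → toℕ (csuc i) ≡ suc (toℕ i) % suc m
toℕ-csuc {m} i = toℕ-fromℕ< (m%n<n (suc (toℕ i)) (suc m))

toℕ-csuc-< : ∀ {m} (i : Fin (suc m)) → toℕ i < m → toℕ (csuc i) ≡ suc (toℕ i)
toℕ-csuc-< i h = trans (toℕ-csuc i) (m<n⇒m%n≡m (s≤s h))

toℕ-csuc-last : ∀ {m} (i : Fin (suc m)) → toℕ i ≡ m → toℕ (csuc i) ≡ 0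
toℕ-csuc-last {m} i e = trans (toℕ-csuc i) (trans (cong (λ k → suc k % suc m) e) (n%n≡0 (suc m)))

module _ {n : ℕ} (G : PCGraph n) where

  vertices : List (Fin n)
  vertices = allFin n

  vertices-unique : Unique vertices
  vertices-unique = allFin⁺ n

  adj : Fin n → Fin n → Bool
  adj = isEdgeᵇ G

  adj-just : ∀ {u v c} → col G u v ≡ just c → adj u v ≡ true
  adj-just {u} {v} e with col G u v
  adj-just refl | just _ = refl

  adj-colour : ∀ {u v} → adj u v ≡ true → ∃ λ c → col G u v ≡ just c
  adj-colour {u} {v} h with col G u v
  ... | just c = c , refl

  adj-sym : ∀ u v → adj u v ≡ adj v u
  adj-sym u v with col G u v in e₁ | col G v u in e₂
  ... | just _  | just _  = refl
  ... | nothing | nothing = refl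
  ... | just _  | nothing with trans (≡-sym e₁) (trans (sym G u v) e₂)
  ...   | ()
  adj-sym u v | nothing | just _ with trans (≡-sym e₁) (trans (sym G u v) e₂)
  ...   | ()

  adj-irrefl : ∀ {u v} → adj u v ≡ true → u ≢ v
  adj-irrefl {u} h refl with adj-colour h
  ... | c , e with trans (≡-sym (irrefl G u)) e
  ...   | ()

  _≟ᶜ_ : (a b : Maybe ℕ) → Dec (a ≡ b)
  _≟ᶜ_ = ≡-dec _≟ⁿ_

  hasColour : Fin n → Fin n → ℕ → Bool
  hasColour u v c = does (col G u v ≟ᶜ just c)

  hasColour-sound : ∀ {u v c} → hasColour u v c ≡ true → col G u v ≡ just c
  hasColour-sound {u} {v} {c} h with col G u v ≟ᶜ just c
  ... | yes e = e

  hasColour-complete : ∀ {u v c} → col G u v ≡ just c → hasColour u v c ≡ true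
  hasColour-complete {u} {v} {c} e = dec-true (col G u v ≟ᶜ just c) e

  proper′ : ∀ {u v w c} → col G v u ≡ just c → col G w u ≡ just c → v ≡ w
  proper′ {u} {v} {w} {c} e₁ e₂ = proper G u v w c (trans (sym G u v) e₁) (trans (sym G u w) e₂)

  -- A rainbow path from s, with its vertices and colours listed from the current end backwards.
  data Trail (s : Fin n) : Fin n → List (Fin n) → List ℕ → Set where
    start  : Trail s s [ s ] []
    extend : ∀ {v w c vs cs} → Trail s v vs cs → col G v w ≡ just c → w ∉ vs → c ∉ cs →
             Trail s w (w ∷ vs) (c ∷ cs)

  trail-length : ∀ {s v vs cs} → Trail s v vs cs → length vs ≡ suc (length cs)
  trail-length start            = refl
  trail-length (extend t _ _ _) = cong suc (trail-length t)

  ∉⇒All≢ : {A : Set} {x : A} {xs : List A} → x ∉ xs → All (x ≢_) xs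
  ∉⇒All≢ h = All.tabulate (λ { i refl → h i })

  trail-unique : ∀ {s v vs cs} → Trail s v vs cs → Unique vs
  trail-unique start            = [] ∷ []
  trail-unique (extend t _ h _) = ∉⇒All≢ h ∷ trail-unique t

  trail-rainbow : ∀ {s v vs cs} → Trail s v vs cs → Unique cs
  trail-rainbow start            = []
  trail-rainbow (extend t _ _ h) = ∉⇒All≢ h ∷ trail-rainbow t

  trail-head : ∀ {s v vs cs} d → Trail s v vs cs → nth d vs 0 ≡ v
  trail-head d start            = refl
  trail-head d (extend _ _ _ _) = refl

  trail-last : ∀ {s v vs cs} d → Trail s v vs cs → nth d vs (length cs) ≡ s
  trail-last d start            = refl
  trail-last d (extend t _ _ _) = trail-last d t

  trail-edge : ∀ {s v vs cs} d c → Trail s v vs cs → ∀ i → i < length cs →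
    col G (nth d vs i) (nth d vs (suc i)) ≡ just (nth c cs i)
  trail-edge d c (extend {v} {w} t e _ _) zero _ =
    trans (cong (col G w) (trail-head d t)) (trans (sym G w v) e)
  trail-edge d c (extend t _ _ _) (suc i) (s≤s h) = trail-edge d c t i h

  trail-start-∈ : ∀ {s v vs cs} → Trail s v vs cs → s ∈ vs
  trail-start-∈ start            = here refl
  trail-start-∈ (extend t _ _ _) = there (trail-start-∈ t)

  trail-end-∈ : ∀ {s v vs cs} → Trail s v vs cs → v ∈ vs
  trail-end-∈ start            = here refl
  trail-end-∈ (extend t _ _ _) = here refl

  close-trail : ∀ {s v vs cs c m} → Trail s v vs cs → col G v s ≡ just c → c ∉ cs → length vs ≡ m →
    RainbowCycle G m
  close-trail {s} {v} {vs} {cs} {c} t e c∉ refl rewrite trail-length t = vertex , colour , vertex-inj , colour-inj , edge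
    where
    vertex : Fin (suc (length cs)) → Fin n
    vertex i = nth s vs (toℕ i)
    -- The default `c` is the colour of the closing edge: it is what the position just after the end
    -- of `cs` returns.
    colour : Fin (suc (length cs)) → ℕ
    colour i = nth c cs (toℕ i)
    vertex-inj : ∀ {i j} → vertex i ≡ vertex j → i ≡ j
    vertex-inj {i} {j} eq = toℕ-injective (nth-injective s (trail-unique t) (bound i) (bound j) eq)
      where
      bound : (i : Fin (suc (length cs))) → toℕ i < length vs
      bound i rewrite trail-length t = toℕ<n i
    last-or-< : (i : Fin (suc (length cs))) → toℕ i < length cs ⊎ toℕ i ≡ length cs
    last-or-< i = m≤n⇒m<n∨m≡n (≤-pred (toℕ<n i))
    colour-last : ∀ i → toℕ i ≡ length cs → colour i ≡ c
    colour-last i eq = trans (cong (nth c cs) eq) (nth-length c cs)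
    colour-inj : ∀ {i j} → colour i ≡ colour j → i ≡ j
    colour-inj {i} {j} eq with last-or-< i | last-or-< j
    ... | inj₁ hi | inj₁ hj = toℕ-injective (nth-injective c (trail-rainbow t) hi hj eq)
    ... | inj₂ hi | inj₂ hj = toℕ-injective (trans hi (≡-sym hj))
    ... | inj₁ hi | inj₂ hj = ⊥-elim (c∉ (subst (_∈ cs) (trans eq (colour-last j hj)) (nth-∈ c cs _ hi)))
    ... | inj₂ hi | inj₁ hj = ⊥-elim (c∉ (subst (_∈ cs) (trans (≡-sym eq) (colour-last i hi)) (nth-∈ c cs _ hj)))
    edge : ∀ i → col G (vertex i) (vertex (csuc i)) ≡ just (colour i)
    -- The list runs backwards from the end of the trail: the last position holds `s`, and its
    -- cyclic successor, position 0, holds `v`.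
    edge i with last-or-< i
    ... | inj₁ h = trans (cong (λ k → col G (vertex i) (nth s vs k)) (toℕ-csuc-< i h)) (trail-edge s c t (toℕ i) h)
    ... | inj₂ h = trans (cong₂ (col G) v-last v-first) (trans (sym G s v) (trans e (cong just (≡-sym (colour-last i h)))))
      where
      v-last : vertex i ≡ s
      v-last = trans (cong (nth s vs) h) (trail-last s t)
      v-first : vertex (csuc i) ≡ v
      v-first = trans (cong (nth s vs) (toℕ-csuc-last i h)) (trail-head s t)

-- Greedy choice avoiding used vertices and colours

#-∨ : {A : Set} (xs : List A) (p a b : A → Bool) →
  # xs (λ x → p x ∧ (a x ∨ b x)) ≤ # xs (λ x → p x ∧ a x) + # xs (λ x → p x ∧ b x)
#-∨ xs p a b = ≤-trans (∑-mono xs (λ x → bound (p x) (a x) (b x))) (≤-reflexive (∑-+ xs _ _))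
  where
  bound : ∀ p a b → 𝟙 (p ∧ (a ∨ b)) ≤ 𝟙 (p ∧ a) + 𝟙 (p ∧ b)
  bound false a     b = z≤n
  bound true  true  b = m≤m+n 1 _
  bound true  false b = ≤-refl

∨-false : ∀ {a b} → a ∨ b ≡ false → a ≡ false × b ≡ false
∨-false {false} {false} _ = refl , refl

avoid-two : {A I J : Set} (xs : List A) (p : A → Bool) (r : ℕ)
  (κ : I → A → Bool) (is : List I) (μ : J → A → Bool) (js : List J) →
  (∀ i → # xs (λ x → p x ∧ κ i x) ≤ r) → (∀ j → # xs (λ x → p x ∧ μ j x) ≤ r) →
  r * (length is + length js) < # xs p →
  ∃ λ x → p x ≡ true × (∀ {i} → i ∈ is → κ i x ≡ false) × (∀ {j} → j ∈ js → μ j x ≡ false)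
avoid-two xs p r κ is μ js bκ bμ h with avoid xs p r (map κ is ++ map μ js)
  (AllP.++⁺ (AllP.map⁺ (All.universal bκ is)) (AllP.map⁺ (All.universal bμ js)))
  (subst (λ l → r * l < # xs p) (≡-sym (trans (length-++ (map κ is)) (cong₂ _+_ (length-map κ is) (length-map μ js)))) h)
... | x , px , al = x , px , All.lookup (AllP.map⁻ (AllP.++⁻ˡ (map κ is) al)) ,
                            All.lookup (AllP.map⁻ (AllP.++⁻ʳ (map κ is) al))

∈-pairs : ∀ {n} (t : Fin n × Fin n) → t ∈ cartesianProduct (allFin n) (allFin n)
∈-pairs (u , v) = ∈-cartesianProduct⁺ (∈-allFin u) (∈-allFin v)

does-≟⇒≡ : ∀ {n} {u v : Fin n} → does (u ≟ᶠ v) ≡ true → u ≡ v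
does-≟⇒≡ {u = u} {v} = does-sound (u ≟ᶠ v)

does-≟-refl : ∀ {n} (u : Fin n) → does (u ≟ᶠ u) ≡ true
does-≟-refl u = dec-true (u ≟ᶠ u) refl

∉-from-does : ∀ {n} {u : Fin n} {vs} → (∀ {v} → v ∈ vs → does (u ≟ᶠ v) ≡ false) → u ∉ vs
∉-from-does {u = u} h i = true≢false (does-≟-refl u) (h i)

does-<⇒< : ∀ {a b} → does (a <? b) ≡ true → a < b
does-<⇒< {a} {b} h = <ᵇ⇒< a b (subst T (≡-sym h) tt)

-- Heavy pairs and rainbow cycles through a vertex

module _ {n : ℕ} (G : PCGraph n) where

  deg : Fin n → ℕ
  deg v = # (vertices G) (adj G v)

  codeg : Fin n → Fin n → ℕ
  codeg u v = # (vertices G) (λ w → adj G u w ∧ adj G v w)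

  ∉-from-hasColour : ∀ {u v c cs} → col G u v ≡ just c → (∀ {d} → d ∈ cs → hasColour G u v d ≡ false) → c ∉ cs
  ∉-from-hasColour e h i = true≢false (hasColour-complete G e) (h i)

  trail-end≢start : ∀ {s v vs cs} → Trail G s v vs cs → 2 ≤ length vs → v ≢ s
  trail-end≢start start (s≤s ()) _
  trail-end≢start (extend t _ h _) _ refl = h (trail-start-∈ G t)

  trail-colours≤ : ∀ {s v vs cs m} → Trail G s v vs cs → length vs ≤ m → length cs ≤ m
  trail-colours≤ {cs = cs} t h = ≤-trans (n≤1+n _) (subst (_≤ _) (trail-length G t) h)

  -- `E` is abstract because it is a neighbour of `x` in one application and an edge `(u , y)`, of
  -- which `y` continues the trail, in the other. Each of the `j` rounds adds a new `z` and a new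
  -- tip; one more `z` is added at the end, since the cycle is closed from a `z`.
  alternate : {E : Set} (tip : E → Fin n) (Q : E → Fin n → Set) (m : ℕ) →
    (∀ e z vs cs → Q e z → length vs ≤ m → length cs ≤ m →
      ∃ λ z′ → Q e z′ × z′ ∉ vs × ∃ λ c → col G (tip e) z′ ≡ just c × c ∉ cs) →
    (∀ e z vs cs → Q e z → length vs ≤ m → length cs ≤ m →
      ∃ λ e′ → Q e′ z × tip e′ ∉ vs × ∃ λ c → col G z (tip e′) ≡ just c × c ∉ cs) →
    ∀ {s} j {e z vs cs} → Trail G s (tip e) vs cs → Q e z → length vs + 2 * j ≤ m →
    ∃ λ e′ → ∃ λ z′ → ∃ λ vs′ → ∃ λ cs′ → Trail G s z′ vs′ cs′ × Q e′ z′ × length vs′ ≡ suc (length vs + 2 * j)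
  alternate tip Q m nextZ nextE zero {e} {z} {vs} {cs} t qez h
    with nextZ e z vs cs qez (≤-trans (m≤m+n _ _) h) (trail-colours≤ t (≤-trans (m≤m+n _ _) h))
  ... | z′ , q , z′∉ , c , ce , c∉ = e , z′ , _ , _ , extend t ce z′∉ c∉ , q , cong suc (≡-sym (+-identityʳ _))
  alternate tip Q m nextZ nextE (suc j) {e} {z} {vs} {cs} t qez h
    with nextZ e z vs cs qez (≤-trans (m≤m+n _ _) h) (trail-colours≤ t (≤-trans (m≤m+n _ _) h))
  ... | z′ , q , z′∉ , c , ce , c∉
    with nextE e z′ (z′ ∷ vs) (c ∷ cs) q (≤-trans (grow (length vs) j) h)
           (trail-colours≤ (extend t ce z′∉ c∉) (≤-trans (grow (length vs) j) h))
    where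
    grow : ∀ a j → suc a ≤ a + 2 * suc j
    grow a j = subst (suc a ≤_) (eq a j) (m≤m+n (suc a) _)
      where
      eq : ∀ a j → suc a + suc (2 * j) ≡ a + 2 * suc j
      eq = solve-∀
  ... | e′ , q′ , e′∉ , c′ , ce′ , c′∉
    with alternate tip Q m nextZ nextE j (extend (extend t ce z′∉ c∉) ce′ e′∉ c′∉) q′ (subst (_≤ m) (≡-sym (eq (length vs) j)) h)
    where
    eq : ∀ a j → suc (suc a) + 2 * j ≡ a + 2 * suc j
    eq = solve-∀
  ... | e″ , z″ , vs″ , cs″ , t″ , q″ , len = e″ , z″ , vs″ , cs″ , t″ , q″ , trans len (cong suc (eq (length vs) j))
    where
    eq : ∀ a j → suc (suc a) + 2 * j ≡ a + 2 * suc j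
    eq = solve-∀

  module _ (D : ℕ) where

    heavy : Fin n → Fin n → Bool
    heavy u v = does (D <? codeg u v)

  module _ (k m d₀ D : ℕ) (m-def : m ≡ 4 + 2 * k) (d₀-def : d₀ ≡ 6 * m) (D-def : D ≡ 2 * d₀)
           (norainbow : ¬ RainbowCycle G m) where

    module _ (x : Fin n) where

      private
        pairs : List (Fin n × Fin n)
        pairs = cartesianProduct (vertices G) (vertices G)

        -- A bipartite graph between the neighbours of `x` and the vertices heavy to `x`. A path
        -- that alternates in it is a path of `G`, and from each vertex on the heavy side `x` can be
        -- reached in two steps.
        edge : Fin n × Fin n → Bool
        edge (y , w) = adj G x y ∧ (adj G y w ∧ heavy D x w)

        inc : Fin n ⊎ Fin n → Fin n × Fin n → Bool
        inc (inj₁ y′) (y , w) = does (y ≟ᶠ y′)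
        inc (inj₂ w′) (y , w) = does (w ≟ᶠ w′)

        nbrs heavies : List (Fin n)
        nbrs    = filterᵇ (adj G x) (vertices G)
        heavies = filterᵇ (heavy D x) (vertices G)

        labels : List (Fin n ⊎ Fin n)
        labels = map inj₁ nbrs ++ map inj₂ heavies

        pairs-unique : Unique pairs
        pairs-unique = cartesianProduct⁺ (vertices-unique G) (vertices-unique G)

        Survives : (Fin n × Fin n → Bool) → Set
        Survives q = ∀ ℓ → ℓ ∈ labels → ∀ t → q t ≡ true → inc ℓ t ≡ true → d₀ < # pairs (λ t′ → q t′ ∧ inc ℓ t′)

        -- The origin of `d₀`: at most `m` vertices and `m` colours are in use, and each may rule
        -- out up to three links.
        room : ∀ r (vs : List (Fin n)) (cs : List ℕ) → r ≤ 3 → length vs ≤ m → length cs ≤ m → r * (length vs + length cs) ≤ d₀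
        room r vs cs hr hv hc = ≤-trans (*-mono-≤ hr (+-mono-≤ hv hc)) (≤-reflexive (trans (eq m) (≡-sym d₀-def)))
          where
          eq : ∀ m → 3 * (m + m) ≡ 6 * m
          eq = solve-∀

        module _ (q : Fin n × Fin n → Bool) (sub : ∀ t → q t ≡ true → edge t ≡ true) (big : Survives q) where

          Q : Fin n → Fin n → Set
          Q y w = q (y , w) ≡ true

          Q-xy : ∀ {y w} → Q y w → adj G x y ≡ true
          Q-xy {y} {w} h = proj₁ (∧-split (sub (y , w) h))

          Q-yw : ∀ {y w} → Q y w → adj G y w ≡ true
          Q-yw {y} {w} h = proj₁ (∧-split {adj G y w} (proj₂ (∧-split {adj G x y} (sub (y , w) h))))

          Q-heavy : ∀ {y w} → Q y w → heavy D x w ≡ true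
          Q-heavy {y} {w} h = proj₂ (∧-split {adj G y w} (proj₂ (∧-split {adj G x y} (sub (y , w) h))))

          big-y : ∀ {y w} → Q y w → d₀ < # pairs (λ t → q t ∧ inc (inj₁ y) t)
          big-y {y} {w} h = big (inj₁ y)
            (∈-++⁺ˡ (∈-map⁺ inj₁ (∈-filterᵇ (adj G x) (∈-allFin y) (Q-xy h)))) (y , w) h (does-≟-refl y)

          big-w : ∀ {y w} → Q y w → d₀ < # pairs (λ t → q t ∧ inc (inj₂ w) t)
          big-w {y} {w} h = big (inj₂ w)
            (∈-++⁺ʳ (map inj₁ nbrs) (∈-map⁺ inj₂ (∈-filterᵇ (heavy D x) (∈-allFin w) (Q-heavy h)))) (y , w) h (does-≟-refl w)

          at-y : ∀ y t → q t ∧ inc (inj₁ y) t ≡ true → proj₁ t ≡ y × q t ≡ true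
          at-y y (y′ , w) e = does-≟⇒≡ (proj₂ (∧-split {q (y′ , w)} e)) , proj₁ (∧-split e)

          at-w : ∀ w t → q t ∧ inc (inj₂ w) t ≡ true → proj₂ t ≡ w × q t ≡ true
          at-w w (y , w′) e = does-≟⇒≡ (proj₂ (∧-split {q (y , w′)} e)) , proj₁ (∧-split e)

          few-w : ∀ y (κ : Fin n → Bool) → (∀ {w w′} → κ w ≡ true → κ w′ ≡ true → w ≡ w′) →
            # pairs (λ t → (q t ∧ inc (inj₁ y) t) ∧ κ (proj₂ t)) ≤ 1
          few-w y κ h = #≤1 _ pairs-unique same
            where
            same : ∀ t t′ → (q t ∧ inc (inj₁ y) t) ∧ κ (proj₂ t) ≡ true → (q t′ ∧ inc (inj₁ y) t′) ∧ κ (proj₂ t′) ≡ true → t ≡ t′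
            same t t′ e e′ = cong₂ _,_
              (trans (proj₁ (at-y y t (proj₁ (∧-split e)))) (≡-sym (proj₁ (at-y y t′ (proj₁ (∧-split e′))))))
              (h (proj₂ (∧-split {q t ∧ inc (inj₁ y) t} e)) (proj₂ (∧-split {q t′ ∧ inc (inj₁ y) t′} e′)))

          few-y : ∀ w (κ : Fin n → Bool) → (∀ {y y′} → κ y ≡ true → κ y′ ≡ true → y ≡ y′) →
            # pairs (λ t → (q t ∧ inc (inj₂ w) t) ∧ κ (proj₁ t)) ≤ 1
          few-y w κ h = #≤1 _ pairs-unique same
            where
            same : ∀ t t′ → (q t ∧ inc (inj₂ w) t) ∧ κ (proj₁ t) ≡ true → (q t′ ∧ inc (inj₂ w) t′) ∧ κ (proj₁ t′) ≡ true → t ≡ t′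
            same t t′ e e′ = cong₂ _,_
              (h (proj₂ (∧-split {q t ∧ inc (inj₂ w) t} e)) (proj₂ (∧-split {q t′ ∧ inc (inj₂ w) t′} e′)))
              (trans (proj₁ (at-w w t (proj₁ (∧-split e)))) (≡-sym (proj₁ (at-w w t′ (proj₁ (∧-split e′))))))

          same-vertex : (v : Fin n) {w w′ : Fin n} → does (w ≟ᶠ v) ≡ true → does (w′ ≟ᶠ v) ≡ true → w ≡ w′
          same-vertex v h h′ = trans (does-≟⇒≡ h) (≡-sym (does-≟⇒≡ h′))

          same-colour : (v : Fin n) (c : ℕ) {w w′ : Fin n} → hasColour G v w c ≡ true → hasColour G v w′ c ≡ true → w ≡ w′
          same-colour v c {w} {w′} h h′ = proper G v w w′ c (hasColour-sound G h) (hasColour-sound G h′)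

          nextZ : ∀ y w vs cs → Q y w → length vs ≤ m → length cs ≤ m →
            ∃ λ w′ → Q y w′ × w′ ∉ vs × ∃ λ c → col G y w′ ≡ just c × c ∉ cs
          nextZ y w vs cs h hv hc = found (avoid-two pairs (λ t → q t ∧ inc (inj₁ y) t) 1
              (λ v t → does (proj₂ t ≟ᶠ v)) vs (λ c t → hasColour G y (proj₂ t) c) cs
              (λ v → few-w y (λ w → does (w ≟ᶠ v)) (same-vertex v))
              (λ c → few-w y (λ w → hasColour G y w c) (same-colour y c))
              (≤-<-trans (room 1 vs cs (s≤s z≤n) hv hc) (big-y h)))
            where
            found : (∃ λ t → q t ∧ inc (inj₁ y) t ≡ true × (∀ {v} → v ∈ vs → does (proj₂ t ≟ᶠ v) ≡ false) ×
                       (∀ {c} → c ∈ cs → hasColour G y (proj₂ t) c ≡ false)) →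
              ∃ λ w′ → Q y w′ × w′ ∉ vs × ∃ λ c → col G y w′ ≡ just c × c ∉ cs
            found ((y′ , w′) , e , fv , fc) with at-y y (y′ , w′) e
            ... | refl , qt with adj-colour G (Q-yw qt)
            ...   | c , ce = w′ , qt , ∉-from-does fv , c , ce , ∉-from-hasColour ce fc

          nextY : ∀ y w vs cs → Q y w → length vs ≤ m → length cs ≤ m →
            ∃ λ y′ → Q y′ w × y′ ∉ vs × ∃ λ c → col G w y′ ≡ just c × c ∉ cs × ∃ λ c′ → col G x y′ ≡ just c′ × c′ ∉ cs
          nextY y w vs cs h hv hc = found (avoid-two pairs (λ t → q t ∧ inc (inj₂ w) t) 2
              (λ v t → does (proj₁ t ≟ᶠ v)) vs (λ c t → hasColour G w (proj₁ t) c ∨ hasColour G x (proj₁ t) c) cs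
              (λ v → ≤-trans (few-y w (λ y → does (y ≟ᶠ v)) (same-vertex v)) (s≤s z≤n))
              (λ c → ≤-trans (#-∨ pairs _ (λ t → hasColour G w (proj₁ t) c) (λ t → hasColour G x (proj₁ t) c))
                (+-mono-≤ (few-y w (λ y → hasColour G w y c) (same-colour w c))
                          (few-y w (λ y → hasColour G x y c) (same-colour x c))))
              (≤-<-trans (room 2 vs cs (s≤s (s≤s z≤n)) hv hc) (big-w h)))
            where
            found : (∃ λ t → q t ∧ inc (inj₂ w) t ≡ true × (∀ {v} → v ∈ vs → does (proj₁ t ≟ᶠ v) ≡ false) ×
                       (∀ {c} → c ∈ cs → hasColour G w (proj₁ t) c ∨ hasColour G x (proj₁ t) c ≡ false)) →
              ∃ λ y′ → Q y′ w × y′ ∉ vs × ∃ λ c → col G w y′ ≡ just c × c ∉ cs × ∃ λ c′ → col G x y′ ≡ just c′ × c′ ∉ cs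
            found ((y′ , w′) , e , fv , fc) with at-w w (y′ , w′) e
            ... | refl , qt with adj-colour G (trans (adj-sym G w y′) (Q-yw qt)) | adj-colour G (Q-xy qt)
            ...   | c , ce | c′ , ce′ = y′ , qt , ∉-from-does fv , c , ce ,
                      ∉-from-hasColour ce (λ i → proj₁ (∨-false (fc i))) , c′ , ce′ ,
                      ∉-from-hasColour ce′ (λ i → proj₂ (∨-false {hasColour G w y′ _} (fc i)))

          nextY′ : ∀ y w vs cs → Q y w → length vs ≤ m → length cs ≤ m →
            ∃ λ y′ → Q y′ w × y′ ∉ vs × ∃ λ c → col G w y′ ≡ just c × c ∉ cs
          nextY′ y w vs cs h hv hc with nextY y w vs cs h hv hc
          ... | y′ , q , y∉ , c , e , c∉ , _ = y′ , q , y∉ , c , e , c∉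

          close : ∀ {y z vs cs} → Trail G x z vs cs → Q y z → length vs ≡ suc (2 + 2 * k) → RainbowCycle G m
          close {y} {z} {vs} {cs} t h len with nextY y z vs cs h (≤-trans (n≤1+n _) len′) (trail-colours≤ t (≤-trans (n≤1+n _) len′))
            where
            len′ : suc (length vs) ≤ m
            len′ = ≤-reflexive (trans (cong suc len) (≡-sym m-def))
          ... | y₃ , q₃ , y₃∉ , c , e , c∉ , c′ , e′ , c′∉ =
            close-trail G (extend t e y₃∉ c∉) (trans (sym G y₃ x) e′)
              -- If the last two edges had the same colour, properness at `y₃` would identify `z`
              -- with the start `x` of the trail.
              (λ { (here refl) → trail-end≢start t (subst (2 ≤_) (≡-sym len) (s≤s (s≤s z≤n))) (proper′ G e e′) ; (there i) → c′∉ i })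
              (trans (cong suc len) (≡-sym m-def))

          first-step : ∀ {y w c} → Q y w → col G x y ≡ just c → Trail G x y (y ∷ x ∷ []) (c ∷ [])
          first-step {y} h e = extend start e y∉ (λ ())
            where
            y∉ : y ∉ x ∷ []
            y∉ (here e) = adj-irrefl G (Q-xy h) (≡-sym e)

          start-length : 2 + 2 * k ≤ m
          start-length = ≤-trans (m≤n+m (2 + 2 * k) 2) (≤-reflexive (≡-sym m-def))

          link-cycle : ∀ {y w} → Q y w → RainbowCycle G m
          link-cycle {y} {w} h = let c , e = adj-colour G (Q-xy h) in
            -- The partner `w` may be `x` itself; only `y` enters the trail, and every later vertex
            -- is chosen fresh. The trail has `3 + 2 * k` vertices before `y₃` completes the cycle.
            finish (alternate (λ y → y) Q m nextZ nextY′ k (first-step h e) h start-length)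
            where
            finish : (∃ λ y′ → ∃ λ z′ → ∃ λ vs′ → ∃ λ cs′ → Trail G x z′ vs′ cs′ × Q y′ z′ × length vs′ ≡ suc (2 + 2 * k)) →
              RainbowCycle G m
            finish (_ , _ , _ , _ , t , h′ , len) = close t h′ len

        no-dense-link : # pairs edge ≤ d₀ * length labels
        no-dense-link = ≮⇒≥ contra
          where
          contra : ¬ (d₀ * length labels < # pairs edge)
          contra dense with cleaning pairs d₀ inc labels edge dense
          ... | q , sub , pos , big with #-exists pairs q pos
          ...   | _ , _ , h = norainbow (link-cycle q sub big h)

      heavy-codeg-∑ : ∑ (vertices G) (λ w → 𝟙 (heavy D x w) * codeg x w) ≡ # pairs edge
      heavy-codeg-∑ = begin-equality
        ∑ V (λ w → 𝟙 (heavy D x w) * codeg x w)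
          ≡⟨ ∑-cong V (λ w → ≡-sym (∑-*ˡ V (𝟙 (heavy D x w)) _)) ⟩
        ∑ V (λ w → ∑ V (λ y → 𝟙 (heavy D x w) * 𝟙 (adj G x y ∧ adj G w y)))
          ≡⟨ ∑-swap V V _ ⟩
        ∑ V (λ y → ∑ V (λ w → 𝟙 (heavy D x w) * 𝟙 (adj G x y ∧ adj G w y)))
          ≡⟨ ∑-cong V (λ y → ∑-cong V (λ w → reorder y w)) ⟩
        ∑ V (λ y → ∑ V (λ w → 𝟙 (edge (y , w))))
          ≡⟨ ∑-cartesianProduct V V _ ⟨
        # pairs edge ∎
        where
        open ≤-Reasoning
        V = vertices G
        bools : ∀ h a b → 𝟙 h * 𝟙 (a ∧ b) ≡ 𝟙 (a ∧ (b ∧ h))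
        bools true  true  true  = refl
        bools true  true  false = refl
        bools true  false b     = refl
        bools false true  true  = refl
        bools false true  false = refl
        bools false false b     = refl
        reorder : ∀ y w → 𝟙 (heavy D x w) * 𝟙 (adj G x y ∧ adj G w y) ≡ 𝟙 (edge (y , w))
        reorder y w rewrite adj-sym G w y = bools (heavy D x w) (adj G x y) (adj G y w)

      -- The number `h` of heavy vertices that appears in the bound on links is absorbed: each heavy
      -- vertex carries more than `D` links, so `D * h ≤ N`. Taking `D` as `2 * d₀` makes this just
      -- one of the two copies of `N`.
      heavy-codeg-bound : ∑ (vertices G) (λ w → 𝟙 (heavy D x w) * codeg x w) ≤ D * deg x
      heavy-codeg-bound = +-cancelʳ-≤ N N (D * deg x) (begin
        N + N                              ≡⟨ cong₂ _+_ heavy-codeg-∑ heavy-codeg-∑ ⟩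
        # pairs edge + # pairs edge        ≤⟨ +-mono-≤ no-dense-link no-dense-link ⟩
        d₀ * length labels + d₀ * length labels ≡⟨ cong (λ l → d₀ * l + d₀ * l) labels-length ⟩
        d₀ * (deg x + h) + d₀ * (deg x + h)     ≡⟨ eq d₀ (deg x) h ⟩
        2 * d₀ * deg x + 2 * d₀ * h        ≡⟨ cong (λ D → D * deg x + D * h) D-def ⟨
        D * deg x + D * h                  ≤⟨ +-monoʳ-≤ (D * deg x) Dh≤N ⟩
        D * deg x + N                      ∎)
        where
        open ≤-Reasoning
        V = vertices G
        N = ∑ V (λ w → 𝟙 (heavy D x w) * codeg x w)
        h = # V (heavy D x)
        labels-length : length labels ≡ deg x + h
        labels-length = trans (length-++ (map inj₁ nbrs)) (cong₂ _+_
          (trans (length-map inj₁ nbrs) (length-filterᵇ (adj G x) V))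
          (trans (length-map inj₂ heavies) (length-filterᵇ (heavy D x) V)))
        eq : ∀ a b c → a * (b + c) + a * (b + c) ≡ 2 * a * b + 2 * a * c
        eq = solve-∀
        each : ∀ w → D * 𝟙 (heavy D x w) ≤ 𝟙 (heavy D x w) * codeg x w
        each w with heavy D x w in e
        ... | false = ≤-reflexive (*-zeroʳ D)
        ... | true  = ≤-trans (≤-reflexive (*-identityʳ D)) (≤-trans (<⇒≤ (does-<⇒< e)) (≤-reflexive (≡-sym (*-identityˡ _))))
        Dh≤N : D * h ≤ N
        Dh≤N = ≤-trans (≤-reflexive (≡-sym (∑-*ˡ V D _))) (∑-mono V each)

-- Walks

2ab≤a²+b² : ∀ a b → a * b + a * b ≤ a * a + b * b
2ab≤a²+b² a b with ≤-total a b
... | inj₁ a≤b with m≤n⇒∃[o]m+o≡n a≤b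
...   | d , refl = ≤-trans (m≤m+n _ (d * d)) (≤-reflexive (eq a d))
  where
  eq : ∀ a d → a * (a + d) + a * (a + d) + d * d ≡ a * a + (a + d) * (a + d)
  eq = solve-∀
2ab≤a²+b² a b | inj₂ b≤a with m≤n⇒∃[o]m+o≡n b≤a
... | d , refl = ≤-trans (m≤m+n _ (d * d)) (≤-reflexive (eq b d))
  where
  eq : ∀ b d → (b + d) * b + (b + d) * b + d * d ≡ (b + d) * (b + d) + b * b
  eq = solve-∀

-- Cauchy-Schwarz: both sides, doubled, are sums over pairs of entries, which `2ab≤a²+b²` compares
-- term by term.
∑-square : {A : Set} (xs : List A) (g : A → ℕ) → ∑ xs g * ∑ xs g ≤ length xs * ∑ xs (λ x → g x * g x)
∑-square xs g = *-cancelˡ-≤ 2 (begin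
  2 * (S * S)                                          ≡⟨ double (S * S) ⟩
  S * S + S * S                                        ≡⟨ cong₂ _+_ (product) (product) ⟩
  ∑ xs (λ x → ∑ xs (λ y → g x * g y)) + ∑ xs (λ x → ∑ xs (λ y → g x * g y))
    ≡⟨ ∑-+ xs _ _ ⟨
  ∑ xs (λ x → ∑ xs (λ y → g x * g y) + ∑ xs (λ y → g x * g y))
    ≡⟨ ∑-cong xs (λ x → ∑-+ xs _ _) ⟨
  ∑ xs (λ x → ∑ xs (λ y → g x * g y + g x * g y))
    ≤⟨ ∑-mono xs (λ x → ∑-mono xs (λ y → 2ab≤a²+b² (g x) (g y))) ⟩
  ∑ xs (λ x → ∑ xs (λ y → g x * g x + g y * g y))
    ≡⟨ ∑-cong xs (λ x → trans (∑-+ xs _ _) (cong (_+ Q) (∑-const xs _))) ⟩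
  ∑ xs (λ x → length xs * (g x * g x) + Q)             ≡⟨ ∑-+ xs _ _ ⟩
  ∑ xs (λ x → length xs * (g x * g x)) + ∑ xs (λ _ → Q) ≡⟨ cong₂ _+_ (∑-*ˡ xs (length xs) (λ x → g x * g x)) (∑-const xs Q) ⟩
  length xs * Q + length xs * Q                        ≡⟨ double (length xs * Q) ⟨
  2 * (length xs * Q)                                  ∎)
  where
  open ≤-Reasoning
  S = ∑ xs g
  Q = ∑ xs (λ x → g x * g x)
  double : ∀ a → 2 * a ≡ a + a
  double = solve-∀
  product : S * S ≡ ∑ xs (λ x → ∑ xs (λ y → g x * g y))
  product = trans (≡-sym (∑-*ʳ xs S g)) (∑-cong xs (λ x → ≡-sym (∑-*ˡ xs (g x) g)))

threshold-split : ∀ D c → c ≤ D + 𝟙 (does (D <? c)) * c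
threshold-split D c with D <ᵇ c in e
... | true  = ≤-trans (≤-reflexive (≡-sym (*-identityˡ c))) (m≤n+m _ D)
... | false = ≤-trans (≮⇒≥ (λ lt → subst T e (<⇒<ᵇ lt))) (m≤m+n D _)

module _ {n : ℕ} (G : PCGraph n) where

  private V = vertices G

  -- The adjacency operator; `walksFrom l` is its `l`-th power applied to the constant 1.
  nbrSum : (Fin n → ℕ) → Fin n → ℕ
  nbrSum g v = ∑ V (λ u → 𝟙 (adj G v u) * g u)

  walksFrom : ℕ → Fin n → ℕ
  walksFrom zero    v = 1
  walksFrom (suc l) v = nbrSum (walksFrom l) v

  walks : ℕ → ℕ
  walks l = ∑ V (walksFrom l)

  length-vertices : length V ≡ n
  length-vertices = length-tabulate id

  nbrSum-mono : ∀ {g h} → (∀ v → g v ≤ h v) → ∀ v → nbrSum g v ≤ nbrSum h v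
  nbrSum-mono e v = ∑-mono V (λ u → *-monoʳ-≤ (𝟙 (adj G v u)) (e u))

  walksFrom-1 : ∀ v → walksFrom 1 v ≡ deg G v
  walksFrom-1 v = ∑-cong V (λ u → *-identityʳ _)

  deg≤n : ∀ v → deg G v ≤ n
  deg≤n v = subst (deg G v ≤_) length-vertices (#≤length V (adj G v))

  -- The adjacency matrix is symmetric. This allows a walk to be cut at any of its vertices and
  -- counted from there in both directions.
  nbrSum-adjoint : ∀ g h → ∑ V (λ v → h v * nbrSum g v) ≡ ∑ V (λ v → nbrSum h v * g v)
  nbrSum-adjoint g h = begin-equality
    ∑ V (λ v → h v * nbrSum g v)                           ≡⟨ ∑-cong V (λ v → ∑-*ˡ V (h v) _) ⟨
    ∑ V (λ v → ∑ V (λ u → h v * (𝟙 (adj G v u) * g u)))   ≡⟨ ∑-swap V V _ ⟩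
    ∑ V (λ u → ∑ V (λ v → h v * (𝟙 (adj G v u) * g u)))   ≡⟨ ∑-cong V (λ u → ∑-cong V (λ v → reorder u v)) ⟩
    ∑ V (λ u → ∑ V (λ v → 𝟙 (adj G u v) * h v * g u))     ≡⟨ ∑-cong V (λ u → ∑-*ʳ V (g u) _) ⟩
    ∑ V (λ v → nbrSum h v * g v)                           ∎
    where
    open ≤-Reasoning
    eq : ∀ a b c → a * (b * c) ≡ b * a * c
    eq = solve-∀
    reorder : ∀ u v → h v * (𝟙 (adj G v u) * g u) ≡ 𝟙 (adj G u v) * h v * g u
    reorder u v rewrite adj-sym G v u = eq (h v) (𝟙 (adj G u v)) (g u)

  walks-+2 : ∀ l → walks (2 + l) ≡ ∑ V (λ v → walksFrom 2 v * walksFrom l v)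
  walks-+2 l = trans (∑-cong V (λ v → ≡-sym (*-identityˡ _)))
    (trans (nbrSum-adjoint (walksFrom (suc l)) (walksFrom 0)) (nbrSum-adjoint (walksFrom l) (walksFrom 1)))

  walks-2 : walks 2 ≡ ∑ V (λ v → deg G v * deg G v)
  walks-2 = trans (∑-cong V (λ v → ≡-sym (*-identityˡ _)))
    (trans (nbrSum-adjoint (walksFrom 1) (walksFrom 0)) (∑-cong V (λ v → cong₂ _*_ (walksFrom-1 v) (walksFrom-1 v))))

  walks-3 : walks 3 ≡ ∑ V (λ v → deg G v * walksFrom 2 v)
  walks-3 = trans (∑-cong V (λ v → ≡-sym (*-identityˡ _)))
    (trans (nbrSum-adjoint (walksFrom 2) (walksFrom 0)) (∑-cong V (λ v → cong (_* walksFrom 2 v) (walksFrom-1 v))))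

  walksFrom-2 : ∀ v → walksFrom 2 v ≡ ∑ V (codeg G v)
  walksFrom-2 v = ≡-sym (begin-equality
    ∑ V (λ w → ∑ V (λ y → 𝟙 (adj G v y ∧ adj G w y)))   ≡⟨ ∑-swap V V _ ⟩
    ∑ V (λ y → ∑ V (λ w → 𝟙 (adj G v y ∧ adj G w y)))   ≡⟨ ∑-cong V (λ y → ∑-cong V (λ w → reorder y w)) ⟩
    ∑ V (λ y → ∑ V (λ w → 𝟙 (adj G v y) * (𝟙 (adj G y w) * 1)))    ≡⟨ ∑-cong V (λ y → ∑-*ˡ V (𝟙 (adj G v y)) _) ⟩
    walksFrom 2 v                                        ∎)
    where
    open ≤-Reasoning
    reorder : ∀ y w → 𝟙 (adj G v y ∧ adj G w y) ≡ 𝟙 (adj G v y) * (𝟙 (adj G y w) * 1)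
    reorder y w rewrite adj-sym G w y | *-identityʳ (𝟙 (adj G y w)) = 𝟙-∧ (adj G v y) _

  walks-1² : walks 1 * walks 1 ≤ n * walks 2
  walks-1² = ≤-trans (∑-square V (walksFrom 1)) (≤-reflexive (cong₂ _*_ length-vertices
    (≡-sym (trans walks-2 (∑-cong V (λ v → ≡-sym (cong₂ _*_ (walksFrom-1 v) (walksFrom-1 v))))))))

  startsPath : ℕ → Fin n → ℕ
  startsPath l x = # (allLists l n) (λ ys → consecEdgesᵇ G (x ∷ ys))

  startsPath≤walksFrom : ∀ l x → startsPath l x ≤ walksFrom l x
  startsPath≤walksFrom zero    x = ≤-refl
  startsPath≤walksFrom (suc l) x = begin
    startsPath (suc l) x
      ≡⟨ ∑-concatMap (λ y → map (y ∷_) (allLists l n)) V _ ⟩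
    ∑ V (λ y → ∑ (map (y ∷_) (allLists l n)) (λ ys → 𝟙 (consecEdgesᵇ G (x ∷ ys))))
      ≡⟨ ∑-cong V (λ y → ∑-map (y ∷_) (allLists l n) _) ⟩
    ∑ V (λ y → ∑ (allLists l n) (λ ys → 𝟙 (adj G x y ∧ consecEdgesᵇ G (y ∷ ys))))
      ≡⟨ ∑-cong V (λ y → trans (∑-cong (allLists l n) (λ ys → 𝟙-∧ (adj G x y) _)) (∑-*ˡ (allLists l n) (𝟙 (adj G x y)) _)) ⟩
    ∑ V (λ y → 𝟙 (adj G x y) * startsPath l y)
      ≤⟨ nbrSum-mono (startsPath≤walksFrom l) x ⟩
    walksFrom (suc l) x ∎
    where open ≤-Reasoning

  -- Dropping distinctness of the vertices can only increase the count.
  pathSeqCount≤walks : ∀ l → pathSeqCount G l ≤ walks l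
  pathSeqCount≤walks l = begin
    pathSeqCount G l
      ≡⟨ length-filterᵇ _ (allLists (suc l) n) ⟩
    # (allLists (suc l) n) (λ vs → distinctᵇ vs ∧ consecEdgesᵇ G vs)
      ≤⟨ #-mono (allLists (suc l) n) (λ vs h → proj₂ (∧-split {distinctᵇ vs} h)) ⟩
    # (allLists (suc l) n) (consecEdgesᵇ G)
      ≡⟨ ∑-concatMap (λ y → map (y ∷_) (allLists l n)) V _ ⟩
    ∑ V (λ y → ∑ (map (y ∷_) (allLists l n)) (λ ys → 𝟙 (consecEdgesᵇ G ys)))
      ≡⟨ ∑-cong V (λ y → ∑-map (y ∷_) (allLists l n) _) ⟩
    ∑ V (startsPath l)
      ≤⟨ ∑-mono V (startsPath≤walksFrom l) ⟩
    walks l ∎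
    where open ≤-Reasoning

  copiesP≤walks : ∀ l → copiesP G l ≤ walks l
  copiesP≤walks l = ≤-trans (m/n≤m (pathSeqCount G l) 2) (pathSeqCount≤walks l)

  walks-0 : walks 0 ≡ n
  walks-0 = trans (∑-const V 1) (trans (*-identityʳ _) length-vertices)

  module _ (D : ℕ) (few-heavy : ∀ x → ∑ V (λ w → 𝟙 (heavy G D x w) * codeg G x w) ≤ D * deg G x) where

    codeg-split : ∀ x w → codeg G x w ≤ D + 𝟙 (heavy G D x w) * codeg G x w
    codeg-split x w = threshold-split D (codeg G x w)

    -- Light end vertices contribute at most `D` each, and the heavy ones together at most
    -- `D * deg G v`; both parts are at most `D * n`.
    walksFrom-2-bound : ∀ v → walksFrom 2 v ≤ 2 * D * n
    walksFrom-2-bound v = begin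
      walksFrom 2 v                                              ≡⟨ walksFrom-2 v ⟩
      ∑ V (codeg G v)                                            ≤⟨ ∑-mono V (codeg-split v) ⟩
      ∑ V (λ w → D + 𝟙 (heavy G D v w) * codeg G v w)           ≡⟨ ∑-+ V _ _ ⟩
      ∑ V (λ _ → D) + ∑ V (λ w → 𝟙 (heavy G D v w) * codeg G v w)
        ≤⟨ +-mono-≤ (≤-reflexive (trans (∑-const V D) (cong (_* D) length-vertices)))
                    (≤-trans (few-heavy v) (*-monoʳ-≤ D (deg≤n v))) ⟩
      n * D + D * n                                              ≡⟨ eq n D ⟩
      2 * D * n                                                  ∎
      where
      open ≤-Reasoning
      eq : ∀ n D → n * D + D * n ≡ 2 * D * n
      eq = solve-∀

    walks-+2-bound : ∀ l → walks (2 + l) ≤ 2 * D * n * walks l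
    walks-+2-bound l = ≤-trans (≤-reflexive (walks-+2 l))
      (≤-trans (∑-mono V (λ v → *-monoˡ-≤ (walksFrom l v) (walksFrom-2-bound v))) (≤-reflexive (∑-*ˡ V (2 * D * n) (walksFrom l))))

    walks-2-bound : walks 2 ≤ 2 * D * n * n
    walks-2-bound = subst (λ a → walks 2 ≤ 2 * D * n * a) walks-0 (walks-+2-bound 0)

    -- Cutting off two steps costs a factor `2 * D * n`, which after squaring raises the exponent by
    -- two. Only length one has to be treated by Cauchy-Schwarz.
    walks-bound-half : ∀ l → walks l ^ 2 ≤ (2 * D) ^ l * n ^ (l + 2)
    walks-bound-half zero = ≤-reflexive (trans (cong (_^ 2) walks-0) (≡-sym (*-identityˡ _)))
    walks-bound-half (suc zero) = begin
      walks 1 ^ 2              ≡⟨ eq₁ (walks 1) ⟩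
      walks 1 * walks 1        ≤⟨ walks-1² ⟩
      n * walks 2              ≤⟨ *-monoʳ-≤ n walks-2-bound ⟩
      n * (2 * D * n * n)      ≡⟨ eq₂ n (2 * D) ⟩
      (2 * D) ^ 1 * n ^ 3      ∎
      where
      open ≤-Reasoning
      eq₁ : ∀ a → a * (a * 1) ≡ a * a
      eq₁ = solve-∀
      eq₂ : ∀ n c → n * (c * n * n) ≡ c * 1 * (n * (n * (n * 1)))
      eq₂ = solve-∀
    walks-bound-half (suc (suc l)) = begin
      walks (2 + l) ^ 2                                ≤⟨ ^-monoˡ-≤ 2 (walks-+2-bound l) ⟩
      (2 * D * n * walks l) ^ 2                        ≡⟨ eq₁ (2 * D) n (walks l) ⟩
      (2 * D) * (2 * D) * (n * n) * walks l ^ 2        ≤⟨ *-monoʳ-≤ ((2 * D) * (2 * D) * (n * n)) (walks-bound-half l) ⟩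
      (2 * D) * (2 * D) * (n * n) * ((2 * D) ^ l * n ^ (l + 2)) ≡⟨ eq₂ (2 * D) n _ _ ⟩
      (2 * D) ^ (2 + l) * n ^ (2 + l + 2)              ∎
      where
      open ≤-Reasoning
      eq₁ : ∀ c n w → c * n * w * (c * n * w * 1) ≡ c * c * (n * n) * (w * (w * 1))
      eq₁ = solve-∀
      eq₂ : ∀ c n a b → c * c * (n * n) * (a * b) ≡ c * (c * a) * (n * (n * b))
      eq₂ = solve-∀

    -- Two further steps cost one factor `n`, as they do in the exponent, so the bounds for lengths
    -- two and three carry over to all lengths. The power of `K` is generous to give both parities
    -- the same form.
    walks-bound-ceil : ∀ K → 2 * D ≤ K → 1 ≤ K → walks 3 ≤ K * (n * n) → ∀ l → walks (2 + l) ≤ K ^ suc l * n ^ ⌈ 2 + l + 1 /2⌉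
    walks-bound-ceil K D≤K 1≤K w₃ zero = ≤-trans walks-2-bound (≤-trans (*-monoˡ-≤ n (*-monoˡ-≤ n D≤K)) (≤-reflexive (eq K n)))
      where
      eq : ∀ c n → c * n * n ≡ c * 1 * (n * (n * 1))
      eq = solve-∀
    walks-bound-ceil K D≤K 1≤K w₃ (suc zero) = ≤-trans w₃ (≤-trans (*-monoˡ-≤ (n * n) (m≤n*m K K {{>-nonZero 1≤K}})) (≤-reflexive (eq K n)))
      where
      eq : ∀ c n → c * c * (n * n) ≡ c * (c * 1) * (n * (n * 1))
      eq = solve-∀
    walks-bound-ceil K D≤K 1≤K w₃ (suc (suc l)) = begin
      walks (4 + l)                                       ≤⟨ walks-+2-bound (2 + l) ⟩
      2 * D * n * walks (2 + l)                           ≤⟨ *-mono-≤ (*-monoˡ-≤ n D≤K) (walks-bound-ceil K D≤K 1≤K w₃ l) ⟩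
      K * n * (K ^ suc l * n ^ ⌈ 2 + l + 1 /2⌉)           ≤⟨ *-monoˡ-≤ _ (*-monoˡ-≤ n (m≤n*m K K {{>-nonZero 1≤K}})) ⟩
      K * K * n * (K ^ suc l * n ^ ⌈ 2 + l + 1 /2⌉)       ≡⟨ eq K n (K ^ suc l) _ ⟩
      K ^ (3 + l) * n ^ ⌈ 4 + l + 1 /2⌉                   ∎
      where
      open ≤-Reasoning
      eq : ∀ c n a b → c * c * n * (a * b) ≡ c * (c * a) * (n * b)
      eq = solve-∀

-- Walks of length three

module _ {n : ℕ} (G : PCGraph n) where

  private
    V = vertices G

  vertexPairs : List (Fin n × Fin n)
  vertexPairs = cartesianProduct V V

  -- ((u , y) , (x , z)) encodes the walk x u y z.
  Walk₃ : Set
  Walk₃ = (Fin n × Fin n) × (Fin n × Fin n)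

  walks₃ : List Walk₃
  walks₃ = cartesianProduct vertexPairs vertexPairs

  isWalk : Walk₃ → Bool
  isWalk ((u , y) , (x , z)) = adj G u y ∧ (adj G u x ∧ adj G y z)

  sameColour : Fin n → Fin n → Fin n → Fin n → Bool
  sameColour u y u′ y′ = does (_≟ᶜ_ G (col G u′ y′) (col G u y))

  -- When `uy` is an edge, equality of colours forces `u′y′` to be one, so this is the number of
  -- walks `x u′ y′ z` with the same middle colour, the given walk included.
  sharedColour : Walk₃ → ℕ
  sharedColour ((u , y) , (x , z)) = # vertexPairs (λ { (u′ , y′) → (adj G u′ x ∧ adj G y′ z) ∧ sameColour u y u′ y′ })

  ∑-pairs : ∀ f → ∑ vertexPairs f ≡ ∑ V (λ u → ∑ V (λ v → f (u , v)))
  ∑-pairs f = ∑-cartesianProduct V V f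

  ∑-walks₃ : ∀ f → ∑ walks₃ f ≡ ∑ V (λ u → ∑ V (λ y → ∑ V (λ x → ∑ V (λ z → f ((u , y) , (x , z))))))
  ∑-walks₃ f = trans (∑-cartesianProduct vertexPairs vertexPairs f)
    (trans (∑-pairs _) (∑-cong V (λ u → ∑-cong V (λ y → ∑-pairs (λ xz → f ((u , y) , xz))))))

  ∑-product : ∀ (f g : Fin n → ℕ) → ∑ V (λ x → ∑ V (λ z → f x * g z)) ≡ ∑ V f * ∑ V g
  ∑-product f g = trans (∑-cong V (λ x → ∑-*ˡ V (f x) g)) (∑-*ʳ V (∑ V g) f)

  -- A walk of length three is a middle edge together with a neighbour of each of its ends.
  ∑-edges-degrees : ∑ V (λ u → ∑ V (λ y → 𝟙 (adj G u y) * (deg G u * deg G y))) ≡ walks G 3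
  ∑-edges-degrees = begin-equality
    ∑ V (λ u → ∑ V (λ y → 𝟙 (adj G u y) * (deg G u * deg G y)))
      ≡⟨ ∑-cong V (λ u → ∑-cong V (λ y → eq (𝟙 (adj G u y)) (deg G u) (deg G y))) ⟩
    ∑ V (λ u → ∑ V (λ y → deg G u * (𝟙 (adj G u y) * deg G y)))
      ≡⟨ ∑-cong V (λ u → ∑-*ˡ V (deg G u) _) ⟩
    ∑ V (λ u → deg G u * nbrSum G (deg G) u)
      ≡⟨ ∑-cong V (λ u → cong (deg G u *_) (∑-cong V (λ y → cong (𝟙 (adj G u y) *_) (≡-sym (walksFrom-1 G y))))) ⟩
    ∑ V (λ u → deg G u * walksFrom G 2 u)
      ≡⟨ walks-3 G ⟨
    walks G 3 ∎
    where
    open ≤-Reasoning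
    eq : ∀ a b c → a * (b * c) ≡ b * (a * c)
    eq = solve-∀

  #-walks₃ : # walks₃ isWalk ≡ walks G 3
  #-walks₃ = trans (∑-walks₃ _) (trans (∑-cong V (λ u → ∑-cong V (λ y → inner u y))) ∑-edges-degrees)
    where
    inner : ∀ u y → ∑ V (λ x → ∑ V (λ z → 𝟙 (isWalk ((u , y) , (x , z))))) ≡ 𝟙 (adj G u y) * (deg G u * deg G y)
    inner u y = trans
      (∑-cong V (λ x → trans (∑-cong V (λ z → trans (𝟙-∧ (adj G u y) _) (cong (𝟙 (adj G u y) *_) (𝟙-∧ (adj G u x) _)))) (∑-*ˡ V (𝟙 (adj G u y)) _)))
      (trans (∑-*ˡ V (𝟙 (adj G u y)) _) (cong (𝟙 (adj G u y) *_) (∑-product (λ x → 𝟙 (adj G u x)) (λ z → 𝟙 (adj G y z)))))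

  few-same-colour : ∀ {u y c} → col G u y ≡ just c → ∀ u′ → # V (λ y′ → sameColour u y u′ y′) ≤ 1
  few-same-colour {u} {y} {c} e u′ = #≤1 _ (vertices-unique G) (λ a b ha hb →
    proper G u′ a b c (trans (does-sound (_≟ᶜ_ G (col G u′ a) (col G u y)) ha) e)
                      (trans (does-sound (_≟ᶜ_ G (col G u′ b) (col G u y)) hb) e))

  few-same-colour′ : ∀ {u y c} → col G u y ≡ just c → ∀ y′ → # V (λ u′ → sameColour u y u′ y′) ≤ 1
  few-same-colour′ {u} {y} {c} e y′ = #≤1 _ (vertices-unique G) (λ a b ha hb →
    proper′ G (trans (does-sound (_≟ᶜ_ G (col G a y′) (col G u y)) ha) e)
              (trans (does-sound (_≟ᶜ_ G (col G b y′) (col G u y)) hb) e))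

  codeg≤deg : ∀ u v → codeg G u v ≤ deg G u
  codeg≤deg u v = #-mono V (λ w h → proj₁ (∧-split h))

  module _ (D : ℕ) (1≤D : 1 ≤ D) (few-heavy : ∀ x → ∑ V (λ w → 𝟙 (heavy G D x w) * codeg G x w) ≤ D * deg G x) where

    -- For walks `c b a d` with `(a , c)` heavy, `a` is chosen first: this leaves `deg G a` choices
    -- for `d` and at most `D * deg G a` for `b` and `c`, and the squares of the degrees sum to
    -- `walks G 2`.
    heavy-walks : ∑ V (λ a → ∑ V (λ b → ∑ V (λ c → ∑ V (λ d →
        𝟙 (adj G a d) * (𝟙 (heavy G D a c) * 𝟙 (adj G a b ∧ adj G c b)))))) ≤ D * walks G 2
    heavy-walks = begin
      ∑ V (λ a → ∑ V (λ b → ∑ V (λ c → ∑ V (λ d → 𝟙 (adj G a d) * (𝟙 (heavy G D a c) * 𝟙 (adj G a b ∧ adj G c b))))))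
        ≡⟨ ∑-cong V (λ a → ∑-cong V (λ b → ∑-cong V (λ c → ∑-*ʳ V (𝟙 (heavy G D a c) * 𝟙 (adj G a b ∧ adj G c b)) _))) ⟩
      ∑ V (λ a → ∑ V (λ b → ∑ V (λ c → deg G a * (𝟙 (heavy G D a c) * 𝟙 (adj G a b ∧ adj G c b)))))
        ≡⟨ ∑-cong V (λ a → ∑-cong V (λ b → ∑-*ˡ V (deg G a) _)) ⟩
      ∑ V (λ a → ∑ V (λ b → deg G a * ∑ V (λ c → 𝟙 (heavy G D a c) * 𝟙 (adj G a b ∧ adj G c b))))
        ≡⟨ ∑-cong V (λ a → trans (∑-*ˡ V (deg G a) _) (cong (deg G a *_) (trans (∑-swap V V _) (∑-cong V (λ c → ∑-*ˡ V (𝟙 (heavy G D a c)) _))))) ⟩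
      ∑ V (λ a → deg G a * ∑ V (λ c → 𝟙 (heavy G D a c) * codeg G a c))
        ≤⟨ ∑-mono V (λ a → *-monoʳ-≤ (deg G a) (few-heavy a)) ⟩
      ∑ V (λ a → deg G a * (D * deg G a))
        ≡⟨ ∑-cong V (λ a → eq (deg G a) D) ⟩
      ∑ V (λ a → D * (deg G a * deg G a))
        ≡⟨ ∑-*ˡ V D (λ a → deg G a * deg G a) ⟩
      D * ∑ V (λ a → deg G a * deg G a)
        ≡⟨ cong (D *_) (walks-2 G) ⟨
      D * walks G 2 ∎
      where
      open ≤-Reasoning
      eq : ∀ a d → a * (d * a) ≡ d * (a * a)
      eq = solve-∀

    heavy-xy : Walk₃ → Bool
    heavy-xy ((u , y) , (x , z)) = heavy G D y x

    heavy-uz : Walk₃ → Bool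
    heavy-uz ((u , y) , (x , z)) = heavy G D u z

    ends : Walk₃ → Bool
    ends ((u , y) , (x , z)) = does (_≟ᶜ_ G (col G y z) (col G u x))

    popular : Walk₃ → Bool
    popular t = does (4 * D <? sharedColour t)

    #-heavy-xy : # walks₃ (λ t → isWalk t ∧ heavy-xy t) ≤ D * walks G 2
    #-heavy-xy = begin
      # walks₃ (λ t → isWalk t ∧ heavy-xy t)     ≡⟨ ∑-walks₃ _ ⟩
      ∑ V (λ u → ∑ V (λ y → ∑ V (λ x → ∑ V (λ z → 𝟙 ((adj G u y ∧ (adj G u x ∧ adj G y z)) ∧ heavy G D y x)))))
        ≡⟨ ∑-cong V (λ u → ∑-cong V (λ y → ∑-cong V (λ x → ∑-cong V (λ z → reorder u y x z)))) ⟩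
      ∑ V (λ u → ∑ V (λ y → ∑ V (λ x → ∑ V (λ z → 𝟙 (adj G y z) * (𝟙 (heavy G D y x) * 𝟙 (adj G y u ∧ adj G x u))))))
        ≡⟨ ∑-swap V V _ ⟩
      ∑ V (λ y → ∑ V (λ u → ∑ V (λ x → ∑ V (λ z → 𝟙 (adj G y z) * (𝟙 (heavy G D y x) * 𝟙 (adj G y u ∧ adj G x u))))))
        ≤⟨ heavy-walks ⟩
      D * walks G 2 ∎
      where
      open ≤-Reasoning
      bools : ∀ a b c h → 𝟙 ((a ∧ (b ∧ c)) ∧ h) ≡ 𝟙 c * (𝟙 h * 𝟙 (a ∧ b))
      bools true  true  true  true  = refl
      bools true  true  true  false = refl
      bools true  true  false _     = refl
      bools true  false true  true  = refl
      bools true  false true  false = refl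
      bools true  false false _     = refl
      bools false b     true  true  = refl
      bools false b     true  false = refl
      bools false b     false _     = refl
      reorder : ∀ u y x z → 𝟙 ((adj G u y ∧ (adj G u x ∧ adj G y z)) ∧ heavy G D y x) ≡ 𝟙 (adj G y z) * (𝟙 (heavy G D y x) * 𝟙 (adj G y u ∧ adj G x u))
      reorder u y x z rewrite adj-sym G u y | adj-sym G u x = bools (adj G y u) (adj G x u) (adj G y z) (heavy G D y x)

    #-heavy-uz : # walks₃ (λ t → isWalk t ∧ heavy-uz t) ≤ D * walks G 2
    #-heavy-uz = begin
      # walks₃ (λ t → isWalk t ∧ heavy-uz t)     ≡⟨ ∑-walks₃ _ ⟩
      ∑ V (λ u → ∑ V (λ y → ∑ V (λ x → ∑ V (λ z → 𝟙 ((adj G u y ∧ (adj G u x ∧ adj G y z)) ∧ heavy G D u z)))))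
        ≡⟨ ∑-cong V (λ u → ∑-cong V (λ y → ∑-cong V (λ x → ∑-cong V (λ z → reorder u y x z)))) ⟩
      ∑ V (λ u → ∑ V (λ y → ∑ V (λ x → ∑ V (λ z → 𝟙 (adj G u x) * (𝟙 (heavy G D u z) * 𝟙 (adj G u y ∧ adj G z y))))))
        ≡⟨ ∑-cong V (λ u → ∑-cong V (λ y → ∑-swap V V _)) ⟩
      ∑ V (λ u → ∑ V (λ y → ∑ V (λ z → ∑ V (λ x → 𝟙 (adj G u x) * (𝟙 (heavy G D u z) * 𝟙 (adj G u y ∧ adj G z y))))))
        ≤⟨ heavy-walks ⟩
      D * walks G 2 ∎
      where
      open ≤-Reasoning
      bools : ∀ a b c h → 𝟙 ((a ∧ (b ∧ c)) ∧ h) ≡ 𝟙 b * (𝟙 h * 𝟙 (a ∧ c))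
      bools true  true  true  true  = refl
      bools true  true  true  false = refl
      bools true  true  false true  = refl
      bools true  true  false false = refl
      bools true  false c     h     = refl
      bools false true  c     true  = refl
      bools false true  c     false = refl
      bools false false c     h     = refl
      reorder : ∀ u y x z → 𝟙 ((adj G u y ∧ (adj G u x ∧ adj G y z)) ∧ heavy G D u z) ≡ 𝟙 (adj G u x) * (𝟙 (heavy G D u z) * 𝟙 (adj G u y ∧ adj G z y))
      reorder u y x z rewrite adj-sym G z y = bools (adj G u y) (adj G u x) (adj G y z) (heavy G D u z)

    #-ends : # walks₃ (λ t → isWalk t ∧ ends t) ≤ walks G 2
    #-ends = begin
      # walks₃ (λ t → isWalk t ∧ ends t)     ≡⟨ ∑-walks₃ _ ⟩
      ∑ V (λ u → ∑ V (λ y → ∑ V (λ x → ∑ V (λ z → 𝟙 (isWalk ((u , y) , (x , z)) ∧ ends ((u , y) , (x , z)))))))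
        ≤⟨ ∑-mono V (λ u → ∑-mono V (λ y → ∑-mono V (λ x → one u y x))) ⟩
      ∑ V (λ u → ∑ V (λ y → ∑ V (λ x → 𝟙 (adj G u y) * 𝟙 (adj G u x))))
        ≡⟨ ∑-cong V (λ u → ∑-product (λ y → 𝟙 (adj G u y)) (λ x → 𝟙 (adj G u x))) ⟩
      ∑ V (λ u → deg G u * deg G u)
        ≡⟨ walks-2 G ⟨
      walks G 2 ∎
      where
      open ≤-Reasoning
      -- Given `x u y`, properness at `y` leaves at most one `z` for which `yz` has the colour of
      -- `ux`.
      one : ∀ u y x → # V (λ z → isWalk ((u , y) , (x , z)) ∧ ends ((u , y) , (x , z))) ≤ 𝟙 (adj G u y) * 𝟙 (adj G u x)
      one u y x with adj G u y | adj G u x in ux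
      ... | false | _     = ≤-reflexive (∑-zero V)
      ... | true  | false = ≤-reflexive (∑-zero V)
      ... | true  | true  with adj-colour G ux
      ...   | c , e = ≤-trans (#-mono V (λ z h → proj₂ (∧-split {adj G y z} h))) (few-same-colour e y)

    -- Light u′ contribute at most D walks u x u′ each; over heavy u′ these sum to at most D * deg u,
    -- with codeg y y′ ≤ deg y.
    shared-edges : ∀ {u y c} → col G u y ≡ just c →
      ∑ V (λ u′ → ∑ V (λ y′ → 𝟙 (sameColour u y u′ y′) * (codeg G u u′ * codeg G y y′)))
        ≤ D * walksFrom G 2 y + D * (deg G u * deg G y)
    shared-edges {u} {y} e = begin
      ∑ V (λ u′ → ∑ V (λ y′ → s u′ y′ * (codeg G u u′ * codeg G y y′)))
        ≤⟨ ∑-mono V (λ u′ → ∑-mono V (λ y′ → *-monoʳ-≤ (s u′ y′) (*-monoˡ-≤ (codeg G y y′) (threshold-split D (codeg G u u′))))) ⟩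
      ∑ V (λ u′ → ∑ V (λ y′ → s u′ y′ * ((D + hv u′) * codeg G y y′)))
        ≡⟨ ∑-cong V (λ u′ → trans (∑-cong V (λ y′ → eq (s u′ y′) D (hv u′) (codeg G y y′))) (∑-+ V _ _)) ⟩
      ∑ V (λ u′ → ∑ V (λ y′ → D * (s u′ y′ * codeg G y y′)) + ∑ V (λ y′ → hv u′ * (s u′ y′ * codeg G y y′)))
        ≡⟨ ∑-+ V _ _ ⟩
      ∑ V (λ u′ → ∑ V (λ y′ → D * (s u′ y′ * codeg G y y′))) + ∑ V (λ u′ → ∑ V (λ y′ → hv u′ * (s u′ y′ * codeg G y y′)))
        ≤⟨ +-mono-≤ light-part heavy-part ⟩
      D * walksFrom G 2 y + D * (deg G u * deg G y) ∎
      where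
      open ≤-Reasoning
      s : Fin n → Fin n → ℕ
      s u′ y′ = 𝟙 (sameColour u y u′ y′)
      hv : Fin n → ℕ
      hv u′ = 𝟙 (heavy G D u u′) * codeg G u u′
      eq : ∀ s d h c → s * ((d + h) * c) ≡ d * (s * c) + h * (s * c)
      eq = solve-∀
      light-part : ∑ V (λ u′ → ∑ V (λ y′ → D * (s u′ y′ * codeg G y y′))) ≤ D * walksFrom G 2 y
      light-part = begin
        ∑ V (λ u′ → ∑ V (λ y′ → D * (s u′ y′ * codeg G y y′)))   ≡⟨ ∑-swap V V _ ⟩
        ∑ V (λ y′ → ∑ V (λ u′ → D * (s u′ y′ * codeg G y y′)))   ≡⟨ ∑-cong V (λ y′ → trans (∑-*ˡ V D _) (cong (D *_) (∑-*ʳ V (codeg G y y′) _))) ⟩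
        ∑ V (λ y′ → D * (∑ V (λ u′ → s u′ y′) * codeg G y y′))   ≤⟨ ∑-mono V (λ y′ → *-monoʳ-≤ D (*-monoˡ-≤ (codeg G y y′) (few-same-colour′ e y′))) ⟩
        ∑ V (λ y′ → D * (1 * codeg G y y′))                      ≡⟨ trans (∑-*ˡ V D _) (cong (D *_) (∑-cong V (λ y′ → *-identityˡ _))) ⟩
        D * ∑ V (codeg G y)                                       ≡⟨ cong (D *_) (walksFrom-2 G y) ⟨
        D * walksFrom G 2 y                                       ∎
      heavy-part : ∑ V (λ u′ → ∑ V (λ y′ → hv u′ * (s u′ y′ * codeg G y y′))) ≤ D * (deg G u * deg G y)
      heavy-part = begin
        ∑ V (λ u′ → ∑ V (λ y′ → hv u′ * (s u′ y′ * codeg G y y′)))  ≤⟨ ∑-mono V (λ u′ → ∑-mono V (λ y′ → *-monoʳ-≤ (hv u′) (*-monoʳ-≤ (s u′ y′) (codeg≤deg y y′)))) ⟩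
        ∑ V (λ u′ → ∑ V (λ y′ → hv u′ * (s u′ y′ * deg G y)))       ≡⟨ ∑-cong V (λ u′ → trans (∑-*ˡ V (hv u′) _) (cong (hv u′ *_) (∑-*ʳ V (deg G y) _))) ⟩
        ∑ V (λ u′ → hv u′ * (∑ V (s u′) * deg G y))                 ≤⟨ ∑-mono V (λ u′ → *-monoʳ-≤ (hv u′) (*-monoˡ-≤ (deg G y) (few-same-colour e u′))) ⟩
        ∑ V (λ u′ → hv u′ * (1 * deg G y))                          ≡⟨ ∑-*ʳ V (1 * deg G y) hv ⟩
        ∑ V hv * (1 * deg G y)                                       ≤⟨ *-monoˡ-≤ (1 * deg G y) (few-heavy u) ⟩
        D * deg G u * (1 * deg G y)                                  ≡⟨ eq₂ D (deg G u) (deg G y) ⟩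
        D * (deg G u * deg G y)                                      ∎
        where
        eq₂ : ∀ d a b → d * a * (1 * b) ≡ d * (a * b)
        eq₂ = solve-∀

    -- Each of the two terms in `shared-edges` sums to `D * walks G 3` over the oriented edges `uy`:
    -- the first extends the edge by two steps beyond `y`, the second by one step at either end.
    ∑-sharedColour : ∑ walks₃ (λ t → 𝟙 (isWalk t) * sharedColour t) ≤ 2 * D * walks G 3
    ∑-sharedColour = begin
      ∑ walks₃ (λ t → 𝟙 (isWalk t) * sharedColour t)
        ≡⟨ trans (∑-cartesianProduct vertexPairs vertexPairs _) (∑-pairs _) ⟩
      ∑ V (λ u → ∑ V (λ y → ∑ vertexPairs (λ xz → 𝟙 (isWalk ((u , y) , xz)) * sharedColour ((u , y) , xz))))
        ≤⟨ ∑-mono V (λ u → ∑-mono V (λ y → edge-bound u y)) ⟩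
      ∑ V (λ u → ∑ V (λ y → 𝟙 (adj G u y) * (D * walksFrom G 2 y + D * (deg G u * deg G y))))
        ≡⟨ ∑-cong V (λ u → trans (∑-cong V (λ y → eq₁ (𝟙 (adj G u y)) D (walksFrom G 2 y) (deg G u * deg G y)))
             (trans (∑-*ˡ V D _) (cong (D *_) (∑-+ V _ _)))) ⟩
      ∑ V (λ u → D * (∑ V (λ y → 𝟙 (adj G u y) * walksFrom G 2 y) + ∑ V (λ y → 𝟙 (adj G u y) * (deg G u * deg G y))))
        ≡⟨ trans (∑-*ˡ V D _) (cong (D *_) (trans (∑-+ V _ _) (cong (walks G 3 +_) ∑-edges-degrees))) ⟩
      D * (walks G 3 + walks G 3)
        ≡⟨ eq₂ D (walks G 3) ⟩
      2 * D * walks G 3 ∎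
      where
      open ≤-Reasoning
      eq₁ : ∀ a d w p → a * (d * w + d * p) ≡ d * (a * w + a * p)
      eq₁ = solve-∀
      eq₂ : ∀ d w → d * (w + w) ≡ 2 * d * w
      eq₂ = solve-∀
      bools : ∀ a b c d s → 𝟙 (a ∧ b) * 𝟙 ((c ∧ d) ∧ s) ≡ 𝟙 s * (𝟙 (a ∧ c) * 𝟙 (b ∧ d))
      bools true  true  true  true  s = trans (*-identityˡ _) (≡-sym (*-identityʳ _))
      bools true  true  true  false s = ≡-sym (*-zeroʳ (𝟙 s))
      bools true  true  false d     s = ≡-sym (*-zeroʳ (𝟙 s))
      bools true  false c     d     s = ≡-sym (trans (cong (𝟙 s *_) (*-zeroʳ (𝟙 c))) (*-zeroʳ (𝟙 s)))
      bools false b     c     d     s = ≡-sym (*-zeroʳ (𝟙 s))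
      split : ∀ u y → ∑ vertexPairs (λ { (x , z) → 𝟙 (adj G u x ∧ adj G y z) * sharedColour ((u , y) , (x , z)) })
        ≡ ∑ V (λ u′ → ∑ V (λ y′ → 𝟙 (sameColour u y u′ y′) * (codeg G u u′ * codeg G y y′)))
      split u y = begin-equality
        ∑ vertexPairs (λ { (x , z) → 𝟙 (adj G u x ∧ adj G y z) * sharedColour ((u , y) , (x , z)) })
          ≡⟨ ∑-cong vertexPairs (λ { (x , z) → ≡-sym (∑-*ˡ vertexPairs (𝟙 (adj G u x ∧ adj G y z)) _) }) ⟩
        ∑ vertexPairs (λ { (x , z) → ∑ vertexPairs (λ { (u′ , y′) → 𝟙 (adj G u x ∧ adj G y z) * 𝟙 ((adj G u′ x ∧ adj G y′ z) ∧ sameColour u y u′ y′) }) })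
          ≡⟨ ∑-cong vertexPairs (λ { (x , z) → ∑-cong vertexPairs (λ { (u′ , y′) → bools (adj G u x) (adj G y z) (adj G u′ x) (adj G y′ z) (sameColour u y u′ y′) }) }) ⟩
        ∑ vertexPairs (λ { (x , z) → ∑ vertexPairs (λ { (u′ , y′) → 𝟙 (sameColour u y u′ y′) * (𝟙 (adj G u x ∧ adj G u′ x) * 𝟙 (adj G y z ∧ adj G y′ z)) }) })
          ≡⟨ ∑-swap vertexPairs vertexPairs (λ { (x , z) (u′ , y′) → 𝟙 (sameColour u y u′ y′) * (𝟙 (adj G u x ∧ adj G u′ x) * 𝟙 (adj G y z ∧ adj G y′ z)) }) ⟩
        ∑ vertexPairs (λ { (u′ , y′) → ∑ vertexPairs (λ { (x , z) → 𝟙 (sameColour u y u′ y′) * (𝟙 (adj G u x ∧ adj G u′ x) * 𝟙 (adj G y z ∧ adj G y′ z)) }) })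
          ≡⟨ ∑-pairs _ ⟩
        ∑ V (λ u′ → ∑ V (λ y′ → ∑ vertexPairs (λ { (x , z) → 𝟙 (sameColour u y u′ y′) * (𝟙 (adj G u x ∧ adj G u′ x) * 𝟙 (adj G y z ∧ adj G y′ z)) })))
          ≡⟨ ∑-cong V (λ u′ → ∑-cong V (λ y′ → trans (∑-*ˡ vertexPairs (𝟙 (sameColour u y u′ y′)) (λ { (x , z) → 𝟙 (adj G u x ∧ adj G u′ x) * 𝟙 (adj G y z ∧ adj G y′ z) }))
               (cong (𝟙 (sameColour u y u′ y′) *_) (trans (∑-pairs _) (∑-product (λ x → 𝟙 (adj G u x ∧ adj G u′ x)) (λ z → 𝟙 (adj G y z ∧ adj G y′ z))))))) ⟩
        ∑ V (λ u′ → ∑ V (λ y′ → 𝟙 (sameColour u y u′ y′) * (codeg G u u′ * codeg G y y′))) ∎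
      edge-bound : ∀ u y → ∑ vertexPairs (λ xz → 𝟙 (isWalk ((u , y) , xz)) * sharedColour ((u , y) , xz))
        ≤ 𝟙 (adj G u y) * (D * walksFrom G 2 y + D * (deg G u * deg G y))
      edge-bound u y with adj G u y in uy
      ... | false = ≤-reflexive (∑-zero vertexPairs)
      ... | true with adj-colour G uy
      ...   | c , e = ≤-trans (≤-reflexive (trans (∑-cong vertexPairs (λ { (x , z) → refl })) (split u y)))
                        (≤-trans (shared-edges e) (≤-reflexive (≡-sym (*-identityˡ _))))

    #-popular : 2 * # walks₃ (λ t → isWalk t ∧ popular t) ≤ walks G 3
    #-popular = *-cancelˡ-≤ (2 * D) {{>-nonZero (≤-trans 1≤D (m≤m+n D _))}} (begin
      -- Markov's inequality: `sharedColour` averages at most `2 * D`, so at most half of the walks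
      -- exceed `4 * D`.
      2 * D * (2 * S)                                       ≡⟨ eq D S ⟩
      4 * D * S                                             ≡⟨ ∑-*ˡ walks₃ (4 * D) _ ⟨
      ∑ walks₃ (λ t → 4 * D * 𝟙 (isWalk t ∧ popular t))    ≤⟨ ∑-mono walks₃ (λ t → each (isWalk t) (4 * D) (sharedColour t)) ⟩
      ∑ walks₃ (λ t → 𝟙 (isWalk t) * sharedColour t)       ≤⟨ ∑-sharedColour ⟩
      2 * D * walks G 3                                     ∎)
      where
      open ≤-Reasoning
      S = # walks₃ (λ t → isWalk t ∧ popular t)
      eq : ∀ d s → 2 * d * (2 * s) ≡ 4 * d * s
      eq = solve-∀
      each : ∀ b r s → r * 𝟙 (b ∧ does (r <? s)) ≤ 𝟙 b * s
      each false r s = ≤-reflexive (*-zeroʳ r)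
      each true  r s with r <ᵇ s in e
      ... | false = ≤-trans (≤-reflexive (*-zeroʳ r)) z≤n
      ... | true  = ≤-trans (≤-reflexive (*-identityʳ r)) (≤-trans (<⇒≤ (does-<⇒< e)) (≤-reflexive (≡-sym (*-identityˡ s))))

    good : Walk₃ → Bool
    good t = isWalk t ∧ ((not (heavy-xy t) ∧ not (heavy-uz t)) ∧ (not (ends t) ∧ not (popular t)))

    -- All walks are counted twice; the popular ones then cost no more than one copy of `walks G 3`,
    -- which cancels.
    walks-3-bound : walks G 3 ≤ (4 * D + 2) * walks G 2 + 2 * # walks₃ good
    walks-3-bound = +-cancelʳ-≤ (walks G 3) _ _ (begin
      walks G 3 + walks G 3                    ≡⟨ cong₂ _+_ #-walks₃ #-walks₃ ⟨
      # walks₃ isWalk + # walks₃ isWalk        ≤⟨ +-mono-≤ cover cover ⟩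
      S + S                                    ≤⟨ +-mono-≤ S-bound S-bound ⟩
      (D * w + (D * w + (w + (p + g)))) + (D * w + (D * w + (w + (p + g))))
                                               ≡⟨ eq D w p g ⟩
      ((4 * D + 2) * w + 2 * g) + 2 * p        ≤⟨ +-monoʳ-≤ ((4 * D + 2) * w + 2 * g) #-popular ⟩
      ((4 * D + 2) * w + 2 * g) + walks G 3    ∎)
      where
      open ≤-Reasoning
      w = walks G 2
      p = # walks₃ (λ t → isWalk t ∧ popular t)
      g = # walks₃ good
      S = # walks₃ (λ t → isWalk t ∧ heavy-xy t) + (# walks₃ (λ t → isWalk t ∧ heavy-uz t) + (# walks₃ (λ t → isWalk t ∧ ends t) + (p + g)))
      eq : ∀ D w p g → (D * w + (D * w + (w + (p + g)))) + (D * w + (D * w + (w + (p + g)))) ≡ ((4 * D + 2) * w + 2 * g) + 2 * p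
      eq = solve-∀
      S-bound : S ≤ D * w + (D * w + (w + (p + g)))
      S-bound = +-mono-≤ #-heavy-xy (+-mono-≤ #-heavy-uz (+-monoˡ-≤ (p + g) #-ends))
      cases : ∀ i a b c d → 𝟙 i ≤ 𝟙 (i ∧ a) + (𝟙 (i ∧ b) + (𝟙 (i ∧ c) + (𝟙 (i ∧ d) + 𝟙 (i ∧ ((not a ∧ not b) ∧ (not c ∧ not d))))))
      cases false a b c d = z≤n
      cases true true  b     c     d     = s≤s z≤n
      cases true false true  c     d     = s≤s z≤n
      cases true false false true  d     = s≤s z≤n
      cases true false false false true  = s≤s z≤n
      cases true false false false false = s≤s z≤n
      cover : # walks₃ isWalk ≤ S
      cover = ≤-trans (∑-mono walks₃ (λ t → cases (isWalk t) (heavy-xy t) (heavy-uz t) (ends t) (popular t)))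
        (≤-reflexive (trans (∑-+ walks₃ _ _) (cong (# walks₃ (λ t → isWalk t ∧ heavy-xy t) +_)
          (trans (∑-+ walks₃ _ _) (cong (# walks₃ (λ t → isWalk t ∧ heavy-uz t) +_)
          (trans (∑-+ walks₃ _ _) (cong (# walks₃ (λ t → isWalk t ∧ ends t) +_) (∑-+ walks₃ _ _))))))))

-- Rainbow cycles from good walks

module _ {n : ℕ} (G : PCGraph n) (k m D d : ℕ) (m-def : m ≡ 6 + 2 * k) (d-def : d ≡ 6 * D * (m + m)) (1≤D : 1 ≤ D)
         (few-heavy : ∀ x → ∑ (vertices G) (λ w → 𝟙 (heavy G D x w) * codeg G x w) ≤ D * deg G x)
         (norainbow : ¬ RainbowCycle G m) where

  private
    V = vertices G

    E : Set
    E = Fin n × Fin n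

    ok : Walk₃ G → Bool
    ok = good G D 1≤D few-heavy

    -- The labels match the two moves of the construction: `((u , y) , x)` offers many new ends `z`,
    -- and `(x , z)` many ways from `z` back to `x`. Those of the first kind are listed only for
    -- `cherries`, of which there are `walks G 2`, so that the number of labels is quadratic in `n`.
    Label : Set
    Label = (E × Fin n) ⊎ (Fin n × Fin n)

    _≟²_ : (a b : Fin n × Fin n) → Dec (a ≡ b)
    _≟²_ = ×-≡-dec _≟ᶠ_ _≟ᶠ_

    _≟³_ : (a b : E × Fin n) → Dec (a ≡ b)
    _≟³_ = ×-≡-dec _≟²_ _≟ᶠ_

    inc : Label → Walk₃ G → Bool
    inc (inj₁ l) (e , (x , z))  = does ((e , x) ≟³ l)
    inc (inj₂ l) (e , xz)       = does (xz ≟² l)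

    cherry : E × Fin n → Bool
    cherry ((u , y) , x) = adj G u y ∧ adj G u x

    cherries : List (E × Fin n)
    cherries = filterᵇ cherry (cartesianProduct (vertexPairs G) V)

    labels : List Label
    labels = map inj₁ cherries ++ map inj₂ (vertexPairs G)

    walks₃-unique : Unique (walks₃ G)
    walks₃-unique = cartesianProduct⁺ pairs-unique pairs-unique
      where
      pairs-unique = cartesianProduct⁺ (vertices-unique G) (vertices-unique G)

    record Good (u y x z : Fin n) : Set where
      field
        uy : adj G u y ≡ true
        ux : adj G u x ≡ true
        yz : adj G y z ≡ true
        light-yx : codeg G y x ≤ D
        light-uz : codeg G u z ≤ D
        ends≢ : col G y z ≢ col G u x
        unpopular : sharedColour G ((u , y) , (x , z)) ≤ 4 * D
    open Good

    not-true : ∀ {b} → not b ≡ true → b ≡ false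
    not-true {false} _ = refl

    not-<ᵇ : ∀ a b → not (does (a <? b)) ≡ true → b ≤ a
    not-<ᵇ a b h = ≮⇒≥ (λ lt → true≢false (dec-true (a <? b) lt) (not-true h))

    ok⇒Good : ∀ {u y x z} → ok ((u , y) , (x , z)) ≡ true → Good u y x z
    ok⇒Good {u} {y} {x} {z} h
      with ∧-split {adj G u y ∧ (adj G u x ∧ adj G y z)} h
    ... | w , r with ∧-split {adj G u y} w | ∧-split r
    ... | uy₁ , w′ | l , s with ∧-split {adj G u x} w′ | ∧-split l | ∧-split s
    ... | ux₁ , yz₁ | l₁ , l₂ | s₁ , s₂ = record
      { uy = uy₁ ; ux = ux₁ ; yz = yz₁
      ; light-yx = not-<ᵇ D _ l₁ ; light-uz = not-<ᵇ D _ l₂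
      ; ends≢ = λ eq → true≢false (dec-true (_≟ᶜ_ G (col G y z) (col G u x)) eq) (not-true s₁)
      ; unpopular = not-<ᵇ (4 * D) _ s₂ }

    Survives : (Walk₃ G → Bool) → Set
    Survives q = ∀ ℓ → ℓ ∈ labels → ∀ t → q t ≡ true → inc ℓ t ≡ true → d < # (walks₃ G) (λ t′ → q t′ ∧ inc ℓ t′)

    fibre : (q : Walk₃ G → Bool) → Fin n → Fin n → Walk₃ G → Bool
    fibre q x z t = q t ∧ inc (inj₂ (x , z)) t

    module _ (q : Walk₃ G → Bool) (sub : ∀ t → q t ≡ true → ok t ≡ true) (big : Survives q) where

      good-walk : ∀ {u y x z} → q ((u , y) , (x , z)) ≡ true → Good u y x z
      good-walk h = ok⇒Good (sub _ h)

      big-uyx : ∀ {u y x z} → q ((u , y) , (x , z)) ≡ true → d < # (walks₃ G) (λ t → q t ∧ inc (inj₁ ((u , y) , x)) t)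
      big-uyx {u} {y} {x} {z} h = big (inj₁ ((u , y) , x))
        (∈-++⁺ˡ (∈-map⁺ inj₁ (∈-filterᵇ cherry (∈-cartesianProduct⁺ (∈-pairs (u , y)) (∈-allFin x)) (∧-join (uy (good-walk h)) (ux (good-walk h))))))
        ((u , y) , (x , z)) h (dec-true (((u , y) , x) ≟³ ((u , y) , x)) refl)

      big-xz : ∀ {u y x z} → q ((u , y) , (x , z)) ≡ true → d < # (walks₃ G) (fibre q x z)
      big-xz {u} {y} {x} {z} h = big (inj₂ (x , z))
        (∈-++⁺ʳ (map inj₁ cherries) (∈-map⁺ inj₂ (∈-pairs (x , z))))
        ((u , y) , (x , z)) h (dec-true ((x , z) ≟² (x , z)) refl)

      at-xz : ∀ {x z t} → fibre q x z t ≡ true → proj₂ t ≡ (x , z) × q t ≡ true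
      at-xz {x} {z} {e , xz} h with ∧-split {q (e , xz)} h
      ... | qt , i = does-sound (xz ≟² (x , z)) i , qt

      at-uyx : ∀ {l t} → q t ∧ inc (inj₁ l) t ≡ true → (proj₁ t , proj₁ (proj₂ t)) ≡ l × q t ≡ true
      at-uyx {l} {e , (x , z)} h with ∧-split {q (e , (x , z))} h
      ... | qt , i = does-sound ((e , x) ≟³ l) i , qt

      -- A fixed `y` leaves only common neighbours of `y` and `x` for `u`, and this pair is light
      -- because it belongs to a survivor.
      few-with-y : ∀ x z (κ : Walk₃ G → Bool) →
        (∀ {u y u′ y′} → κ ((u , y) , (x , z)) ≡ true → κ ((u′ , y′) , (x , z)) ≡ true → q ((u , y) , (x , z)) ≡ true → q ((u′ , y′) , (x , z)) ≡ true → y ≡ y′) →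
        # (walks₃ G) (λ t → fibre q x z t ∧ κ t) ≤ D
      few-with-y x z κ same = #≤-by-member (walks₃ G) _ D bound
        where
        bound : ∀ t → fibre q x z t ∧ κ t ≡ true → # (walks₃ G) (λ t → fibre q x z t ∧ κ t) ≤ D
        bound ((u₀ , y₀) , _) h₀ with ∧-split {fibre q x z ((u₀ , y₀) , _)} h₀
        ... | f₀ , κ₀ with at-xz f₀
        ... | refl , q₀ = ≤-trans
          (#-injection _≟ᶠ_ _ (λ u → adj G y₀ u ∧ adj G x u) (λ t → proj₁ (proj₁ t)) walks₃-unique (λ t → ∈-allFin _) into inj)
          (light-yx (good-walk q₀))
          where
          y-fixed : ∀ t → fibre q x z t ∧ κ t ≡ true → proj₂ (proj₁ t) ≡ y₀ × proj₂ t ≡ (x , z) × q t ≡ true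
          y-fixed ((u , y) , _) h with ∧-split {fibre q x z ((u , y) , _)} h
          ... | f , κt with at-xz f
          ... | refl , qt = same κt κ₀ qt q₀ , refl , qt
          into : ∀ t → fibre q x z t ∧ κ t ≡ true → adj G y₀ (proj₁ (proj₁ t)) ∧ adj G x (proj₁ (proj₁ t)) ≡ true
          into ((u , y) , xz) h with y-fixed ((u , y) , xz) h
          ... | refl , refl , qt = ∧-join (trans (adj-sym G y₀ u) (uy (good-walk qt))) (trans (adj-sym G x u) (ux (good-walk qt)))
          inj : ∀ t t′ → fibre q x z t ∧ κ t ≡ true → fibre q x z t′ ∧ κ t′ ≡ true → proj₁ (proj₁ t) ≡ proj₁ (proj₁ t′) → t ≡ t′
          inj ((u , y) , xz) ((u′ , y′) , xz′) h h′ refl with y-fixed ((u , y) , xz) h | y-fixed ((u′ , y′) , xz′) h′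
          ... | refl , refl , _ | refl , refl , _ = refl

      -- By the same argument with the ends exchanged, `y` is then a common neighbour of the light
      -- pair `(u , z)`.
      few-with-u : ∀ x z (κ : Walk₃ G → Bool) →
        (∀ {u y u′ y′} → κ ((u , y) , (x , z)) ≡ true → κ ((u′ , y′) , (x , z)) ≡ true → q ((u , y) , (x , z)) ≡ true → q ((u′ , y′) , (x , z)) ≡ true → u ≡ u′) →
        # (walks₃ G) (λ t → fibre q x z t ∧ κ t) ≤ D
      few-with-u x z κ same = #≤-by-member (walks₃ G) _ D bound
        where
        bound : ∀ t → fibre q x z t ∧ κ t ≡ true → # (walks₃ G) (λ t → fibre q x z t ∧ κ t) ≤ D
        bound ((u₀ , y₀) , _) h₀ with ∧-split {fibre q x z ((u₀ , y₀) , _)} h₀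
        ... | f₀ , κ₀ with at-xz f₀
        ... | refl , q₀ = ≤-trans
          (#-injection _≟ᶠ_ _ (λ y → adj G u₀ y ∧ adj G z y) (λ t → proj₂ (proj₁ t)) walks₃-unique (λ t → ∈-allFin _) into inj)
          (light-uz (good-walk q₀))
          where
          u-fixed : ∀ t → fibre q x z t ∧ κ t ≡ true → proj₁ (proj₁ t) ≡ u₀ × proj₂ t ≡ (x , z) × q t ≡ true
          u-fixed ((u , y) , _) h with ∧-split {fibre q x z ((u , y) , _)} h
          ... | f , κt with at-xz f
          ... | refl , qt = same κt κ₀ qt q₀ , refl , qt
          into : ∀ t → fibre q x z t ∧ κ t ≡ true → adj G u₀ (proj₂ (proj₁ t)) ∧ adj G z (proj₂ (proj₁ t)) ≡ true
          into ((u , y) , xz) h with u-fixed ((u , y) , xz) h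
          ... | refl , refl , qt = ∧-join (uy (good-walk qt)) (trans (adj-sym G z y) (yz (good-walk qt)))
          inj : ∀ t t′ → fibre q x z t ∧ κ t ≡ true → fibre q x z t′ ∧ κ t′ ≡ true → proj₂ (proj₁ t) ≡ proj₂ (proj₁ t′) → t ≡ t′
          inj ((u , y) , xz) ((u′ , y′) , xz′) h h′ refl with u-fixed ((u , y) , xz) h | u-fixed ((u′ , y′) , xz′) h′
          ... | refl , refl , _ | refl , refl , _ = refl

      -- Properness does not help, since the colour of the middle edge fixes neither of its ends.
      -- But any single such walk is unpopular, and all the others share its middle colour.
      few-with-colour : ∀ x z c → # (walks₃ G) (λ t → fibre q x z t ∧ hasColour G (proj₁ (proj₁ t)) (proj₂ (proj₁ t)) c) ≤ 4 * D
      few-with-colour x z c = #≤-by-member (walks₃ G) _ (4 * D) bound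
        where
        p : Walk₃ G → Bool
        p t = fibre q x z t ∧ hasColour G (proj₁ (proj₁ t)) (proj₂ (proj₁ t)) c
        unpack : ∀ t → p t ≡ true → col G (proj₁ (proj₁ t)) (proj₂ (proj₁ t)) ≡ just c × proj₂ t ≡ (x , z) × q t ≡ true
        unpack t h with ∧-split {fibre q x z t} h
        ... | f , e with at-xz {t = t} f
        ... | eq , qt = hasColour-sound G e , eq , qt
        bound : ∀ t → p t ≡ true → # (walks₃ G) p ≤ 4 * D
        bound ((u₀ , y₀) , xz₀) h₀ with unpack ((u₀ , y₀) , xz₀) h₀
        ... | c₀ , refl , q₀ = ≤-trans
          (#-injection _≟²_ _ (λ { (u′ , y′) → (adj G u′ x ∧ adj G y′ z) ∧ sameColour G u₀ y₀ u′ y′ }) proj₁ walks₃-unique (λ t → ∈-pairs _) into inj)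
          (unpopular (good-walk q₀))
          where
          into : ∀ t → p t ≡ true → (adj G (proj₁ (proj₁ t)) x ∧ adj G (proj₂ (proj₁ t)) z) ∧ sameColour G u₀ y₀ (proj₁ (proj₁ t)) (proj₂ (proj₁ t)) ≡ true
          into ((u , y) , xz) h with unpack ((u , y) , xz) h
          ... | ct , refl , qt = ∧-join (∧-join (ux (good-walk qt)) (yz (good-walk qt)))
            (dec-true (_≟ᶜ_ G (col G u y) (col G u₀ y₀)) (trans ct (≡-sym c₀)))
          inj : ∀ t t′ → p t ≡ true → p t′ ≡ true → proj₁ t ≡ proj₁ t′ → t ≡ t′
          inj (e , xz) (e′ , xz′) h h′ refl with unpack (e , xz) h | unpack (e′ , xz′) h′
          ... | _ , refl , _ | _ , refl , _ = refl

      few-z : ∀ u y x (κ : Fin n → Bool) → (∀ {z z′} → κ z ≡ true → κ z′ ≡ true → z ≡ z′) →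
        # (walks₃ G) (λ t → (q t ∧ inc (inj₁ ((u , y) , x)) t) ∧ κ (proj₂ (proj₂ t))) ≤ 1
      few-z u y x κ h = #≤1 _ walks₃-unique same
        where
        same : ∀ t t′ → (q t ∧ inc (inj₁ ((u , y) , x)) t) ∧ κ (proj₂ (proj₂ t)) ≡ true →
          (q t′ ∧ inc (inj₁ ((u , y) , x)) t′) ∧ κ (proj₂ (proj₂ t′)) ≡ true → t ≡ t′
        same t@(_ , (_ , z)) t′@(_ , (_ , z′)) e e′
          with ∧-split {q t ∧ inc (inj₁ ((u , y) , x)) t} e | ∧-split {q t′ ∧ inc (inj₁ ((u , y) , x)) t′} e′
        ... | f , κz | f′ , κz′ with at-uyx {t = t} f | at-uyx {t = t′} f′ | h κz κz′
        ... | refl , _ | refl , _ | refl = refl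

      module _ (x : Fin n) where

        Q : E → Fin n → Set
        Q e z = q (e , (x , z)) ≡ true

        room : ∀ r (vs : List (Fin n)) (cs : List ℕ) → r ≤ 6 * D → length vs ≤ m → length cs ≤ m → r * (length vs + length cs) ≤ d
        room r vs cs hr hv hc = ≤-trans (*-mono-≤ hr (+-mono-≤ hv hc)) (≤-reflexive (≡-sym d-def))

        nextZ : ∀ e z vs cs → Q e z → length vs ≤ m → length cs ≤ m →
          ∃ λ z′ → Q e z′ × z′ ∉ vs × ∃ λ c → col G (proj₂ e) z′ ≡ just c × c ∉ cs
        nextZ (u , y) z vs cs h hv hc = found (avoid-two (walks₃ G) (λ t → q t ∧ inc (inj₁ ((u , y) , x)) t) 1
            (λ v t → does (proj₂ (proj₂ t) ≟ᶠ v)) vs (λ c t → hasColour G y (proj₂ (proj₂ t)) c) cs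
            (λ v → few-z u y x (λ z → does (z ≟ᶠ v)) (λ a b → trans (does-≟⇒≡ a) (≡-sym (does-≟⇒≡ b))))
            (λ c → few-z u y x (λ z → hasColour G y z c) (λ {z} {z′} a b → proper G y z z′ c (hasColour-sound G a) (hasColour-sound G b)))
            (≤-<-trans (room 1 vs cs (≤-trans 1≤D (m≤n*m D 6)) hv hc) (big-uyx h)))
          where
          found : (∃ λ t → q t ∧ inc (inj₁ ((u , y) , x)) t ≡ true × (∀ {v} → v ∈ vs → does (proj₂ (proj₂ t) ≟ᶠ v) ≡ false) ×
                     (∀ {c} → c ∈ cs → hasColour G y (proj₂ (proj₂ t)) c ≡ false)) →
            ∃ λ z′ → Q (u , y) z′ × z′ ∉ vs × ∃ λ c → col G y z′ ≡ just c × c ∉ cs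
          found (t@(_ , (_ , z′)) , e , fv , fc) with at-uyx {t = t} e
          ... | refl , qt with adj-colour G (yz (good-walk qt))
          ...   | c , ce = z′ , qt , ∉-from-does fv , c , ce , ∉-from-hasColour G ce fc

        record Fresh (z : Fin n) (vs : List (Fin n)) (cs : List ℕ) : Set where
          field
            u y : Fin n
            walk : Q (u , y) z
            u∉ : u ∉ vs
            y∉ : y ∉ vs
            zy-colour xu-colour uy-colour : ℕ
            zy : col G z y ≡ just zy-colour
            xu : col G x u ≡ just xu-colour
            uy-col : col G u y ≡ just uy-colour
            zy∉ : zy-colour ∉ cs
            xu∉ : xu-colour ∉ cs
            uy∉ : uy-colour ∉ cs

        hit-vertex : Fin n → Walk₃ G → Bool
        hit-vertex v ((u , y) , _) = does (u ≟ᶠ v) ∨ does (y ≟ᶠ v)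

        hit-colour : Fin n → ℕ → Walk₃ G → Bool
        hit-colour z c ((u , y) , _) = hasColour G z y c ∨ (hasColour G x u c ∨ hasColour G u y c)

        few-hit-vertex : ∀ z v → # (walks₃ G) (λ t → fibre q x z t ∧ hit-vertex v t) ≤ 6 * D
        few-hit-vertex z v = ≤-trans (#-∨ (walks₃ G) (fibre q x z) (λ t → does (proj₁ (proj₁ t) ≟ᶠ v)) (λ t → does (proj₂ (proj₁ t) ≟ᶠ v)))
          (≤-trans (+-mono-≤ (few-with-u x z (λ t → does (proj₁ (proj₁ t) ≟ᶠ v)) (λ a b _ _ → trans (does-≟⇒≡ a) (≡-sym (does-≟⇒≡ b))))
                             (few-with-y x z (λ t → does (proj₂ (proj₁ t) ≟ᶠ v)) (λ a b _ _ → trans (does-≟⇒≡ a) (≡-sym (does-≟⇒≡ b)))))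
            (≤-trans (m≤m+n (D + D) (4 * D)) (≤-reflexive (eq D))))
          where
          eq : ∀ D → D + D + 4 * D ≡ 6 * D
          eq = solve-∀

        -- The origin of the factor `6 * D` in `d`: a used colour on `zy` fixes `y` and one on `xu`
        -- fixes `u`, leaving `D` walks each, and the middle edge accounts for `4 * D`.
        few-hit-colour : ∀ z c → # (walks₃ G) (λ t → fibre q x z t ∧ hit-colour z c t) ≤ 6 * D
        few-hit-colour z c = ≤-trans (#-∨ (walks₃ G) (fibre q x z) (λ t → hasColour G z (proj₂ (proj₁ t)) c) (λ t → hasColour G x (proj₁ (proj₁ t)) c ∨ hasColour G (proj₁ (proj₁ t)) (proj₂ (proj₁ t)) c))
          (≤-trans (+-mono-≤ (few-with-y x z (λ t → hasColour G z (proj₂ (proj₁ t)) c) (λ {_} {y} {_} {y′} a b _ _ → proper G z y y′ c (hasColour-sound G a) (hasColour-sound G b)))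
            (≤-trans (#-∨ (walks₃ G) (fibre q x z) (λ t → hasColour G x (proj₁ (proj₁ t)) c) (λ t → hasColour G (proj₁ (proj₁ t)) (proj₂ (proj₁ t)) c))
              (+-mono-≤ (few-with-u x z (λ t → hasColour G x (proj₁ (proj₁ t)) c) (λ {u} {_} {u′} a b _ _ → proper G x u u′ c (hasColour-sound G a) (hasColour-sound G b)))
                        (few-with-colour x z c))))
            (≤-reflexive (eq D)))
          where
          eq : ∀ D → D + (D + 4 * D) ≡ 6 * D
          eq = solve-∀

        fresh : ∀ {e} z vs cs → Q e z → length vs ≤ m → length cs ≤ m → Fresh z vs cs
        fresh z vs cs h hv hc = found (avoid-two (walks₃ G) (fibre q x z) (6 * D) hit-vertex vs (hit-colour z) cs
            (few-hit-vertex z) (few-hit-colour z) (≤-<-trans (room (6 * D) vs cs ≤-refl hv hc) (big-xz h)))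
          where
          found : (∃ λ t → fibre q x z t ≡ true × (∀ {v} → v ∈ vs → hit-vertex v t ≡ false) × (∀ {c} → c ∈ cs → hit-colour z c t ≡ false)) →
            Fresh z vs cs
          found (((u₁ , y₁) , xz) , f , fv , fc) with at-xz {t = (u₁ , y₁) , xz} f
          ... | refl , qt with adj-colour G (trans (adj-sym G z y₁) (yz (good-walk qt))) | adj-colour G (trans (adj-sym G x u₁) (ux (good-walk qt))) | adj-colour G (uy (good-walk qt))
          ...   | c₁ , e₁ | c₂ , e₂ | c₃ , e₃ = record
            { u = u₁ ; y = y₁ ; walk = qt
            ; u∉ = ∉-from-does (λ i → proj₁ (∨-false (fv i)))
            ; y∉ = ∉-from-does (λ {v} i → proj₂ (∨-false {does (u₁ ≟ᶠ v)} (fv i)))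
            ; zy = e₁ ; xu = e₂ ; uy-col = e₃
            ; zy∉ = ∉-from-hasColour G e₁ (λ i → proj₁ (∨-false (fc i)))
            ; xu∉ = ∉-from-hasColour G e₂ (λ {c} i → proj₁ (∨-false (proj₂ (∨-false {hasColour G z y₁ c} (fc i)))))
            ; uy∉ = ∉-from-hasColour G e₃ (λ {c} i → proj₂ (∨-false {hasColour G x u₁ c} (proj₂ (∨-false {hasColour G z y₁ c} (fc i)))))
            }

        nextE : ∀ e z vs cs → Q e z → length vs ≤ m → length cs ≤ m →
          ∃ λ e′ → Q e′ z × proj₂ e′ ∉ vs × ∃ λ c → col G z (proj₂ e′) ≡ just c × c ∉ cs
        nextE e z vs cs h hv hc = (u , y) , walk , y∉ , zy-colour , zy , zy∉
          where open Fresh (fresh z vs cs h hv hc)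

        -- The three edges of the way back are now used together, so their colours must also differ
        -- from each other: adjacent edges by properness, the two outer ones by `ends≢`.
        close : ∀ {e z vs cs} → Trail G x z vs cs → Q e z → length vs ≡ suc (3 + 2 * k) → RainbowCycle G m
        close {e} {z} {vs} {cs} t h len = close-trail G
            (extend (extend t zy y∉ zy∉) (trans (sym G y u) uy-col) u∉′ uy∉′) (trans (sym G u x) xu) xu∉′
            (trans (cong (λ l → suc (suc l)) len) (≡-sym m-def))
          where
          len′ : length vs ≤ m
          len′ = ≤-trans (≤-trans (n≤1+n _) (n≤1+n _)) (≤-reflexive (trans (cong (λ l → suc (suc l)) len) (≡-sym m-def)))
          open Fresh (fresh z vs cs h len′ (trail-colours≤ G t len′))
          u∉′ : u ∉ y ∷ vs
          u∉′ (here e)  = adj-irrefl G (uy (good-walk walk)) e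
          u∉′ (there i) = u∉ i
          uy∉′ : uy-colour ∉ zy-colour ∷ cs
          uy∉′ (here e)  = u∉ (subst (_∈ vs) (proper′ G zy (trans uy-col (cong just e))) (trail-end-∈ G t))
          uy∉′ (there i) = uy∉ i
          xu∉′ : xu-colour ∉ uy-colour ∷ zy-colour ∷ cs
          xu∉′ (here e)          = y∉ (subst (_∈ vs) (proper G u x y _ (trans (trans (sym G u x) xu) (cong just e)) uy-col) (trail-start-∈ G t))
          xu∉′ (there (here e))  = ends≢ (good-walk walk) (trans (trans (sym G y z) zy) (trans (cong just (≡-sym e)) (≡-sym (trans (sym G u x) xu))))
          xu∉′ (there (there i)) = xu∉ i

        link-cycle₃ : ∀ {e z} → Q e z → RainbowCycle G m
        link-cycle₃ {e} {z} h = finish (alternate G proj₂ Q m nextZ nextE k first-steps walk start-length)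
          where
          2≤m : 1 ≤ m
          2≤m = ≤-trans (s≤s z≤n) (≤-reflexive (≡-sym m-def))
          -- The surviving walk at hand may pass through `x` again; a fresh one supplies `y ≢ x`, so
          -- that `x u y` begins a trail.
          open Fresh (fresh z (x ∷ []) [] h 2≤m z≤n)
          first-steps : Trail G x y (y ∷ u ∷ x ∷ []) (uy-colour ∷ xu-colour ∷ [])
          first-steps = extend (extend start xu u∉ (λ ())) uy-col y∉′ c∉
            where
            y∉′ : y ∉ u ∷ x ∷ []
            y∉′ (here e)  = adj-irrefl G (uy (good-walk walk)) (≡-sym e)
            y∉′ (there i) = y∉ i
            c∉ : uy-colour ∉ xu-colour ∷ []
            c∉ (here e) = y∉ (here (≡-sym (proper G u x y _ (trans (trans (sym G u x) xu) (cong just (≡-sym e))) uy-col)))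
          start-length : 3 + 2 * k ≤ m
          start-length = ≤-trans (m≤n+m (3 + 2 * k) 3) (≤-reflexive (≡-sym m-def))
          finish : (∃ λ e′ → ∃ λ z′ → ∃ λ vs′ → ∃ λ cs′ → Trail G x z′ vs′ cs′ × Q e′ z′ × length vs′ ≡ suc (3 + 2 * k)) → RainbowCycle G m
          finish (_ , _ , _ , _ , t , h′ , len) = close t h′ len

    labels-length : length labels ≡ walks G 2 + n * n
    labels-length = trans (length-++ (map inj₁ cherries)) (cong₂ _+_
      (trans (length-map inj₁ cherries) (trans (length-filterᵇ cherry (cartesianProduct (vertexPairs G) V)) cherry-count))
      (trans (length-map inj₂ (vertexPairs G)) pair-count))
      where
      cherry-count : # (cartesianProduct (vertexPairs G) V) cherry ≡ walks G 2
      cherry-count = trans (∑-cartesianProduct (vertexPairs G) V _) (trans (∑-pairs G _) (trans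
        (∑-cong V (λ u → trans (∑-cong V (λ y → ∑-cong V (λ x → 𝟙-∧ (adj G u y) (adj G u x)))) (∑-product G (λ y → 𝟙 (adj G u y)) (λ x → 𝟙 (adj G u x)))))
        (≡-sym (walks-2 G))))
      pair-count : length (vertexPairs G) ≡ n * n
      pair-count = trans (≡-sym (trans (∑-const (vertexPairs G) 1) (*-identityʳ _)))
        (trans (∑-pairs G _) (trans (∑-product G (λ _ → 1) (λ _ → 1))
          (cong₂ _*_ (walks-0 G) (walks-0 G))))

    #-good : # (walks₃ G) ok ≤ d * (walks G 2 + n * n)
    #-good = subst (λ l → # (walks₃ G) ok ≤ d * l) labels-length (≮⇒≥ contra)
      where
      contra : ¬ (d * length labels < # (walks₃ G) ok)
      contra dense with cleaning (walks₃ G) d inc labels ok dense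
      ... | q , sub , pos , big with #-exists (walks₃ G) q pos
      ...   | (e , (x , z)) , _ , h = norainbow (link-cycle₃ q sub big x h)

  walks-3-quadratic : walks G 3 ≤ ((4 * D + 2) * (2 * D) + 2 * (d * (2 * D + 1))) * (n * n)
  walks-3-quadratic = begin
    walks G 3                                                              ≤⟨ walks-3-bound G D 1≤D few-heavy ⟩
    (4 * D + 2) * w + 2 * # (walks₃ G) ok                                  ≤⟨ +-monoʳ-≤ ((4 * D + 2) * w) (*-monoʳ-≤ 2 #-good) ⟩
    (4 * D + 2) * w + 2 * (d * (w + n * n))                                ≤⟨ +-mono-≤ (*-monoʳ-≤ (4 * D + 2) w-bound) (*-monoʳ-≤ 2 (*-monoʳ-≤ d (+-monoˡ-≤ (n * n) w-bound))) ⟩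
    (4 * D + 2) * (2 * D * n * n) + 2 * (d * (2 * D * n * n + n * n))      ≡⟨ eq D d n ⟩
    ((4 * D + 2) * (2 * D) + 2 * (d * (2 * D + 1))) * (n * n)              ∎
    where
    open ≤-Reasoning
    w = walks G 2
    w-bound : w ≤ 2 * D * n * n
    w-bound = walks-2-bound G D few-heavy
    eq : ∀ D d n → (4 * D + 2) * (2 * D * n * n) + 2 * (d * (2 * D * n * n + n * n)) ≡ ((4 * D + 2) * (2 * D) + 2 * (d * (2 * D + 1))) * (n * n)
    eq = solve-∀

-- Primes between 4 ^ r and 4 ^ (r + 2)

prime≥2 : ∀ {p} → Prime p → 2 ≤ p
prime≥2 {p} pp = nonTrivial⇒n>1 p {{prime⇒nonTrivial pp}}

primeDivisor : ∀ n → 2 ≤ n → ∃ λ p → Prime p × p ∣ n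
primeDivisor n@(suc _) 2≤n with factorise n
... | record { factors = []     ; isFactorisation = eq } = ⊥-elim (<-irrefl (≡-sym eq) 2≤n)
... | record { factors = p ∷ ps ; isFactorisation = eq ; factorsPrime = pp ∷ _ } = p , pp , subst (p ∣_) (≡-sym eq) (m∣m*n _)

-- Common multiples of an initial segment and binomial coefficients

absorption : ∀ n k → suc k * (suc n C suc k) ≡ suc n * (n C k)
absorption n       zero    = trans (*-identityˡ _) (trans (nC1≡n (suc n)) (≡-sym (*-identityʳ (suc n))))
absorption zero    (suc k) = trans (cong (suc (suc k) *_) (k>n⇒nCk≡0 {1} {suc (suc k)} (s≤s (s≤s z≤n))))
  (trans (*-zeroʳ (suc (suc k))) (≡-sym (trans (+-identityʳ _) (k>n⇒nCk≡0 {0} {suc k} (s≤s z≤n)))))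
absorption (suc n) (suc k) = begin-equality
  suc (suc k) * (suc (suc n) C suc (suc k))
    ≡⟨ cong (suc (suc k) *_) (nCk+nC[k+1]≡[n+1]C[k+1] (suc n) (suc k)) ⟨
  suc (suc k) * ((suc n C suc k) + (suc n C suc (suc k)))
    ≡⟨ eq k (suc n C suc k) (suc n C suc (suc k)) ⟩
  (suc n C suc k) + (suc k * (suc n C suc k) + suc (suc k) * (suc n C suc (suc k)))
    ≡⟨ cong ((suc n C suc k) +_) (cong₂ _+_ (absorption n k) (absorption n (suc k))) ⟩
  (suc n C suc k) + (suc n * (n C k) + suc n * (n C suc k))
    ≡⟨ cong ((suc n C suc k) +_) (*-distribˡ-+ (suc n) (n C k) (n C suc k)) ⟨
  (suc n C suc k) + suc n * ((n C k) + (n C suc k))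
    ≡⟨ cong (λ a → (suc n C suc k) + suc n * a) (nCk+nC[k+1]≡[n+1]C[k+1] n k) ⟩
  suc (suc n) * (suc n C suc k) ∎
  where
  open ≤-Reasoning
  eq : ∀ k a b → suc (suc k) * (a + b) ≡ a + (suc k * a + suc (suc k) * b)
  eq = solve-∀

C-positive : ∀ n k → k ≤ n → 0 < n C k
C-positive n       zero    _       = s≤s z≤n
C-positive (suc n) (suc k) (s≤s h) = ≤-trans (C-positive n k h) (≤-trans (m≤m+n _ _) (≤-reflexive (nCk+nC[k+1]≡[n+1]C[k+1] n k)))

C-monoˡ : ∀ n k → n C k ≤ suc n C k
C-monoˡ n zero    = ≤-refl
C-monoˡ n (suc k) = ≤-trans (m≤n+m _ _) (≤-reflexive (nCk+nC[k+1]≡[n+1]C[k+1] n k))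

C≤2^ : ∀ n k → n C k ≤ 2 ^ n
C≤2^ n       zero    = m^n>0 2 n
C≤2^ zero    (suc k) = ≤-trans (≤-reflexive (k>n⇒nCk≡0 {0} {suc k} (s≤s z≤n))) z≤n
C≤2^ (suc n) (suc k) = ≤-trans (≤-reflexive (≡-sym (nCk+nC[k+1]≡[n+1]C[k+1] n k)))
  (≤-trans (+-mono-≤ (C≤2^ n k) (C≤2^ n (suc k))) (≤-reflexive (cong (2 ^ n +_) (≡-sym (+-identityʳ _)))))

2^≤central-C : ∀ m → 2 ^ m ≤ (m + m) C m
2^≤central-C zero    = ≤-refl
2^≤central-C (suc m) = begin
  2 ^ m + (2 ^ m + 0)                                       ≡⟨ cong (2 ^ m +_) (+-identityʳ _) ⟩
  2 ^ m + 2 ^ m                                             ≤⟨ +-mono-≤ (2^≤central-C m) (2^≤central-C m) ⟩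
  ((m + m) C m) + ((m + m) C m)                             ≤⟨ +-mono-≤ (C-monoˡ (m + m) m) (m≤m+n _ _) ⟩
  (suc (m + m) C m) + (((m + m) C m) + ((m + m) C suc m))   ≡⟨ cong ((suc (m + m) C m) +_) (nCk+nC[k+1]≡[n+1]C[k+1] (m + m) m) ⟩
  (suc (m + m) C m) + (suc (m + m) C suc m)                 ≡⟨ nCk+nC[k+1]≡[n+1]C[k+1] (suc (m + m)) m ⟩
  suc (suc (m + m)) C suc m                                 ≡⟨ cong (λ a → suc a C suc m) (+-suc m m) ⟨
  (suc m + suc m) C suc m                                   ∎
  where open ≤-Reasoning

-- 1/a′ = 1/b - 1/a, cleared of denominators.
harmonic-∣ : ∀ {a a′ b d} .{{_ : NonZero a}} .{{_ : NonZero b}} → a * a′ ≡ b * (a + a′) → a ∣ d → b ∣ d → a′ ∣ d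
harmonic-∣ {a} {a′} {b} {d} eq (divides s d≡sa) (divides t d≡tb) =
  ∣m+n∣m⇒∣n (subst (a′ ∣_) t*a′≡s*a′+d (n∣m*n t)) (n∣m*n s)
  where
  t*a′≡s*a′+d : t * a′ ≡ s * a′ + d
  t*a′≡s*a′+d = *-cancelˡ-≡ (t * a′) (s * a′ + d) a (*-cancelˡ-≡ (a * (t * a′)) (a * (s * a′ + d)) b (begin-equality
    b * (a * (t * a′))              ≡⟨ eq₁ a a′ b t ⟩
    (t * b) * (a * a′)              ≡⟨ cong₂ _*_ (≡-sym d≡tb) eq ⟩
    d * (b * (a + a′))              ≡⟨ eq₂ a a′ b d ⟩
    b * (d * a′ + a * d)            ≡⟨ cong (λ x → b * (x * a′ + a * d)) d≡sa ⟩
    b * (s * a * a′ + a * d)        ≡⟨ eq₃ a a′ b s d ⟩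
    b * (a * (s * a′ + d))          ∎))
    where
    open ≤-Reasoning
    eq₁ : ∀ a a′ b t → b * (a * (t * a′)) ≡ (t * b) * (a * a′)
    eq₁ = solve-∀
    eq₂ : ∀ a a′ b d → d * (b * (a + a′)) ≡ b * (d * a′ + a * d)
    eq₂ = solve-∀
    eq₃ : ∀ a a′ b s d → b * (s * a * a′ + a * d) ≡ b * (a * (s * a′ + d))
    eq₃ = solve-∀

-- The reciprocals of (n + 1) * (n C k) form Leibniz's harmonic triangle.
leibniz-∣ : ∀ {d} n k → k ≤ n → (∀ i → 1 ≤ i → i ≤ suc n → i ∣ d) → suc n * (n C k) ∣ d
leibniz-∣ {d} n zero    _       h = subst (_∣ d) (≡-sym (*-identityʳ (suc n))) (h (suc n) (s≤s z≤n) ≤-refl)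
leibniz-∣ {d} (suc n) (suc k) (s≤s k≤n) h =
  harmonic-∣ {{>-nonZero (*-mono-≤ {1} {suc (suc n)} (s≤s z≤n) (C-positive (suc n) k (m≤n⇒m≤1+n k≤n)))}}
             {{>-nonZero (*-mono-≤ {1} {suc n} (s≤s z≤n) (C-positive n k k≤n))}} identity
    (leibniz-∣ (suc n) k (m≤n⇒m≤1+n k≤n) h) (leibniz-∣ n k k≤n (λ i 1≤i i≤ → h i 1≤i (m≤n⇒m≤1+n i≤)))
  where
  open ≤-Reasoning
  identity : ((2 + n) * (suc n C k)) * ((2 + n) * (suc n C suc k)) ≡ (suc n * (n C k)) * ((2 + n) * (suc n C k) + (2 + n) * (suc n C suc k))
  identity = begin-equality
    ((2 + n) * (suc n C k)) * ((2 + n) * (suc n C suc k))                  ≡⟨ cong (_* ((2 + n) * (suc n C suc k))) (absorption (suc n) k) ⟨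
    (suc k * (suc (suc n) C suc k)) * ((2 + n) * (suc n C suc k))                ≡⟨ eq k (2 + n) (suc (suc n) C suc k) (suc n C suc k) ⟩
    (suc k * (suc n C suc k)) * ((2 + n) * (suc (suc n) C suc k))                ≡⟨ cong₂ (λ a b → a * ((2 + n) * b)) (absorption n k) (≡-sym (nCk+nC[k+1]≡[n+1]C[k+1] (suc n) k)) ⟩
    (suc n * (n C k)) * ((2 + n) * ((suc n C k) + (suc n C suc k)))        ≡⟨ cong ((suc n * (n C k)) *_) (*-distribˡ-+ (2 + n) (suc n C k) (suc n C suc k)) ⟩
    (suc n * (n C k)) * ((2 + n) * (suc n C k) + (2 + n) * (suc n C suc k)) ∎
    where
    eq : ∀ k n a b → (suc k * a) * (n * b) ≡ (suc k * b) * (n * a)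
    eq = solve-∀

-- The middle of a row of Leibniz's triangle: `d` is divisible by `2 * m + 2` times a binomial
-- coefficient that is at least `2 ^ m`.
common-multiple-≥ : ∀ d m → 0 < d → (∀ i → 1 ≤ i → i ≤ 2 * suc m → i ∣ d) → 2 ^ suc m ≤ d
common-multiple-≥ d m 0<d h = begin
  2 * 2 ^ m                                       ≤⟨ *-mono-≤ {2} {suc (suc (m + m))} (s≤s (s≤s z≤n)) (≤-trans (2^≤central-C m) (C-monoˡ (m + m) m)) ⟩
  suc (suc (m + m)) * (suc (m + m) C m)           ≤⟨ ∣⇒≤ {{>-nonZero 0<d}} (leibniz-∣ (suc (m + m)) m (m≤n⇒m≤1+n (m≤m+n m m)) (λ i 1≤i i≤ → h i 1≤i (≤-trans i≤ (≤-reflexive (eq m))))) ⟩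
  d                                               ∎
  where
  open ≤-Reasoning
  eq : ∀ m → suc (suc (m + m)) ≡ 2 * suc m
  eq = solve-∀

-- Products of the primes in an interval

primeProduct : ℕ → ℕ → ℕ
primeProduct m zero    = 1
primeProduct m (suc j) with prime? (m + suc j)
... | yes _ = primeProduct m j * (m + suc j)
... | no  _ = primeProduct m j

primeProduct-+ : ∀ m a b → primeProduct m (a + b) ≡ primeProduct m a * primeProduct (m + a) b
primeProduct-+ m a zero = trans (cong (primeProduct m) (+-identityʳ a)) (≡-sym (*-identityʳ _))
primeProduct-+ m a (suc b) rewrite +-suc a b with prime? (m + suc (a + b)) | prime? (m + a + suc b)
... | yes _ | yes _ = trans (cong₂ _*_ (primeProduct-+ m a b) (eq m a b)) (*-assoc (primeProduct m a) _ _)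
  where
  eq : ∀ m a b → m + suc (a + b) ≡ m + a + suc b
  eq = solve-∀
... | no _  | no _  = primeProduct-+ m a b
... | yes p | no ¬p = ⊥-elim (¬p (subst Prime (eq m a b) p))
  where
  eq : ∀ m a b → m + suc (a + b) ≡ m + a + suc b
  eq = solve-∀
... | no ¬p | yes p = ⊥-elim (¬p (subst Prime (eq m a b) p))
  where
  eq : ∀ m a b → m + a + suc b ≡ m + suc (a + b)
  eq = solve-∀

primeProduct-positive : ∀ m j → 0 < primeProduct m j
primeProduct-positive m zero    = s≤s z≤n
primeProduct-positive m (suc j) with prime? (m + suc j)
... | yes p = *-mono-≤ (primeProduct-positive m j) (≤-trans (s≤s z≤n) (prime≥2 p))
... | no  _ = primeProduct-positive m j

∣primeProduct : ∀ j p → Prime p → p ≤ j → p ∣ primeProduct 0 j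
∣primeProduct zero    p pp h = ⊥-elim (<⇒≱ (prime≥2 pp) (≤-trans h z≤n))
∣primeProduct (suc j) p pp h with prime? (suc j) | m≤n⇒m<n∨m≡n h
... | yes _ | inj₁ (s≤s p≤j) = ∣m⇒∣m*n (suc j) (∣primeProduct j p pp p≤j)
... | no  _ | inj₁ (s≤s p≤j) = ∣primeProduct j p pp p≤j
... | yes _ | inj₂ refl      = n∣m*n (primeProduct 0 j)
... | no ¬p | inj₂ refl      = ⊥-elim (¬p pp)

∤primeProduct : ∀ m j p → Prime p → m + j < p → p ∤ primeProduct m j
∤primeProduct m zero    p pp h p∣ = <⇒≱ (prime≥2 pp) (∣⇒≤ p∣)
∤primeProduct m (suc j) p pp h p∣ with prime? (m + suc j)
... | no  _ = ∤primeProduct m j p pp (<-trans (≤-reflexive (≡-sym (+-suc m j))) h) p∣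
... | yes q with euclidsLemma (primeProduct m j) (m + suc j) pp p∣
...   | inj₁ p∣′ = ∤primeProduct m j p pp (<-trans (≤-reflexive (≡-sym (+-suc m j))) h) p∣′
...   | inj₂ p∣′ = <⇒≱ h (∣⇒≤ {{prime⇒nonZero q}} p∣′)

-- Pascal's rule lowers `n` until it equals `p`; there, absorption shows that `p` divides the
-- coefficient times a positive number smaller than `p`. The conditions say that `p` is at most `n`
-- but exceeds both `k` and `n - k`.
prime∣C : ∀ p → Prime p → ∀ n k → p ≤ n → k < p → n < p + k → p ∣ n C k
prime∣C p pp zero    k p≤n _ _ = ⊥-elim (<⇒≱ (prime≥2 pp) (≤-trans p≤n z≤n))
prime∣C p pp (suc n) zero    p≤n _ n< = ⊥-elim (<⇒≱ n< (≤-trans (≤-reflexive (+-identityʳ p)) p≤n))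
prime∣C p pp (suc n) (suc k) p≤n k<p n< with m≤n⇒m<n∨m≡n p≤n
... | inj₁ (s≤s p≤n′) = subst (p ∣_) (nCk+nC[k+1]≡[n+1]C[k+1] n k) (∣m∣n⇒∣m+n
  (prime∣C p pp n k p≤n′ (<-trans (n<1+n k) k<p) (≤-pred (≤-trans n< (≤-reflexive (+-suc p k)))))
  (prime∣C p pp n (suc k) p≤n′ k<p (<-trans (n<1+n n) n<)))
... | inj₂ refl with euclidsLemma (suc k) (suc n C suc k) pp (subst (suc n ∣_) (≡-sym (absorption n k)) (m∣m*n (n C k)))
...   | inj₁ p∣ = ⊥-elim (<⇒≱ k<p (∣⇒≤ p∣))
...   | inj₂ p∣ = p∣

-- The next prime divides the binomial coefficient but not the product of the smaller primes, hence
-- it divides the cofactor.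
primeProduct∣central-C : ∀ m j → j ≤ m → primeProduct m j ∣ (m + m) C m
primeProduct∣central-C m zero    _ = 1∣ _
primeProduct∣central-C m (suc j) j<m with prime? (m + suc j)
... | no  _ = primeProduct∣central-C m j (<⇒≤ j<m)
... | yes q with primeProduct∣central-C m j (<⇒≤ j<m)
...   | divides s eq with euclidsLemma s (primeProduct m j) q (subst (m + suc j ∣_) eq
          (prime∣C (m + suc j) q (m + m) m (+-monoʳ-≤ m j<m) (m<m+n m (s≤s z≤n)) (+-monoˡ-< m (m<m+n m (s≤s z≤n)))))
...     | inj₂ p∣ = ⊥-elim (∤primeProduct m j (m + suc j) q (+-monoʳ-< m (n<1+n j)) p∣)
...     | inj₁ (divides r refl) = divides r (trans eq (reassoc r (m + suc j) (primeProduct m j)))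
  where
  reassoc : ∀ a b c → a * b * c ≡ a * (c * b)
  reassoc = solve-∀

-- The primes between `x` and `2 * x` divide a binomial coefficient of size at most `4 ^ x`, so that
-- each doubling of the range squares the bound.
primorial-bound : ∀ j → primeProduct 0 (2 ^ j) ≤ 4 ^ (2 ^ j)
primorial-bound zero    = s≤s z≤n
primorial-bound (suc j) = begin
  primeProduct 0 (2 ^ suc j)                       ≡⟨ cong (λ a → primeProduct 0 (2 ^ j + a)) (+-identityʳ (2 ^ j)) ⟩
  primeProduct 0 (x + x)                           ≡⟨ primeProduct-+ 0 x x ⟩
  primeProduct 0 x * primeProduct x x              ≤⟨ *-mono-≤ (primorial-bound j) (≤-trans (∣⇒≤ {{>-nonZero (C-positive (x + x) x (m≤m+n x x))}} (primeProduct∣central-C x x ≤-refl)) (C≤2^ (x + x) x)) ⟩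
  4 ^ x * 2 ^ (x + x)                              ≡⟨ cong (4 ^ x *_) (trans (^-distribˡ-+-* 2 x x) (≡-sym (*-^ x))) ⟩
  4 ^ x * 4 ^ x                                    ≡⟨ ^-distribˡ-+-* 4 x x ⟨
  4 ^ (x + x)                                      ≡⟨ cong (λ a → 4 ^ (2 ^ j + a)) (+-identityʳ (2 ^ j)) ⟨
  4 ^ (2 ^ suc j)                                  ∎
  where
  open ≤-Reasoning
  x = 2 ^ j
  *-^ : ∀ x → 4 ^ x ≡ 2 ^ x * 2 ^ x
  *-^ zero    = refl
  *-^ (suc x) = trans (cong (4 *_) (*-^ x)) (eq (2 ^ x))
    where
    eq : ∀ a → 4 * (a * a) ≡ (2 * a) * (2 * a)
    eq = solve-∀

-- Divisibility tested on prime powers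

extract-power : ∀ p → Prime p → ∀ n → 1 ≤ n → ∃ λ j → ∃ λ n′ → n ≡ p ^ j * n′ × p ∤ n′ × 1 ≤ n′
extract-power p pp = <-rec _ step
  where
  step : ∀ n → (∀ {m} → m < n → 1 ≤ m → ∃ λ j → ∃ λ n′ → m ≡ p ^ j * n′ × p ∤ n′ × 1 ≤ n′) →
    1 ≤ n → ∃ λ j → ∃ λ n′ → n ≡ p ^ j * n′ × p ∤ n′ × 1 ≤ n′
  step n rec 1≤n with p ∣? n
  ... | no  p∤n = 0 , n , ≡-sym (+-identityʳ n) , p∤n , 1≤n
  ... | yes (divides zero refl) = ⊥-elim (<⇒≱ 1≤n z≤n)
  ... | yes (divides (suc q) refl) with rec (m<m*n (suc q) p (prime≥2 pp)) (s≤s z≤n)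
  ...   | j , n′ , eq , p∤ , 1≤ = suc j , n′ , trans (*-comm (suc q) p) (trans (cong (p *_) eq) (≡-sym (*-assoc p (p ^ j) n′))) , p∤ , 1≤

coprime-power-∣ : ∀ p → Prime p → ∀ j {a s} → p ∤ a → p ^ j ∣ a * s → p ^ j ∣ s
coprime-power-∣ p pp zero    p∤a h = 1∣ _
coprime-power-∣ p pp (suc j) {a} {s} p∤a h with euclidsLemma a s pp (∣-trans (m∣m*n (p ^ j)) h)
... | inj₁ p∣a = ⊥-elim (p∤a p∣a)
... | inj₂ (divides s′ refl) = subst (p ^ suc j ∣_) (*-comm p s′) (*-pres-∣ (∣-refl {p})
  (coprime-power-∣ p pp j p∤a (*-cancelˡ-∣ p {{prime⇒nonZero pp}} (subst (p ^ suc j ∣_) (eq a s′ p) h))))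
  where
  eq : ∀ a s p → a * (s * p) ≡ p * (a * s)
  eq = solve-∀

-- Strong induction: `n` is split into the full power of one of its primes and a smaller cofactor.
-- Both divide `d`, and since the prime does not divide the cofactor, so does their product.
∣-from-prime-powers : ∀ d N → (∀ p j → Prime p → p ^ j ≤ N → p ^ j ∣ d) → ∀ n → 1 ≤ n → n ≤ N → n ∣ d
∣-from-prime-powers d N h = <-rec _ step
  where
  step : ∀ n → (∀ {m} → m < n → 1 ≤ m → m ≤ N → m ∣ d) → 1 ≤ n → n ≤ N → n ∣ d
  step (suc zero) rec _ _ = 1∣ d
  step n@(suc (suc _)) rec _ n≤N with primeDivisor n (s≤s (s≤s z≤n))
  ... | p , pp , p∣n with extract-power p pp n (s≤s z≤n)
  ...   | zero , n′ , eq , p∤ , _ = ⊥-elim (p∤ (subst (p ∣_) (trans eq (+-identityʳ n′)) p∣n))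
  ...   | suc j , n′ , eq , p∤ , 1≤n′ with rec {n′} n′<n 1≤n′ (≤-trans (<⇒≤ n′<n) n≤N)
    where
    n′<n : n′ < n
    n′<n = subst (n′ <_) (≡-sym eq) (≤-trans (m<m*n n′ (p ^ suc j) {{>-nonZero 1≤n′}} (≤-trans (prime≥2 pp) (m≤m*n p (p ^ j) {{m^n≢0 p j {{prime⇒nonZero pp}}}}))) (≤-reflexive (*-comm n′ _)))
  ...     | divides s eq′ = subst₂ _∣_ (≡-sym eq) (trans (*-comm s n′ ) (trans (*-comm n′ s) (≡-sym eq′))) (*-pres-swap (coprime-power-∣ p pp (suc j) p∤ (subst (p ^ suc j ∣_) (trans eq′ (*-comm s n′)) (h p (suc j) pp p^j≤N))))
    where
    p^j≤N : p ^ suc j ≤ N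
    p^j≤N = ≤-trans (m≤m*n (p ^ suc j) n′ {{>-nonZero 1≤n′}}) (≤-trans (≤-reflexive (≡-sym eq)) n≤N)
    *-pres-swap : p ^ suc j ∣ s → p ^ suc j * n′ ∣ s * n′
    *-pres-swap k = *-pres-∣ k (∣-refl {n′})

^-pres-∣ : ∀ j {a b} → a ∣ b → a ^ j ∣ b ^ j
^-pres-∣ zero    h = ∣-refl
^-pres-∣ (suc j) h = *-pres-∣ h (^-pres-∣ j h)

^-mono-∣ : ∀ b {j t} → j ≤ t → b ^ j ∣ b ^ t
^-mono-∣ b {j} {t} h with m≤n⇒∃[o]m+o≡n h
... | o , refl = subst (b ^ j ∣_) (≡-sym (^-distribˡ-+-* b j o)) (m∣m*n (b ^ o))

∣! : ∀ {p s} → 1 ≤ p → p ≤ s → p ∣ s !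
∣! {suc p} _ h = ∣-trans (m∣m*n (p !)) (m≤n⇒m!∣n! h)

!≤^ : ∀ s n → n ≤ s → n ! ≤ s ^ n
!≤^ s zero    _ = ≤-refl
!≤^ s (suc n) h = *-mono-≤ h (!≤^ s n (≤-trans (n≤1+n n) h))

1≤! : ∀ s → 1 ≤ s !
1≤! zero    = ≤-refl
1≤! (suc s) = *-mono-≤ {1} {suc s} (s≤s z≤n) (1≤! s)

-- With `r = 8 + q`, this is what remains of `exponent` below after division by `2 ^ r`. In each
-- step the right side doubles, while the left side grows by a smaller factor.
growth : ∀ q → (10 + q) * 4 * (21 + 2 * q) < 6 * 2 ^ (8 + q)
growth zero    = ≤ᵇ⇒≤ 841 1536 tt
growth (suc q) = begin-strict
  (10 + suc q) * 4 * (21 + 2 * suc q)   ≤⟨ m≤m+n _ (4 * (2 * q * q + 37 * q + 167)) ⟩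
  (10 + suc q) * 4 * (21 + 2 * suc q) + 4 * (2 * q * q + 37 * q + 167) ≡⟨ eq q ⟩
  2 * ((10 + q) * 4 * (21 + 2 * q))     <⟨ *-monoʳ-< 2 (growth q) ⟩
  2 * (6 * 2 ^ (8 + q))                 ≡⟨ eq₂ (2 ^ (8 + q)) ⟩
  6 * 2 ^ (8 + suc q)                   ∎
  where
  open ≤-Reasoning
  eq : ∀ q → (10 + suc q) * 4 * (21 + 2 * suc q) + 4 * (2 * q * q + 37 * q + 167) ≡ 2 * ((10 + q) * 4 * (21 + 2 * q))
  eq = solve-∀
  eq₂ : ∀ a → 2 * (6 * a) ≡ 6 * (2 * a)
  eq₂ = solve-∀

-- Chebyshev-style: were there no such prime, every i ≤ N = 2 ^ (4 + 2 r) would divide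
-- d = (∏ primes ≤ 2 ^ (2 r)) * (√N)! ^ (5 + 2 r), which is too small for a common multiple of 1, …, N.
prime-in-range : ∀ r → 8 ≤ r → ∃ λ p → Prime p × 2 ^ (2 * r) < p × p ≤ 2 ^ (4 + 2 * r)
prime-in-range r 8≤r with anyUpTo? (λ p → prime×big? p) (suc (2 ^ (4 + 2 * r)))
  where
  prime×big? : ∀ p → Dec (Prime p × 2 ^ (2 * r) < p)
  prime×big? p with prime? p | 2 ^ (2 * r) <? p
  ... | yes a | yes b = yes (a , b)
  ... | no ¬a | _     = no (λ h → ¬a (proj₁ h))
  ... | yes _ | no ¬b = no (λ h → ¬b (proj₂ h))
... | yes (p , s≤s p≤N , pp , x<p) = p , pp , x<p , p≤N
... | no none = ⊥-elim (<⇒≱ d-small (common-multiple-≥ d m d-positive (subst (λ N → ∀ i → 1 ≤ i → i ≤ N → i ∣ d) (≡-sym 2m≡N) all-divide)))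
  where
  open ≤-Reasoning
  x s t N d m : ℕ
  x = 2 ^ (2 * r)
  s = 2 ^ (2 + r)
  -- `2 ^ t` exceeds `N`, so `t` bounds the exponent of every prime power up to `N`.
  t = 5 + 2 * r
  N = 2 ^ (4 + 2 * r)
  d = primeProduct 0 x * (s !) ^ t
  -- Chosen so that `2 * suc m` is `N`, the form required by `common-multiple-≥`.
  m = 8 * x ∸ 1
  1≤8x : 1 ≤ 8 * x
  1≤8x = *-mono-≤ {1} {8} (s≤s z≤n) (m^n>0 2 (2 * r))
  m+1 : suc m ≡ 8 * x
  m+1 = m+[n∸m]≡n 1≤8x
  2m≡N : 2 * suc m ≡ N
  2m≡N = trans (cong (2 *_) m+1) (eq x)
    where
    eq : ∀ x → 2 * (8 * x) ≡ 2 * (2 * (2 * (2 * x)))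
    eq = solve-∀
  s*s≡N : s * s ≡ N
  s*s≡N = trans (≡-sym (^-distribˡ-+-* 2 (2 + r) (2 + r))) (cong (2 ^_) (eq r))
    where
    eq : ∀ r → (2 + r) + (2 + r) ≡ 4 + 2 * r
    eq = solve-∀
  d-positive : 0 < d
  d-positive = *-mono-≤ (primeProduct-positive 0 x) (≤-trans (≤-reflexive (≡-sym (^-zeroˡ t))) (^-monoˡ-≤ t (1≤! s)))
  powers-divide : ∀ p j → Prime p → p ^ j ≤ N → p ^ j ∣ d
  powers-divide p zero pp _ = 1∣ d
  powers-divide p (suc zero) pp h = ∣m⇒∣m*n ((s !) ^ t) (subst (_∣ primeProduct 0 x) (≡-sym (*-identityʳ p))
    (∣primeProduct x p pp (≮⇒≥ (λ x<p → none (p , s≤s (≤-trans (≤-reflexive (≡-sym (*-identityʳ p))) h) , pp , x<p)))))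
  powers-divide p j@(suc (suc i)) pp h = ∣n⇒∣m*n (primeProduct 0 x) (∣-trans (^-pres-∣ j (∣! (≤-trans (s≤s z≤n) (prime≥2 pp)) p≤s)) (^-mono-∣ (s !) j≤t))
    where
    instance
      p≢0 : NonZero p
      p≢0 = prime⇒nonZero pp
    p*p≤N : p * p ≤ s * s
    p*p≤N = begin
      p * p              ≤⟨ *-monoʳ-≤ p (m≤m*n p (p ^ i) {{m^n≢0 p i}}) ⟩
      p ^ j              ≤⟨ h ⟩
      N                  ≡⟨ s*s≡N ⟨
      s * s              ∎
    p≤s : p ≤ s
    p≤s = ≮⇒≥ (λ s<p → <⇒≱ (*-mono-< s<p s<p) p*p≤N)
    j≤t : j ≤ t
    j≤t = ≮⇒≥ (λ t<j → <⇒≱ (begin-strict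
      N                     <⟨ ^-monoʳ-< 2 ≤-refl (n<1+n (4 + 2 * r)) ⟩
      2 ^ t                 ≤⟨ ^-monoʳ-≤ 2 (<⇒≤ t<j) ⟩
      2 ^ j                 ≤⟨ ^-monoˡ-≤ j (prime≥2 pp) ⟩
      p ^ j                 ∎) h)
  all-divide : ∀ i → 1 ≤ i → i ≤ N → i ∣ d
  all-divide = ∣-from-prime-powers d N powers-divide
  -- The left side bounds the binary logarithm of `d`, through `4 ^ x` for the primes and `s ^ s`
  -- for the factorial; the right side, half of `N`, is the least that a common multiple allows.
  exponent : 2 * x + (2 + r) * s * t < 8 * x
  exponent with m≤n⇒∃[o]m+o≡n 8≤r
  ... | q , refl = begin-strict
    2 * x + (2 + r) * s * t          ≡⟨ cong (2 * x +_) (eq₁ q y) ⟩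
    2 * x + y * ((10 + q) * 4 * (21 + 2 * q)) <⟨ +-monoʳ-< (2 * x) (*-monoʳ-< y {{m^n≢0 2 r}} (growth q)) ⟩
    2 * x + y * (6 * y)              ≡⟨ cong (2 * x +_) (trans (eq₂ y) (cong (6 *_) y*y≡x)) ⟩
    2 * x + 6 * x                    ≡⟨ eq₃ x ⟩
    8 * x                            ∎
    where
    y = 2 ^ r
    y*y≡x : y * y ≡ x
    y*y≡x = trans (≡-sym (^-distribˡ-+-* 2 r r)) (cong (2 ^_) (cong (r +_) (≡-sym (+-identityʳ r))))
    eq₁ : ∀ q y → (2 + (8 + q)) * (2 * (2 * y)) * (5 + 2 * (8 + q)) ≡ y * ((10 + q) * 4 * (21 + 2 * q))
    eq₁ = solve-∀
    eq₂ : ∀ y → y * (6 * y) ≡ 6 * (y * y)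
    eq₂ = solve-∀
    eq₃ : ∀ x → 2 * x + 6 * x ≡ 8 * x
    eq₃ = solve-∀
  d-small : d < 2 ^ suc m
  d-small = begin-strict
    primeProduct 0 x * (s !) ^ t             ≤⟨ *-mono-≤ (primorial-bound (2 * r)) (^-monoˡ-≤ t (!≤^ s s ≤-refl)) ⟩
    4 ^ x * (s ^ s) ^ t                      ≡⟨ cong₂ _*_ (^-*-assoc 2 2 x) (trans (cong (_^ t) (^-*-assoc 2 (2 + r) s)) (^-*-assoc 2 ((2 + r) * s) t)) ⟩
    2 ^ (2 * x) * 2 ^ ((2 + r) * s * t)      ≡⟨ ^-distribˡ-+-* 2 (2 * x) ((2 + r) * s * t) ⟨
    2 ^ (2 * x + (2 + r) * s * t)            <⟨ ^-monoʳ-< 2 ≤-refl exponent ⟩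
    2 ^ (8 * x)                              ≡⟨ cong (2 ^_) m+1 ⟨
    2 ^ suc m                                ∎

-- Graphs with many paths

-- Colouring an edge by the sum of its ends is proper because the sum and one end determine the
-- other. It turns any simple graph into a coloured one.
sumColoured : {n : ℕ} (e : Fin n → Fin n → Bool) → (∀ u v → e u v ≡ e v u) → (∀ u → e u u ≡ false) → PCGraph n
sumColoured {n} e e-sym e-irr = record { col = c ; sym = c-sym ; irrefl = c-irr ; proper = c-proper }
  where
  colour : Bool → Fin n → Fin n → Maybe ℕ
  colour true  u v = just (toℕ u + toℕ v)
  colour false u v = nothing
  c : Fin n → Fin n → Maybe ℕ
  c u v = colour (e u v) u v
  c-sym : ∀ u v → c u v ≡ c v u
  c-sym u v rewrite e-sym u v with e v u
  ... | true  = cong just (+-comm (toℕ u) (toℕ v))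
  ... | false = refl
  c-irr : ∀ u → c u u ≡ nothing
  c-irr u rewrite e-irr u = refl
  colour-just : ∀ b {u v c} → colour b u v ≡ just c → toℕ u + toℕ v ≡ c
  colour-just true refl = refl
  c-proper : ∀ u v w c′ → c u v ≡ just c′ → c u w ≡ just c′ → v ≡ w
  c-proper u v w c′ h h′ = toℕ-injective (+-cancelˡ-≡ (toℕ u) _ _ (trans (colour-just (e u v) h) (≡-sym (colour-just (e u w) h′))))

adj-sumColoured : {n : ℕ} (e : Fin n → Fin n → Bool) (s : ∀ u v → e u v ≡ e v u) (i : ∀ u → e u u ≡ false) →
  ∀ u v → adj (sumColoured e s i) u v ≡ e u v
adj-sumColoured e s i u v with e u v
... | true  = refl
... | false = refl

allLists-grow : {n : ℕ} (m r : ℕ) (I J : List (Fin n) → Bool) →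
  (∀ ys → I ys ≡ true → r ≤ # (allFin n) (λ x → J (x ∷ ys))) →
  r * # (allLists m n) I ≤ # (allLists (suc m) n) J
allLists-grow {n} m r I J h = begin
  r * # L I                                       ≡⟨ ∑-*ˡ L r _ ⟨
  ∑ L (λ ys → r * 𝟙 (I ys))                       ≤⟨ ∑-mono L each ⟩
  ∑ L (λ ys → ∑ V (λ x → 𝟙 (J (x ∷ ys))))         ≡⟨ ∑-swap V L (λ x ys → 𝟙 (J (x ∷ ys))) ⟨
  ∑ V (λ x → ∑ L (λ ys → 𝟙 (J (x ∷ ys))))         ≡⟨ ∑-cong V (λ x → ∑-map (x ∷_) L _) ⟨
  ∑ V (λ x → ∑ (map (x ∷_) L) (λ ys → 𝟙 (J ys)))  ≡⟨ ∑-concatMap (λ x → map (x ∷_) L) V _ ⟨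
  # (allLists (suc m) n) J                        ∎
  where
  open ≤-Reasoning
  V = allFin n
  L = allLists m n
  each : ∀ ys → r * 𝟙 (I ys) ≤ ∑ V (λ x → 𝟙 (J (x ∷ ys)))
  each ys with I ys in e
  ... | false = ≤-trans (≤-reflexive (*-zeroʳ r)) z≤n
  ... | true  = ≤-trans (≤-reflexive (*-identityʳ r)) (h ys e)

#≥-family : {n : ℕ} (q : ℕ) (p : Fin n → Bool) (f : Fin q → Fin n) →
  (∀ t → p (f t) ≡ true) → (∀ s t → f s ≡ f t → s ≡ t) → q ≤ # (allFin n) p
#≥-family {n} q p f pf inj = ≤-trans (≤-reflexive (≡-sym count))
  (#-injection _≟ᶠ_ (λ _ → true) p f (allFin⁺ q) (λ t → ∈-allFin (f t)) (λ t _ → pf t) (λ s t _ _ → inj s t))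
  where
  count : # (allFin q) (λ _ → true) ≡ q
  count = trans (∑-const (allFin q) 1) (trans (*-identityʳ _) (length-tabulate id))

parity : ∀ m → (∃ λ a → m ≡ 2 * a) ⊎ (∃ λ a → m ≡ suc (2 * a))
parity zero = inj₁ (0 , refl)
parity (suc m) with parity m
... | inj₁ (a , refl) = inj₂ (a , refl)
... | inj₂ (a , refl) = inj₁ (suc a , eq a)
  where
  eq : ∀ a → suc (suc (2 * a)) ≡ 2 * suc a
  eq = solve-∀

-- Cyclic positions and graded graphs

advance : {m : ℕ} → ℕ → Fin m → Fin m
advance zero    i = i
advance (suc j) i = csuc (advance j i)

toℕ-advance : ∀ {m} j (i : Fin (suc m)) → toℕ (advance j i) ≡ (toℕ i + j) % suc m
toℕ-advance {m} zero i = ≡-sym (trans (cong (_% suc m) (+-identityʳ (toℕ i))) (m<n⇒m%n≡m (toℕ<n i)))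
toℕ-advance {m} (suc j) i = begin-equality
  toℕ (csuc (advance j i))                         ≡⟨ toℕ-csuc (advance j i) ⟩
  (1 + toℕ (advance j i)) % suc m                  ≡⟨ cong (λ a → (1 + a) % suc m) (toℕ-advance j i) ⟩
  (1 + (toℕ i + j) % suc m) % suc m                ≡⟨ %-distribˡ-+ 1 ((toℕ i + j) % suc m) (suc m) ⟩
  (1 % suc m + (toℕ i + j) % suc m % suc m) % suc m ≡⟨ cong (λ a → (1 % suc m + a) % suc m) (m%n%n≡m%n (toℕ i + j) (suc m)) ⟩
  (1 % suc m + (toℕ i + j) % suc m) % suc m        ≡⟨ %-distribˡ-+ 1 (toℕ i + j) (suc m) ⟨
  (1 + (toℕ i + j)) % suc m                        ≡⟨ cong (_% suc m) (+-suc (toℕ i) j) ⟨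
  (toℕ i + suc j) % suc m                          ∎
  where open ≤-Reasoning

advance-full : ∀ {m} (i : Fin (suc m)) → advance (suc m) i ≡ i
advance-full {m} i = toℕ-injective (trans (toℕ-advance (suc m) i) (trans ([m+n]%n≡m%n (toℕ i) (suc m)) (m<n⇒m%n≡m (toℕ<n i))))

advance-≢ : ∀ {m} j (i : Fin (suc m)) → 0 < j → j < suc m → advance j i ≢ i
advance-≢ {m} j i 0<j j<m e with toℕ i + j <? suc m
... | yes lt = <⇒≢ 0<j (≡-sym (+-cancelˡ-≡ (toℕ i) j 0 (trans (trans (≡-sym (m<n⇒m%n≡m lt)) eq) (≡-sym (+-identityʳ (toℕ i))))))
  where
  eq : (toℕ i + j) % suc m ≡ toℕ i
  eq = trans (≡-sym (toℕ-advance j i)) (cong toℕ e)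
... | no ge with m≤n⇒∃[o]m+o≡n (≮⇒≥ ge)
...   | o , e′ = <⇒≢ j<m (+-cancelˡ-≡ (toℕ i) j (suc m) (trans (≡-sym e′) (trans (+-comm (suc m) o) (cong (_+ suc m) o≡i))))
  where
  o<m : o < suc m
  o<m = +-cancelˡ-< (suc m) o (suc m) (subst (_< suc m + suc m) (≡-sym e′) (+-mono-< (toℕ<n i) j<m))
  o≡i : o ≡ toℕ i
  o≡i = trans (≡-sym (m<n⇒m%n≡m o<m)) (trans (≡-sym ([m+n]%n≡m%n o (suc m)))
    (trans (cong (_% suc m) (trans (+-comm o (suc m)) e′)) (trans (≡-sym (toℕ-advance j i)) (cong toℕ e))))

argmax : ∀ {m} (f : Fin (suc m) → ℕ) → ∃ λ i → ∀ j → f j ≤ f i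
argmax {zero}  f = fzero , λ { fzero → ≤-refl }
argmax {suc m} f with argmax (λ i → f (fsuc i))
... | i , h with ≤-total (f fzero) (f (fsuc i))
...   | inj₁ le = fsuc i , λ { fzero → le ; (fsuc j) → h j }
...   | inj₂ ge = fzero , λ { fzero → ≤-refl ; (fsuc j) → ≤-trans (h j) ge }

-- A graph graded by a level function, with at most one vertex on each odd level, has no cycle
-- longer than 4: around a vertex of maximal level a cycle runs through levels L-2, L-1, L, L-1, L-2,
-- and either L - 1 or both L and L - 2 are odd.
graded-no-cycle : ∀ {n m} (v : Fin (6 + m) → Fin n) (level : Fin n → ℕ) →
  (∀ {i j} → v i ≡ v j → i ≡ j) →
  (∀ u w a → level u ≡ suc (2 * a) → level w ≡ suc (2 * a) → u ≡ w) →
  (∀ i → suc (level (v i)) ≡ level (v (csuc i)) ⊎ suc (level (v (csuc i))) ≡ level (v i)) → ⊥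
graded-no-cycle {n} {m} v level inj odd step = finish (step′ c) (step b)
  where
  top : Fin (6 + m)
  top = proj₁ (argmax (λ i → level (v i)))
  max : ∀ j → level (v j) ≤ level (v top)
  max = proj₂ (argmax (λ i → level (v i)))
  a b c d e : Fin (6 + m)
  -- On a cycle of length `6 + m`, going forward `4 + m` steps means going back two, so that `c` is
  -- the top position and `a`, `b`, `d`, `e` surround it.
  a = advance (4 + m) top
  b = csuc a
  c = csuc b
  d = csuc c
  e = csuc d
  c≡top : c ≡ top
  c≡top = advance-full top
  L : Fin (6 + m) → ℕ
  L i = level (v i)
  step′ : ∀ i → suc (L (csuc i)) ≡ L i ⊎ suc (L i) ≡ L (csuc i)
  step′ i with step i
  ... | inj₁ x = inj₂ x
  ... | inj₂ x = inj₁ x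
  max-c : ∀ j → L j ≤ L c
  max-c j = subst (λ t → L j ≤ L t) (≡-sym c≡top) (max j)
  a≢c : a ≢ c
  a≢c eq = advance-≢ 2 a (s≤s z≤n) (s≤s (s≤s (s≤s z≤n))) (≡-sym eq)
  b≢d : b ≢ d
  b≢d eq = advance-≢ 2 b (s≤s z≤n) (s≤s (s≤s (s≤s z≤n))) (≡-sym eq)
  c≢e : c ≢ e
  c≢e eq = advance-≢ 2 c (s≤s z≤n) (s≤s (s≤s (s≤s z≤n))) (≡-sym eq)
  a≢e : a ≢ e
  a≢e eq = advance-≢ 4 a (s≤s z≤n) (s≤s (s≤s (s≤s (s≤s (s≤s z≤n))))) (≡-sym eq)
  odd-pair : ∀ i j t → L i ≡ suc (2 * t) → L j ≡ suc (2 * t) → i ≡ j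
  odd-pair i j t p q = inj (odd (v i) (v j) t p q)
  outer : ∀ t → L b ≡ 2 * t → suc (L b) ≡ L c → suc (L d) ≡ L c →
    suc (L a) ≡ L b ⊎ suc (L b) ≡ L a → suc (L e) ≡ L d ⊎ suc (L d) ≡ L e → ⊥
  -- If `a` lay above `b`, it would share the odd level of `c` and thus coincide with `c`; the next
  -- clause treats `e` in the same way.
  outer t lb bc dc (inj₂ ba) _ = a≢c (odd-pair a c t (trans (≡-sym ba) (cong suc lb)) (trans (≡-sym bc) (cong suc lb)))
  outer t lb bc dc (inj₁ _) (inj₂ de) = c≢e (odd-pair c e t (trans (≡-sym bc) (cong suc lb)) (trans (≡-sym de) (trans dc (trans (≡-sym bc) (cong suc lb)))))
  outer zero lb bc dc (inj₁ ab) (inj₁ _) = 1+n≢0 (trans ab lb)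
  outer (suc t) lb bc dc (inj₁ ab) (inj₁ ed) = a≢e (odd-pair a e t
    (suc-injective (trans ab (trans lb (eq t))))
    (suc-injective (trans ed (trans (suc-injective (trans dc (≡-sym bc))) (trans lb (eq t))))))
    where
    eq : ∀ t → 2 * suc t ≡ suc (suc (2 * t))
    eq = solve-∀
  finish : suc (L d) ≡ L c ⊎ suc (L c) ≡ L d → suc (L b) ≡ L c ⊎ suc (L c) ≡ L b → ⊥
  finish (inj₂ cd) _ = <⇒≱ (≤-reflexive cd) (max-c d)
  finish (inj₁ _) (inj₂ cb) = <⇒≱ (≤-reflexive cb) (max-c b)
  finish (inj₁ dc) (inj₁ bc) = by-parity (parity (L b))
    where
    by-parity : (∃ λ t → L b ≡ 2 * t) ⊎ (∃ λ t → L b ≡ suc (2 * t)) → ⊥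
    by-parity (inj₂ (t , lb)) = b≢d (odd-pair b d t lb (trans (suc-injective (trans dc (≡-sym bc))) lb))
    by-parity (inj₁ (t , lb)) = outer t lb bc dc (step a) (step′ d)

-- The path with every other vertex blown up

does-≟ⁿ-sound : ∀ {a b} → does (a ≟ⁿ b) ≡ true → a ≡ b
does-≟ⁿ-sound {a} {b} = does-sound (a ≟ⁿ b)

-- The first h vertices are hubs, hub i on level 2 i + 1; the others form classes of q twins, class i
-- on level 2 i; and vertices on consecutive levels are adjacent.
module _ (n h q : ℕ) .{{_ : NonZero q}} (fits : h + suc h * q ≤ n) where

  private
    level : ℕ → ℕ
    level i with i <? h
    ... | yes _ = suc (2 * i)
    ... | no  _ = 2 * ((i ∸ h) / q)

    lv : Fin n → ℕ
    lv u = level (toℕ u)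

    edge : Fin n → Fin n → Bool
    edge u v = does (suc (lv u) ≟ⁿ lv v) ∨ does (suc (lv v) ≟ⁿ lv u)

    edge-irr : ∀ u → edge u u ≡ false
    edge-irr u rewrite dec-false (suc (lv u) ≟ⁿ lv u) 1+n≢n = refl

  broom : PCGraph n
  broom = sumColoured edge (λ u v → ∨-comm (does (suc (lv u) ≟ⁿ lv v)) _) edge-irr

  private
    adj-broom : ∀ u v → adj broom u v ≡ edge u v
    adj-broom = adj-sumColoured edge (λ u v → ∨-comm (does (suc (lv u) ≟ⁿ lv v)) _) edge-irr

    edge-sound : ∀ {u v} → edge u v ≡ true → suc (lv u) ≡ lv v ⊎ suc (lv v) ≡ lv u
    edge-sound {u} {v} e with does (suc (lv u) ≟ⁿ lv v) in e₁
    ... | true  = inj₁ (does-≟ⁿ-sound e₁)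
    ... | false = inj₂ (does-≟ⁿ-sound e)

    odd-level : ∀ i a → level i ≡ suc (2 * a) → i ≡ a
    odd-level i a e with i <? h
    ... | yes _ = *-cancelˡ-≡ i a 2 (suc-injective e)
    ... | no  _ = ⊥-elim (even≢odd ((i ∸ h) / q) a e)

  broom-rainbow-free : ∀ m → ¬ RainbowCycle broom (6 + m)
  broom-rainbow-free m (v , c , v-inj , _ , edges) = graded-no-cycle v lv v-inj
    (λ u w a p p′ → toℕ-injective (trans (odd-level (toℕ u) a p) (≡-sym (odd-level (toℕ w) a p′))))
    (λ i → edge-sound (trans (≡-sym (adj-broom (v i) (v (csuc i)))) (adj-just broom (edges i))))

  private
    onLevel : ℕ → Fin n → Bool
    onLevel m u = does (lv u ≟ⁿ m)

    -- Only paths running straight down through the levels `m - 1, …, 0` are counted; they are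
    -- enough, and their vertices are distinct because their levels are.
    descending : ℕ → List (Fin n) → Bool
    descending zero    []       = true
    descending zero    (_ ∷ _)  = false
    descending (suc m) []       = false
    descending (suc m) (x ∷ ys) = onLevel m x ∧ descending m ys

    fresh-level : ∀ m ys x → descending m ys ≡ true → m ≤ lv x → memᵇ x ys ≡ false
    fresh-level zero    []       x _ _ = refl
    fresh-level (suc m) (y ∷ ys) x h m<x with ∧-split {onLevel m y} h
    ... | y-level , rest = ∨-join (dec-false (x ≟ᶠ y) (λ { refl → <⇒≱ m<x (≤-reflexive (does-≟ⁿ-sound y-level)) }))
                                  (fresh-level m ys x rest (<⇒≤ m<x))
      where
      ∨-join : ∀ {a b} → a ≡ false → b ≡ false → a ∨ b ≡ false
      ∨-join refl refl = refl

    descending-distinct : ∀ m ys → descending m ys ≡ true → distinctᵇ ys ≡ true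
    descending-distinct zero    []       _ = refl
    descending-distinct (suc m) (x ∷ ys) h with ∧-split {onLevel m x} h
    ... | x-level , rest rewrite fresh-level m ys x rest (≤-reflexive (≡-sym (does-≟ⁿ-sound x-level))) = descending-distinct m ys rest

    consecutive-levels : ∀ m x y ys → descending (suc m) (x ∷ y ∷ ys) ≡ true → edge x y ≡ true
    consecutive-levels zero x y ys h with ∧-split {onLevel zero x} h
    ... | _ , ()
    consecutive-levels (suc m) x y ys h with ∧-split {onLevel (suc m) x} h
    ... | x-level , rest = trans (cong (does (suc (lv x) ≟ⁿ lv y) ∨_) (dec-true (suc (lv y) ≟ⁿ lv x)
        (trans (cong suc (does-≟ⁿ-sound (proj₁ (∧-split {onLevel m y} rest)))) (≡-sym (does-≟ⁿ-sound x-level))))) (∨-zeroʳ _)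

    descending-path : ∀ m ys → descending m ys ≡ true → consecEdgesᵇ broom ys ≡ true
    descending-path zero    []           _ = refl
    descending-path (suc m) (x ∷ [])     _ = refl
    descending-path (suc m) (x ∷ y ∷ ys) h = ∧-join (trans (adj-broom x y) (consecutive-levels m x y ys h))
      (descending-path m (y ∷ ys) (proj₂ (∧-split {onLevel m x} h)))

    level-sizes : ∀ j → j < h → q ≤ # (allFin n) (onLevel (2 * j)) × 1 ≤ # (allFin n) (onLevel (suc (2 * j)))
    level-sizes j j<h = #≥-family q _ twin twin-level twin-inj , #≥-family 1 _ (λ _ → hub) (λ _ → hub-level) (λ { fzero fzero _ → refl })
      where
      bound : ∀ (t : Fin q) → h + (j * q + toℕ t) < n
      bound t = begin-strict
        h + (j * q + toℕ t)   <⟨ +-monoʳ-< h (+-monoʳ-< (j * q) (toℕ<n t)) ⟩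
        h + (j * q + q)       ≡⟨ cong (h +_) (+-comm (j * q) q) ⟩
        h + suc j * q         ≤⟨ +-monoʳ-≤ h (*-monoˡ-≤ q (≤-trans j<h (n≤1+n h))) ⟩
        h + suc h * q         ≤⟨ fits ⟩
        n                     ∎
        where open ≤-Reasoning
      twin : Fin q → Fin n
      twin t = fromℕ< (bound t)
      twin-class : ∀ t → (j * q + toℕ t) / q ≡ j
      twin-class t = trans (+-distrib-/-∣ˡ (toℕ t) (n∣m*n j)) (trans (cong₂ _+_ (m*n/n≡m j q) (m<n⇒m/n≡0 (toℕ<n t))) (+-identityʳ j))
      twin-level : ∀ t → onLevel (2 * j) (twin t) ≡ true
      twin-level t = dec-true (lv (twin t) ≟ⁿ 2 * j) (trans (cong level (toℕ-fromℕ< (bound t))) level-twin)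
        where
        level-twin : level (h + (j * q + toℕ t)) ≡ 2 * j
        level-twin with h + (j * q + toℕ t) <? h
        ... | yes lt = ⊥-elim (<⇒≱ lt (m≤m+n h _))
        ... | no  _  = cong (2 *_) (trans (cong (_/ q) (m+n∸m≡n h (j * q + toℕ t))) (twin-class t))
      twin-inj : ∀ s t → twin s ≡ twin t → s ≡ t
      twin-inj s t e = toℕ-injective (+-cancelˡ-≡ (j * q) _ _ (+-cancelˡ-≡ h _ _
        (trans (≡-sym (toℕ-fromℕ< (bound s))) (trans (cong toℕ e) (toℕ-fromℕ< (bound t))))))
      j<n : j < n
      j<n = <-≤-trans j<h (≤-trans (m≤m+n h _) fits)
      hub : Fin n
      hub = fromℕ< j<n
      hub-level : onLevel (suc (2 * j)) hub ≡ true
      hub-level = dec-true (lv hub ≟ⁿ suc (2 * j)) (trans (cong level (toℕ-fromℕ< j<n)) level-hub)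
        where
        level-hub : level j ≡ suc (2 * j)
        level-hub with j <? h
        ... | yes _ = refl
        ... | no ¬p = ⊥-elim (¬p j<h)

    add-level : ∀ m r → r ≤ # (allFin n) (onLevel m) →
      r * # (allLists m n) (descending m) ≤ # (allLists (suc m) n) (descending (suc m))
    add-level m r hr = allLists-grow m r (descending m) (descending (suc m)) (λ ys e →
      ≤-trans hr (#-mono (allFin n) (λ x px → ∧-join px e)))

    half<h : ∀ m a → m ≡ 2 * a ⊎ m ≡ suc (2 * a) → m < h → a < h
    half<h m a (inj₁ refl) m<h = ≤-<-trans (m≤m+n a _) m<h
    half<h m a (inj₂ refl) m<h = ≤-<-trans (≤-trans (m≤m+n a _) (n≤1+n _)) m<h

    level-nonempty : ∀ m → m < h → 1 ≤ # (allFin n) (onLevel m)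
    level-nonempty m m<h with parity m
    ... | inj₁ (a , refl) = ≤-trans (>-nonZero⁻¹ q) (proj₁ (level-sizes a (half<h _ a (inj₁ refl) m<h)))
    ... | inj₂ (a , refl) = proj₂ (level-sizes a (half<h _ a (inj₂ refl) m<h))

    -- Of two consecutive levels, the even one offers `q` choices and the odd one its hub.
    two-levels : ∀ m → suc m < h → q * # (allLists m n) (descending m) ≤ # (allLists (2 + m) n) (descending (2 + m))
    two-levels m m<h with parity m
    ... | inj₁ (a , refl) = ≤-trans (add-level m q (proj₁ (level-sizes a (half<h _ a (inj₁ refl) (<⇒≤ m<h)))))
                              (≤-trans (≤-reflexive (≡-sym (*-identityˡ _))) (add-level (suc m) 1 (level-nonempty (suc m) m<h)))
    ... | inj₂ (a , refl) = ≤-trans (*-monoʳ-≤ q (≤-trans (≤-reflexive (≡-sym (*-identityˡ _))) (add-level m 1 (level-nonempty m (<⇒≤ m<h)))))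
                              (add-level (suc m) q (subst (λ t → q ≤ # (allFin n) (onLevel t)) (eq a) (proj₁ (level-sizes (suc a) (half<h (suc m) (suc a) (inj₁ (≡-sym (eq a))) m<h)))))
      where
      eq : ∀ a → 2 * suc a ≡ suc (suc (2 * a))
      eq = solve-∀

    descending-count : ∀ m → m ≤ h → q ^ ⌈ m /2⌉ ≤ # (allLists m n) (descending m)
    descending-count zero          _   = ≤-refl
    descending-count (suc zero)    1≤h = ≤-trans (≤-reflexive (cong (q *_) refl)) (add-level 0 q (proj₁ (level-sizes 0 1≤h)))
    descending-count (suc (suc m)) m≤h = ≤-trans (*-monoʳ-≤ q (descending-count m (≤-trans (n≤1+n m) (≤-trans (n≤1+n _) m≤h)))) (two-levels m m≤h)

  broom-paths : ∀ l → suc l ≤ h → q ^ ⌈ suc l /2⌉ ≤ pathSeqCount broom l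
  broom-paths l l<h = ≤-trans (descending-count (suc l) l<h) (≤-trans
    (#-mono (allLists (suc l) n) (λ ys e → ∧-join (descending-distinct (suc l) ys e) (descending-path (suc l) ys e)))
    (≤-reflexive (≡-sym (length-filterᵇ _ (allLists (suc l) n)))))

-- The affine polarity graph

module _ (p : ℕ) (pp : Prime p) where

  private
    instance
      p≢0 : NonZero p
      p≢0 = prime⇒nonZero pp

  %-+-cong : ∀ {x x′ y y′} → x % p ≡ x′ % p → y % p ≡ y′ % p → (x + y) % p ≡ (x′ + y′) % p
  %-+-cong {x} {x′} {y} {y′} e f = trans (%-distribˡ-+ x y p) (trans (cong₂ (λ a b → (a + b) % p) e f) (≡-sym (%-distribˡ-+ x′ y′ p)))

  %≡⇒∣ : ∀ x y → (x + y) % p ≡ x % p → p ∣ y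
  %≡⇒∣ x y e = ∣m+n∣m⇒∣n {m = x / p * p} (subst (p ∣_) (≡-sym (+-cancelˡ-≡ (x % p) _ _ eq)) (n∣m*n ((x + y) / p))) (n∣m*n (x / p))
    where
    open ≤-Reasoning
    eq : x % p + (x / p * p + y) ≡ x % p + (x + y) / p * p
    eq = begin-equality
      x % p + (x / p * p + y)              ≡⟨ +-assoc (x % p) _ y ⟨
      x % p + x / p * p + y                ≡⟨ cong (_+ y) (m≡m%n+[m/n]*n x p) ⟨
      x + y                                ≡⟨ m≡m%n+[m/n]*n (x + y) p ⟩
      (x + y) % p + (x + y) / p * p        ≡⟨ cong (_+ (x + y) / p * p) e ⟩
      x % p + (x + y) / p * p              ∎

  ∣-<⇒≡0 : ∀ o → p ∣ o → o < p → o ≡ 0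
  ∣-<⇒≡0 zero    _ _ = refl
  ∣-<⇒≡0 (suc o) d h = ⊥-elim (<⇒≱ h (∣⇒≤ d))

  %-+-cancelʳ-≤ : ∀ x y z → y < p → x ≤ y → (x + z) % p ≡ (y + z) % p → x ≡ y
  %-+-cancelʳ-≤ x y z hy x≤y e with m≤n⇒∃[o]m+o≡n x≤y
  ... | o , refl with ∣-<⇒≡0 o (%≡⇒∣ (x + z) o (trans (cong (_% p) (eq x z o)) (≡-sym e))) (≤-<-trans (m≤n+m o x) hy)
    where
    eq : ∀ x z o → (x + z) + o ≡ (x + o) + z
    eq = solve-∀
  ...   | refl = ≡-sym (+-identityʳ x)

  %-+-cancelʳ : ∀ x y z → x < p → y < p → (x + z) % p ≡ (y + z) % p → x ≡ y
  %-+-cancelʳ x y z hx hy e with ≤-total x y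
  ... | inj₁ x≤y = %-+-cancelʳ-≤ x y z hy x≤y e
  ... | inj₂ y≤x = ≡-sym (%-+-cancelʳ-≤ y x z hx y≤x (≡-sym e))

  -- The two sides differ by `s * t`, so `p` divides one of these differences, and both are smaller
  -- than `p`.
  zero-divisor : ∀ c s d t → c + s < p → d + t < p →
    ((c + s) * (d + t) + c * d) % p ≡ ((c + s) * d + c * (d + t)) % p → s ≡ 0 ⊎ t ≡ 0
  zero-divisor c s d t hs ht e = Sum.map
      (λ p∣s → ∣-<⇒≡0 s p∣s (≤-<-trans (m≤n+m s c) hs)) (λ p∣t → ∣-<⇒≡0 t p∣t (≤-<-trans (m≤n+m t d) ht))
      (euclidsLemma s t pp (%≡⇒∣ ((c + s) * d + c * (d + t)) (s * t) (trans (cong (_% p) (eq c s d t)) e)))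
    where
    eq : ∀ c s d t → ((c + s) * d + c * (d + t)) + s * t ≡ (c + s) * (d + t) + c * d
    eq = solve-∀

  rectangle-≤ : ∀ {a b c d} → c ≤ a → d ≤ b → a < p → b < p →
    (a * b + c * d) % p ≡ (a * d + c * b) % p → a ≡ c ⊎ b ≡ d
  rectangle-≤ {a} {b} {c} {d} c≤a d≤b = go (m≤n⇒∃[o]m+o≡n c≤a) (m≤n⇒∃[o]m+o≡n d≤b)
    where
    go : (∃ λ s → c + s ≡ a) → (∃ λ t → d + t ≡ b) → a < p → b < p →
      (a * b + c * d) % p ≡ (a * d + c * b) % p → a ≡ c ⊎ b ≡ d
    go (s , refl) (t , refl) ha hb e = Sum.map (λ { refl → +-identityʳ c }) (λ { refl → +-identityʳ d }) (zero-divisor c s d t ha hb e)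

  -- (a₀ - a₂) (a₁ - a₃) ≡ 0, with subtractions moved to the other side.
  rectangle : ∀ a₀ a₁ a₂ a₃ → a₀ < p → a₁ < p → a₂ < p → a₃ < p →
    (a₀ * a₁ + a₂ * a₃) % p ≡ (a₀ * a₃ + a₂ * a₁) % p → a₀ ≡ a₂ ⊎ a₁ ≡ a₃
  rectangle a₀ a₁ a₂ a₃ h₀ h₁ h₂ h₃ e = go (≤-total a₂ a₀) (≤-total a₃ a₁)
    where
    flip-sums : ∀ a b c d → (a + b) % p ≡ (c + d) % p → (b + a) % p ≡ (d + c) % p
    flip-sums a b c d e = trans (cong (_% p) (+-comm b a)) (trans e (cong (_% p) (+-comm c d)))
    go : a₂ ≤ a₀ ⊎ a₀ ≤ a₂ → a₃ ≤ a₁ ⊎ a₁ ≤ a₃ → a₀ ≡ a₂ ⊎ a₁ ≡ a₃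
    go (inj₁ l) (inj₁ m) = rectangle-≤ l m h₀ h₁ e
    go (inj₂ l) (inj₂ m) = Sum.map ≡-sym ≡-sym (rectangle-≤ l m h₂ h₃ (flip-sums (a₀ * a₁) (a₂ * a₃) (a₀ * a₃) (a₂ * a₁) e))
    go (inj₁ l) (inj₂ m) = Sum.map id ≡-sym (rectangle-≤ l m h₀ h₃ (≡-sym e))
    go (inj₂ l) (inj₁ m) = Sum.map ≡-sym id (rectangle-≤ l m h₂ h₁ (flip-sums (a₀ * a₃) (a₂ * a₁) (a₀ * a₁) (a₂ * a₃) (≡-sym e)))

  -- The vertex a p + b below p² stands for the point (a , b) of the affine plane over ℤ/p; the points
  -- (a , b) and (c , d) are adjacent when b + d ≡ a c. The remaining vertices are isolated.
  module _ (n : ℕ) (fits : p * p ≤ n) where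

    private
      α β : Fin n → ℕ
      α u = toℕ u / p
      β u = toℕ u % p

      core : Fin n → Bool
      core u = does (toℕ u <? p * p)

      on : Fin n → Fin n → Bool
      on u x = does ((β u + β x) % p ≟ⁿ (α u * α x) % p)

      -- The condition `on` holds between a point `(a , b)` and itself when `2 b ≡ a²`; the first
      -- factor removes these loops.
      edge : Fin n → Fin n → Bool
      edge u x = not (does (u ≟ᶠ x)) ∧ ((core u ∧ core x) ∧ on u x)

      on-sym : ∀ u x → on u x ≡ on x u
      on-sym u x = cong₂ (λ a b → does (a % p ≟ⁿ b % p)) (+-comm (β u) (β x)) (*-comm (α u) (α x))

      does-≟-sym : ∀ (u x : Fin n) → does (u ≟ᶠ x) ≡ does (x ≟ᶠ u)
      does-≟-sym u x with u ≟ᶠ x | x ≟ᶠ u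
      ... | yes _ | yes _ = refl
      ... | no _  | no _  = refl
      ... | yes e | no ¬e = ⊥-elim (¬e (≡-sym e))
      ... | no ¬e | yes e = ⊥-elim (¬e (≡-sym e))

      edge-sym : ∀ u x → edge u x ≡ edge x u
      edge-sym u x = cong₂ (λ a b → not a ∧ b) (does-≟-sym u x) (cong₂ _∧_ (∧-comm (core u) (core x)) (on-sym u x))

      edge-irr : ∀ u → edge u u ≡ false
      edge-irr u rewrite does-≟-refl u = refl

    polarity : PCGraph n
    polarity = sumColoured edge edge-sym edge-irr

    private
      adj-polarity : ∀ u x → adj polarity u x ≡ edge u x
      adj-polarity = adj-sumColoured edge edge-sym edge-irr

      core-α : ∀ u → core u ≡ true → α u < p
      core-α u h = m<n*o⇒m/o<n (does-<⇒< h)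

      on-eq : ∀ {u x} → on u x ≡ true → (β u + β x) % p ≡ (α u * α x) % p
      on-eq = does-≟ⁿ-sound

      same-point : ∀ {u x} → α u ≡ α x → β u ≡ β x → u ≡ x
      same-point {u} {x} e f = toℕ-injective (trans (m≡m%n+[m/n]*n (toℕ u) p) (trans (cong₂ (λ a b → b + a * p) e f) (≡-sym (m≡m%n+[m/n]*n (toℕ x) p))))

      -- The incidence with `x` determines the second coordinate from the first one.
      same-α : ∀ {u w x} → on u x ≡ true → on w x ≡ true → α u ≡ α w → u ≡ w
      same-α {u} {w} {x} hu hw e = same-point e (%-+-cancelʳ (β u) (β w) (β x) (m%n<n (toℕ u) p) (m%n<n (toℕ w) p)
        (trans (on-eq hu) (trans (cong (λ a → (a * α x) % p) e) (≡-sym (on-eq hw)))))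

      edge-parts : ∀ {u x} → edge u x ≡ true → core u ≡ true × core x ≡ true × on u x ≡ true
      edge-parts {u} {x} h with ∧-split {core u ∧ core x} (proj₂ (∧-split {not (does (u ≟ᶠ x))} h))
      ... | cc , o = proj₁ (∧-split cc) , proj₂ (∧-split {core u} cc) , o

      -- Either pair of opposite edges adds up to the same sum of four second coordinates, which
      -- gives the congruence of `rectangle`. Opposite vertices with equal first coordinates then
      -- coincide, having a common neighbour.
      no-square : ∀ {v₀ v₁ v₂ v₃} → v₀ ≢ v₂ → v₁ ≢ v₃ →
        edge v₀ v₁ ≡ true → edge v₁ v₂ ≡ true → edge v₂ v₃ ≡ true → edge v₃ v₀ ≡ true → ⊥
      no-square {v₀} {v₁} {v₂} {v₃} n₀₂ n₁₃ e₀₁ e₁₂ e₂₃ e₃₀ with edge-parts {v₀} {v₁} e₀₁ | edge-parts {v₁} {v₂} e₁₂ | edge-parts {v₂} {v₃} e₂₃ | edge-parts {v₃} {v₀} e₃₀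
      ... | c₀ , c₁ , o₀₁ | _ , c₂ , o₁₂ | _ , c₃ , o₂₃ | _ , _ , o₃₀
        with rectangle (α v₀) (α v₁) (α v₂) (α v₃) (core-α v₀ c₀) (core-α v₁ c₁) (core-α v₂ c₂) (core-α v₃ c₃) congruence
        where
        open ≤-Reasoning
        eq : ∀ a b c d → (a + b) + (c + d) ≡ (d + a) + (b + c)
        eq = solve-∀
        congruence : (α v₀ * α v₁ + α v₂ * α v₃) % p ≡ (α v₀ * α v₃ + α v₂ * α v₁) % p
        congruence = begin-equality
          (α v₀ * α v₁ + α v₂ * α v₃) % p               ≡⟨ %-+-cong (on-eq o₀₁) (on-eq o₂₃) ⟨
          ((β v₀ + β v₁) + (β v₂ + β v₃)) % p           ≡⟨ cong (_% p) (eq (β v₀) (β v₁) (β v₂) (β v₃)) ⟩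
          ((β v₃ + β v₀) + (β v₁ + β v₂)) % p           ≡⟨ %-+-cong (on-eq o₃₀) (on-eq o₁₂) ⟩
          (α v₃ * α v₀ + α v₁ * α v₂) % p               ≡⟨ cong (_% p) (cong₂ _+_ (*-comm (α v₃) (α v₀)) (*-comm (α v₁) (α v₂))) ⟩
          (α v₀ * α v₃ + α v₂ * α v₁) % p               ∎
      ... | inj₁ e = n₀₂ (same-α o₀₁ (trans (on-sym v₂ v₁) o₁₂) e)
      ... | inj₂ e = n₁₃ (same-α o₁₂ (trans (on-sym v₃ v₂) o₂₃) e)

    polarity-rainbow-free : ¬ RainbowCycle polarity 4
    polarity-rainbow-free (v , c , v-inj , _ , edges) = no-square
        (λ e → 0≢2 (v-inj e)) (λ e → 1≢3 (v-inj e)) (edge-at i₀) (edge-at i₁) (edge-at i₂) (edge-at i₃)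
      where
      i₀ i₁ i₂ i₃ : Fin 4
      i₀ = fzero
      i₁ = fsuc fzero
      i₂ = fsuc (fsuc fzero)
      i₃ = fsuc (fsuc (fsuc fzero))
      0≢2 : i₀ ≢ i₂
      0≢2 ()
      1≢3 : i₁ ≢ i₃
      1≢3 ()
      edge-at : ∀ i → edge (v i) (v (csuc i)) ≡ true
      edge-at i = trans (≡-sym (adj-polarity (v i) (v (csuc i)))) (adj-just polarity (edges i))

    private
      core-count : p * p ≤ # (allFin n) core
      core-count = #≥-family (p * p) core (λ t → fromℕ< (<-≤-trans (toℕ<n t) fits))
        (λ t → dec-true (_ <? p * p) (subst (_< p * p) (≡-sym (toℕ-fromℕ< _)) (toℕ<n t)))
        (λ s t e → toℕ-injective (trans (≡-sym (toℕ-fromℕ< _)) (trans (cong toℕ e) (toℕ-fromℕ< _))))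

      -- Each first coordinate `t` admits a second one. The point `u` itself may be among the
      -- solutions; it is excluded later, by freshness.
      neighbour-count : ∀ u → p ≤ # (allFin n) (λ x → core x ∧ on u x)
      neighbour-count u = #≥-family p _ point (λ t → ∧-join (point-core t) (point-on t)) point-inj
        where
        open ≤-Reasoning
        d : Fin p → ℕ
        -- `p ∸ β u` stands for the negative of `β u` modulo `p`.
        d t = (α u * toℕ t + (p ∸ β u)) % p
        index : Fin p → ℕ
        index t = d t + toℕ t * p
        index< : ∀ t → index t < p * p
        index< t = <-≤-trans (+-monoˡ-< (toℕ t * p) (m%n<n (α u * toℕ t + (p ∸ β u)) p)) (*-monoˡ-≤ p (toℕ<n t))
        point : Fin p → Fin n
        point t = fromℕ< (<-≤-trans (index< t) fits)
        toℕ-point : ∀ t → toℕ (point t) ≡ index t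
        toℕ-point t = toℕ-fromℕ< (<-≤-trans (index< t) fits)
        point-core : ∀ t → core (point t) ≡ true
        point-core t = dec-true (toℕ (point t) <? p * p) (subst (_< p * p) (≡-sym (toℕ-point t)) (index< t))
        d<p : ∀ t → d t < p
        d<p t = m%n<n (α u * toℕ t + (p ∸ β u)) p
        β-point : ∀ t → β (point t) ≡ d t
        β-point t = trans (cong (_% p) (toℕ-point t)) (trans ([m+kn]%n≡m%n (d t) (toℕ t) p) (m<n⇒m%n≡m (d<p t)))
        α-point : ∀ t → α (point t) ≡ toℕ t
        α-point t = trans (cong (_/ p) (toℕ-point t)) (trans (+-distrib-/-∣ʳ (d t) (n∣m*n (toℕ t)))
          (cong₂ _+_ (m<n⇒m/n≡0 (d<p t)) (m*n/n≡m (toℕ t) p)))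
        point-inj : ∀ s t → point s ≡ point t → s ≡ t
        point-inj s t e = toℕ-injective (trans (≡-sym (α-point s)) (trans (cong α e) (α-point t)))
        eq : ∀ a b c → a + (b + c) ≡ b + (a + c)
        eq = solve-∀
        point-on : ∀ t → on u (point t) ≡ true
        point-on t = dec-true ((β u + β (point t)) % p ≟ⁿ (α u * α (point t)) % p) (begin-equality
          (β u + β (point t)) % p                              ≡⟨ cong (λ a → (β u + a) % p) (β-point t) ⟩
          (β u + d t) % p                                      ≡⟨ %-+-cong {β u} {β u} refl (m%n%n≡m%n (α u * toℕ t + (p ∸ β u)) p) ⟩
          (β u + (α u * toℕ t + (p ∸ β u))) % p                ≡⟨ cong (_% p) (eq (β u) (α u * toℕ t) (p ∸ β u)) ⟩
          (α u * toℕ t + (β u + (p ∸ β u))) % p                ≡⟨ cong (λ a → (α u * toℕ t + a) % p) (m+[n∸m]≡n (<⇒≤ (m%n<n (toℕ u) p))) ⟩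
          (α u * toℕ t + p) % p                                ≡⟨ [m+n]%n≡m%n (α u * toℕ t) p ⟩
          (α u * toℕ t) % p                                    ≡⟨ cong (λ a → (α u * a) % p) (α-point t) ⟨
          (α u * α (point t)) % p                              ∎)

      -- Uses `on` in place of `edge`, so that extensions are counted by `neighbour-count`; that
      -- consecutive vertices differ, as an edge requires, follows from the condition of freshness.
      chain : List (Fin n) → Bool
      chain []           = true
      chain (x ∷ [])     = core x
      chain (x ∷ y ∷ ys) = ((core x ∧ on y x) ∧ not (memᵇ x (y ∷ ys))) ∧ chain (y ∷ ys)

      chainOf : ℕ → List (Fin n) → Bool
      chainOf m ys = does (length ys ≟ⁿ m) ∧ chain ys

      chain-core : ∀ y ys → chain (y ∷ ys) ≡ true → core y ≡ true
      chain-core y []       h = h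
      chain-core y (z ∷ ys) h = proj₁ (∧-split (proj₁ (∧-split {core y ∧ on z y} (proj₁ (∧-split {(core y ∧ on z y) ∧ not (memᵇ y (z ∷ ys))} h)))))

      not-false : ∀ {b} → not b ≡ true → b ≡ false
      not-false {false} _ = refl

      record Link (x y : Fin n) (ys : List (Fin n)) : Set where
        field
          in-core : core x ≡ true
          yx      : on y x ≡ true
          fresh   : not (memᵇ x (y ∷ ys)) ≡ true
          rest    : chain (y ∷ ys) ≡ true

      chain-link : ∀ x y ys → chain (x ∷ y ∷ ys) ≡ true → Link x y ys
      chain-link x y ys h with ∧-split {(core x ∧ on y x) ∧ not (memᵇ x (y ∷ ys))} h
      ... | a , r with ∧-split {core x ∧ on y x} a
      ...   | co , f with ∧-split {core x} co
      ...     | cx , yx = record { in-core = cx ; yx = yx ; fresh = f ; rest = r }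

      chain-distinct : ∀ ys → chain ys ≡ true → distinctᵇ ys ≡ true
      chain-distinct []           _ = refl
      chain-distinct (x ∷ [])     _ = refl
      chain-distinct (x ∷ y ∷ ys) h = ∧-join (Link.fresh l) (chain-distinct (y ∷ ys) (Link.rest l))
        where l = chain-link x y ys h

      link-edge : ∀ {x y ys} → Link x y ys → edge x y ≡ true
      link-edge {x} {y} {ys} l = ∧-join (cong not (proj₁ (∨-false {does (x ≟ᶠ y)} (not-false fresh))))
        (∧-join (∧-join in-core (chain-core y ys rest)) (trans (on-sym x y) yx))
        where open Link l

      chain-path : ∀ ys → chain ys ≡ true → consecEdgesᵇ polarity ys ≡ true
      chain-path []           _ = refl
      chain-path (x ∷ [])     _ = refl
      chain-path (x ∷ y ∷ ys) h = ∧-join (trans (adj-polarity x y) (link-edge l)) (chain-path (y ∷ ys) (Link.rest l))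
        where l = chain-link x y ys h

      mem-count : ∀ ys → # (allFin n) (λ x → memᵇ x ys) ≤ length ys
      mem-count []       = ≤-reflexive (∑-zero (allFin n))
      mem-count (y ∷ ys) = ≤-trans (#-∨ (allFin n) (λ _ → true) (λ x → does (x ≟ᶠ y)) (λ x → memᵇ x ys))
        (+-mono-≤ (#≤1 _ (allFin⁺ n) (λ a b ha hb → trans (does-≟⇒≡ ha) (≡-sym (does-≟⇒≡ hb)))) (mem-count ys))

      -- Of the `p` solutions at `y`, each of the `suc m` vertices of the chain rules out at most
      -- one.
      fresh-count : ∀ r m y ys → r + suc m ≤ p → length (y ∷ ys) ≡ suc m →
        r ≤ # (allFin n) (λ x → (core x ∧ on y x) ∧ not (memᵇ x (y ∷ ys)))
      fresh-count r m y ys hr len = +-cancelˡ-≤ (suc m) r _ (begin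
        suc m + r                        ≡⟨ +-comm (suc m) r ⟩
        r + suc m                        ≤⟨ hr ⟩
        p                                ≤⟨ neighbour-count y ⟩
        # V near                         ≡⟨ trans (∑-cong V (λ x → 𝟙-split (near x) (memᵇ x (y ∷ ys)))) (∑-+ V _ _) ⟩
        # V (λ x → near x ∧ memᵇ x (y ∷ ys)) + F ≤⟨ +-monoˡ-≤ F (≤-trans (#-mono V (λ x h → proj₂ (∧-split {near x} h))) (≤-trans (mem-count (y ∷ ys)) (≤-reflexive len))) ⟩
        suc m + F                        ∎)
        where
        open ≤-Reasoning
        V = allFin n
        near : Fin n → Bool
        near x = core x ∧ on y x
        F = # V (λ x → near x ∧ not (memᵇ x (y ∷ ys)))

      chain-grow : ∀ r m → r + suc m ≤ p → r * # (allLists (suc m) n) (chainOf (suc m)) ≤ # (allLists (2 + m) n) (chainOf (2 + m))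
      chain-grow r m hr = allLists-grow (suc m) r (chainOf (suc m)) (chainOf (2 + m)) extend-chain
        where
        extend-chain : ∀ ys → chainOf (suc m) ys ≡ true → r ≤ # (allFin n) (λ x → chainOf (2 + m) (x ∷ ys))
        extend-chain (y ∷ ys) h with ∧-split {does (length (y ∷ ys) ≟ⁿ suc m)} h
        ... | len , ch = ≤-trans (fresh-count r m y ys hr (does-≟ⁿ-sound len))
          (#-mono (allFin n) (λ x e → ∧-join {does (length (x ∷ y ∷ ys) ≟ⁿ 2 + m)} len (∧-join e ch)))

      chain-count : ∀ r m → r + m ≤ p → r ^ m * (p * p) ≤ # (allLists (suc m) n) (chainOf (suc m))
      chain-count r zero    _ = begin
        1 * (p * p)                                   ≡⟨ *-comm 1 (p * p) ⟩
        p * p * # (allLists 0 n) (chainOf 0)          ≤⟨ allLists-grow 0 (p * p) (chainOf 0) (chainOf 1) first ⟩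
        # (allLists 1 n) (chainOf 1)                  ∎
        where
        open ≤-Reasoning
        first : ∀ ys → chainOf 0 ys ≡ true → p * p ≤ # (allFin n) (λ x → chainOf 1 (x ∷ ys))
        first [] _ = core-count
      chain-count r (suc m) h = begin
        r * r ^ m * (p * p)                           ≡⟨ *-assoc r (r ^ m) (p * p) ⟩
        r * (r ^ m * (p * p))                         ≤⟨ *-monoʳ-≤ r (chain-count r m (≤-trans (+-monoʳ-≤ r (n≤1+n m)) h)) ⟩
        r * # (allLists (suc m) n) (chainOf (suc m))  ≤⟨ chain-grow r m h ⟩
        # (allLists (2 + m) n) (chainOf (2 + m))      ∎
        where open ≤-Reasoning

    polarity-paths : ∀ r l → r + l ≤ p → r ^ l * (p * p) ≤ pathSeqCount polarity l
    polarity-paths r l h = ≤-trans (chain-count r l h) (≤-trans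
      (#-mono (allLists (suc l) n) (λ ys e → let ch = proj₂ (∧-split {does (length ys ≟ⁿ suc l)} e) in
        ∧-join (chain-distinct ys ch) (chain-path ys ch)))
      (≤-reflexive (≡-sym (length-filterᵇ _ (allLists (suc l) n)))))

-- Constants and the bounds for each case

^-distribʳ-* : ∀ a b e → (a * b) ^ e ≡ a ^ e * b ^ e
^-distribʳ-* a b zero    = refl
^-distribʳ-* a b (suc e) = trans (cong (a * b *_) (^-distribʳ-* a b e)) (eq a b (a ^ e) (b ^ e))
  where
  eq : ∀ a b x y → a * b * (x * y) ≡ a * x * (b * y)
  eq = solve-∀

1≤^ : ∀ {a} e → 1 ≤ a → 1 ≤ a ^ e
1≤^ e 1≤a = ≤-trans (≤-reflexive (≡-sym (^-zeroˡ e))) (^-monoˡ-≤ e 1≤a)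

-- `copiesP` rounds half the number of sequences down, which costs at most a factor 3 once there are
-- two sequences.
half-bound : ∀ a → 2 ≤ a → a ≤ 3 * (a / 2)
half-bound a 2≤a = begin
  a                       ≡⟨ m≡m%n+[m/n]*n a 2 ⟩
  a % 2 + a / 2 * 2       ≤⟨ +-monoˡ-≤ (a / 2 * 2) (≤-trans (≤-pred (m%n<n a 2)) (m≥n⇒m/n>0 2≤a)) ⟩
  a / 2 + a / 2 * 2       ≡⟨ eq (a / 2) ⟩
  3 * (a / 2)             ∎
  where
  open ≤-Reasoning
  eq : ∀ x → x + x * 2 ≡ 3 * x
  eq = solve-∀

cycleLength : ∀ k → 2 * (2 + k) ≡ 4 + 2 * k
cycleLength = solve-∀

UpperBound : ℕ → ℕ → ℕ → Set
UpperBound k l a = ∃ λ B → 1 ≤ B × (∀ n (G : PCGraph n) → ¬ RainbowCycle G (2 * k) → copiesP G l ^ 2 ≤ B * n ^ a)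

-- The constants are variables constrained by equations, which keeps them from being unfolded.
module _ (k m d₀ D : ℕ) (m-def : m ≡ 4 + 2 * k) (d₀-def : d₀ ≡ 6 * m) (D-def : D ≡ 2 * d₀) where

  private
    1≤D : 1 ≤ D
    1≤D = subst (1 ≤_) (≡-sym D-def) (≤-trans 1≤d₀ (m≤n*m d₀ 2))
      where
      1≤m : 1 ≤ m
      1≤m = subst (1 ≤_) (≡-sym m-def) (s≤s z≤n)
      1≤d₀ : 1 ≤ d₀
      1≤d₀ = subst (1 ≤_) (≡-sym d₀-def) (≤-trans 1≤m (m≤n*m m 6))

    rainbow-free : ∀ {n} (G : PCGraph n) → ¬ RainbowCycle G (2 * (2 + k)) → ¬ RainbowCycle G m
    rainbow-free G = subst (λ m → ¬ RainbowCycle G m) (trans (cycleLength k) (≡-sym m-def))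

    few-heavy : ∀ {n} (G : PCGraph n) → ¬ RainbowCycle G (2 * (2 + k)) →
      ∀ x → ∑ (vertices G) (λ w → 𝟙 (heavy G D x w) * codeg G x w) ≤ D * deg G x
    few-heavy G nr = heavy-codeg-bound G k m d₀ D m-def d₀-def D-def (rainbow-free G nr)

  upper-half-with : ∀ l → UpperBound (2 + k) l (l + 2)
  upper-half-with l = (2 * D) ^ l , 1≤^ l (≤-trans 1≤D (m≤n*m D 2)) , λ n G nr →
    ≤-trans (^-monoˡ-≤ 2 (copiesP≤walks G l)) (walks-bound-half G D (few-heavy G nr) l)

  upper-ceil-with : ∀ k′ d K → k ≡ suc k′ → d ≡ 6 * D * (m + m) → K ≡ (4 * D + 2) * (2 * D) + 2 * (d * (2 * D + 1)) →
    ∀ l → UpperBound (2 + k) (2 + l) (2 * ⌈ 2 + l + 1 /2⌉)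
  upper-ceil-with k′ d K k-def d-def K-def l = (K ^ suc l) ^ 2 , 1≤^ 2 (1≤^ (suc l) 1≤K) , bound
    where
    2D≤K : 2 * D ≤ K
    2D≤K = subst (2 * D ≤_) (≡-sym K-def) (≤-trans
      (m≤n*m (2 * D) (4 * D + 2) {{>-nonZero (≤-trans (s≤s z≤n) (m≤n+m 2 (4 * D)))}})
      (m≤m+n ((4 * D + 2) * (2 * D)) (2 * (d * (2 * D + 1)))))
    1≤K : 1 ≤ K
    1≤K = ≤-trans 1≤D (≤-trans (m≤n*m D 2) 2D≤K)
    m-eq : m ≡ 6 + 2 * k′
    m-eq = trans m-def (trans (cong (λ k → 4 + 2 * k) k-def) (eq k′))
      where
      eq : ∀ k → 4 + 2 * suc k ≡ 6 + 2 * k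
      eq = solve-∀
    bound : ∀ n (G : PCGraph n) → ¬ RainbowCycle G (2 * (2 + k)) → copiesP G (2 + l) ^ 2 ≤ (K ^ suc l) ^ 2 * n ^ (2 * ⌈ 2 + l + 1 /2⌉)
    bound n G nr = begin
      copiesP G (2 + l) ^ 2            ≤⟨ ^-monoˡ-≤ 2 (copiesP≤walks G (2 + l)) ⟩
      walks G (2 + l) ^ 2              ≤⟨ ^-monoˡ-≤ 2 (walks-bound-ceil G D (few-heavy G nr) K 2D≤K 1≤K w₃ l) ⟩
      (K ^ suc l * n ^ e) ^ 2          ≡⟨ ^-distribʳ-* (K ^ suc l) (n ^ e) 2 ⟩
      (K ^ suc l) ^ 2 * (n ^ e) ^ 2    ≡⟨ cong ((K ^ suc l) ^ 2 *_) (trans (^-*-assoc n e 2) (cong (n ^_) (*-comm e 2))) ⟩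
      (K ^ suc l) ^ 2 * n ^ (2 * e)    ∎
      where
      open ≤-Reasoning
      e = ⌈ 2 + l + 1 /2⌉
      w₃ : walks G 3 ≤ K * (n * n)
      w₃ = subst (λ c → walks G 3 ≤ c * (n * n)) (≡-sym K-def)
        (walks-3-quadratic G k′ m D d m-eq d-def 1≤D (few-heavy G nr) (rainbow-free G nr))

upper-half : ∀ k l → UpperBound (2 + k) l (l + 2)
upper-half k = upper-half-with k _ _ _ refl refl refl

upper-ceil : ∀ k l → UpperBound (3 + k) (2 + l) (2 * ⌈ 2 + l + 1 /2⌉)
upper-ceil k = upper-ceil-with (suc k) _ _ _ refl refl refl k _ _ refl refl refl

LowerBound : ℕ → ℕ → ℕ → Set
LowerBound k l a = ∃ λ A → ∃ λ n₀ → 1 ≤ A ×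
  (∀ n → n₀ ≤ n → Σ (PCGraph n) λ G → ¬ RainbowCycle G (2 * k) × n ^ a ≤ A * copiesP G l ^ 2)

lower-ceil : ∀ k l → LowerBound (3 + k) l (2 * ⌈ suc l /2⌉)
-- The power of `2 * M` comes from `n ≤ 2 * M * q`, and 9 is the square of the factor in
-- `half-bound`. From `n ≥ 2 * M` follows `q ≥ 2`, hence at least two sequences.
lower-ceil k l = (2 * M) ^ (2 * e) * 9 , 2 * M , *-mono-≤ {1} {_} {1} {9} (1≤^ (2 * e) (s≤s z≤n)) (s≤s z≤n) , build
  where
  h M e : ℕ
  h = suc l
  -- Each of the `h` hubs is generously allotted `q` places, like each of the `suc h` classes, so
  -- that `M * q ≤ n` suffices.
  M = h + suc h
  e = ⌈ suc l /2⌉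
  cycle-length : ∀ k → 2 * (3 + k) ≡ 6 + 2 * k
  cycle-length = solve-∀
  build : ∀ n → 2 * M ≤ n → Σ (PCGraph n) λ G → ¬ RainbowCycle G (2 * (3 + k)) × n ^ (2 * e) ≤ (2 * M) ^ (2 * e) * 9 * copiesP G l ^ 2
  build n 2M≤n = G , subst (λ m → ¬ RainbowCycle G m) (≡-sym (cycle-length k)) (broom-rainbow-free n h q fits (2 * k)) , many
    where
    open ≤-Reasoning
    q = n / M
    2≤q : 2 ≤ q
    2≤q = ≤-trans (≤-reflexive (≡-sym (m*n/n≡m 2 M))) (/-monoˡ-≤ M 2M≤n)
    instance
      q≢0 : NonZero q
      q≢0 = >-nonZero (≤-trans (s≤s z≤n) 2≤q)
    fits : h + suc h * q ≤ n
    fits = begin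
      h + suc h * q          ≤⟨ +-monoˡ-≤ (suc h * q) (m≤m*n h q) ⟩
      h * q + suc h * q      ≡⟨ *-distribʳ-+ q h (suc h) ⟨
      M * q                  ≡⟨ *-comm M q ⟩
      q * M                  ≤⟨ m/n*n≤m n M ⟩
      n                      ∎
    G : PCGraph n
    G = broom n h q fits
    N c : ℕ
    N = pathSeqCount G l
    c = copiesP G l
    q^e≤N : q ^ e ≤ N
    q^e≤N = broom-paths n h q fits l ≤-refl
    2≤N : 2 ≤ N
    2≤N = ≤-trans 2≤q (≤-trans (q≤q^ l) q^e≤N)
      where
      q≤q^ : ∀ l → q ≤ q ^ ⌈ suc l /2⌉
      q≤q^ zero    = ≤-reflexive (≡-sym (*-identityʳ q))
      q≤q^ (suc l) = m≤m*n q (q ^ ⌈ l /2⌉) {{>-nonZero (1≤^ ⌈ l /2⌉ (≤-trans (s≤s z≤n) 2≤q))}}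
    n≤ : n ≤ 2 * M * q
    n≤ = begin
      n                      ≡⟨ m≡m%n+[m/n]*n n M ⟩
      n % M + q * M          ≤⟨ +-monoˡ-≤ (q * M) (≤-trans (<⇒≤ (m%n<n n M)) (m≤n*m M q)) ⟩
      q * M + q * M          ≡⟨ eq q M ⟩
      2 * M * q              ∎
      where
      eq : ∀ q M → q * M + q * M ≡ 2 * M * q
      eq = solve-∀
    many : n ^ (2 * e) ≤ (2 * M) ^ (2 * e) * 9 * c ^ 2
    many = begin
      n ^ (2 * e)                            ≤⟨ ^-monoˡ-≤ (2 * e) n≤ ⟩
      (2 * M * q) ^ (2 * e)                  ≡⟨ ^-distribʳ-* (2 * M) q (2 * e) ⟩
      (2 * M) ^ (2 * e) * q ^ (2 * e)        ≡⟨ cong ((2 * M) ^ (2 * e) *_) (trans (cong (q ^_) (*-comm 2 e)) (≡-sym (^-*-assoc q e 2))) ⟩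
      (2 * M) ^ (2 * e) * (q ^ e) ^ 2        ≤⟨ *-monoʳ-≤ ((2 * M) ^ (2 * e)) (^-monoˡ-≤ 2 (≤-trans q^e≤N (half-bound N 2≤N))) ⟩
      (2 * M) ^ (2 * e) * (3 * c) ^ 2        ≡⟨ eq ((2 * M) ^ (2 * e)) c ⟩
      (2 * M) ^ (2 * e) * 9 * c ^ 2          ∎
      where
      eq : ∀ a c → a * (3 * c * (3 * c * 1)) ≡ a * 9 * (c * (c * 1))
      eq = solve-∀

-- A prime near the square root and the lower bound for k = 2

m<2^m : ∀ m → m < 2 ^ m
m<2^m zero    = s≤s z≤n
m<2^m (suc m) = ≤-trans (s≤s (m<2^m m)) (≤-trans (+-monoˡ-≤ (2 ^ m) (m^n>0 2 m)) (≤-reflexive (cong (2 ^ m +_) (≡-sym (+-identityʳ (2 ^ m))))))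

module _ (b : ℕ) (b-def : b ≡ 2 ^ 4) where

  private
    2≤b : 2 ≤ b
    2≤b = subst (2 ≤_) (≡-sym b-def) (s≤s (s≤s z≤n))

  bracket : ∀ R n → b ^ R ≤ n → ∃ λ r → R ≤ r × b ^ r ≤ n × n < b ^ suc r
  bracket R n h = search n R h (<-≤-trans (m<2^m n) (≤-trans (^-monoʳ-≤ 2 (m≤n+m n R)) (^-monoˡ-≤ (R + n) 2≤b)))
    where
    search : ∀ f R → b ^ R ≤ n → n < b ^ (R + f) → ∃ λ r → R ≤ r × b ^ r ≤ n × n < b ^ suc r
    search zero    R lo hi = ⊥-elim (<⇒≱ (subst (λ a → n < b ^ a) (+-identityʳ R) hi) lo)
    search (suc f) R lo hi with n <? b ^ suc R
    ... | yes lt = R , ≤-refl , lo , lt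
    ... | no  ge with search f (suc R) (≮⇒≥ ge) (subst (λ a → n < b ^ a) (+-suc R f) hi)
    ...   | r , R<r , lo′ , hi′ = r , <⇒≤ R<r , lo′ , hi′

  -- With `b = 16`, the square of a prime between `4 ^ r` and `4 ^ (r + 2)` lies between `b ^ r` and
  -- `b ^ (r + 2)`; as `n` lies between `b ^ (r + 2)` and `b ^ (r + 3)`, the loss is at most
  -- `b ^ 3`. The 10 is 2 for this shift plus the 8 required by `prime-in-range`, and `L < r` yields
  -- `2 * L ≤ p`.
  prime-near-√ : ∀ L n → b ^ (10 + L) ≤ n → ∃ λ p → Prime p × 2 * L ≤ p × p * p ≤ n × n ≤ b * b * b * (p * p)
  prime-near-√ L n h = at-scale (bracket (10 + L) n h)
    where
    open ≤-Reasoning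
    at-scale : (∃ λ r → 10 + L ≤ r × b ^ r ≤ n × n < b ^ suc r) → ∃ λ p → Prime p × 2 * L ≤ p × p * p ≤ n × n ≤ b * b * b * (p * p)
    at-scale (suc (suc r) , s≤s (s≤s 8+L≤r) , lo , hi) = from-prime (prime-in-range r (≤-trans (m≤m+n 8 L) 8+L≤r))
      where
      b^ : ∀ e → b ^ e ≡ 2 ^ (4 * e)
      b^ e = trans (cong (_^ e) b-def) (^-*-assoc 2 4 e)
      L<r : suc L ≤ r
      L<r = ≤-trans (+-monoˡ-≤ L (s≤s z≤n)) 8+L≤r
      from-prime : (∃ λ p → Prime p × 2 ^ (2 * r) < p × p ≤ 2 ^ (4 + 2 * r)) → ∃ λ p → Prime p × 2 * L ≤ p × p * p ≤ n × n ≤ b * b * b * (p * p)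
      from-prime (p , pp , x<p , p≤) = p , pp , 2L≤p , pp≤n , n≤
        where
        2L≤p : 2 * L ≤ p
        2L≤p = begin
          2 * L            ≤⟨ *-monoʳ-≤ 2 (<⇒≤ (m<2^m L)) ⟩
          2 ^ suc L        ≤⟨ ^-monoʳ-≤ 2 (≤-trans L<r (m≤m+n r _)) ⟩
          2 ^ (2 * r)      ≤⟨ <⇒≤ x<p ⟩
          p                ∎
        pp≤n : p * p ≤ n
        pp≤n = begin
          p * p                                     ≤⟨ *-mono-≤ p≤ p≤ ⟩
          2 ^ (4 + 2 * r) * 2 ^ (4 + 2 * r)         ≡⟨ ^-distribˡ-+-* 2 (4 + 2 * r) (4 + 2 * r) ⟨
          2 ^ ((4 + 2 * r) + (4 + 2 * r))           ≡⟨ cong (2 ^_) (eq r) ⟩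
          2 ^ (4 * suc (suc r))                     ≡⟨ b^ (suc (suc r)) ⟨
          b ^ suc (suc r)                           ≤⟨ lo ⟩
          n                                         ∎
          where
          eq : ∀ r → (4 + 2 * r) + (4 + 2 * r) ≡ 4 * suc (suc r)
          eq = solve-∀
        b^r≤pp : b ^ r ≤ p * p
        b^r≤pp = begin
          b ^ r                                     ≡⟨ b^ r ⟩
          2 ^ (4 * r)                               ≡⟨ cong (2 ^_) (eq r) ⟩
          2 ^ (2 * r + 2 * r)                       ≡⟨ ^-distribˡ-+-* 2 (2 * r) (2 * r) ⟩
          2 ^ (2 * r) * 2 ^ (2 * r)                 ≤⟨ *-mono-≤ (<⇒≤ x<p) (<⇒≤ x<p) ⟩
          p * p                                     ∎
          where
          eq : ∀ r → 4 * r ≡ 2 * r + 2 * r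
          eq = solve-∀
        n≤ : n ≤ b * b * b * (p * p)
        n≤ = begin
          n                                         ≤⟨ <⇒≤ hi ⟩
          b * (b * (b * b ^ r))                     ≡⟨ eq b (b ^ r) ⟩
          b * b * b * b ^ r                         ≤⟨ *-monoʳ-≤ (b * b * b) b^r≤pp ⟩
          b * b * b * (p * p)                       ∎
          where
          eq : ∀ b a → b * (b * (b * a)) ≡ b * b * b * a
          eq = solve-∀

  lower-half-with : ∀ l → LowerBound 2 l (l + 2)
  -- `K` is the loss in `n ≤ K * (p * p)`, `4 ^ l` comes from `p ≤ 2 * r` in the `l` steps of a
  -- path, squared, and 9 from `half-bound`, squared.
  lower-half-with l = K ^ (l + 2) * (4 ^ l * 9) , b ^ (10 + l) ,
    *-mono-≤ {1} {K ^ (l + 2)} {1} (1≤^ {K} (l + 2) 1≤K) (*-mono-≤ {1} {4 ^ l} {1} {9} (1≤^ {4} l (s≤s z≤n)) (s≤s z≤n)) , build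
    where
    K : ℕ
    K = b * b * b
    1≤b : 1 ≤ b
    1≤b = ≤-trans (s≤s z≤n) 2≤b
    1≤K : 1 ≤ K
    1≤K = *-mono-≤ (*-mono-≤ 1≤b 1≤b) 1≤b
    build : ∀ n → b ^ (10 + l) ≤ n → Σ (PCGraph n) λ G → ¬ RainbowCycle G 4 × n ^ (l + 2) ≤ K ^ (l + 2) * (4 ^ l * 9) * copiesP G l ^ 2
    build n h = with-prime (prime-near-√ l n h)
      where
      with-prime : (∃ λ p → Prime p × 2 * l ≤ p × p * p ≤ n × n ≤ K * (p * p)) →
        Σ (PCGraph n) λ G → ¬ RainbowCycle G 4 × n ^ (l + 2) ≤ K ^ (l + 2) * (4 ^ l * 9) * copiesP G l ^ 2
      with-prime (p , pp , 2l≤p , pp≤n , n≤) = G , polarity-rainbow-free p pp n pp≤n , many K n≤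
        where
        open ≤-Reasoning
        G : PCGraph n
        G = polarity p pp n pp≤n
        r N c : ℕ
        -- At each step of a path at most `l` of the `p` choices are already used; `2 * l ≤ p` keeps
        -- `r` at least half of `p`.
        r = p ∸ l
        N = pathSeqCount G l
        c = copiesP G l
        l≤p : l ≤ p
        l≤p = ≤-trans (m≤n*m l 2) 2l≤p
        r+l≡p : r + l ≡ p
        r+l≡p = m∸n+n≡m l≤p
        l≤r : l ≤ r
        l≤r = +-cancelʳ-≤ l l r (≤-trans (≤-reflexive (cong (l +_) (≡-sym (+-identityʳ l)))) (≤-trans 2l≤p (≤-reflexive (≡-sym r+l≡p))))
        p≤2r : p ≤ 2 * r
        p≤2r = ≤-trans (≤-reflexive (≡-sym r+l≡p)) (+-monoʳ-≤ r (≤-trans l≤r (≤-reflexive (≡-sym (+-identityʳ r)))))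
        1≤r : 1 ≤ r
        1≤r = *-cancelˡ-< 2 0 r (≤-trans (s≤s z≤n) (≤-trans (prime≥2 pp) p≤2r))
        paths : r ^ l * (p * p) ≤ N
        paths = polarity-paths p pp n pp≤n r l (≤-reflexive r+l≡p)
        2≤N : 2 ≤ N
        2≤N = ≤-trans (*-mono-≤ {1} {r ^ l} {2} {p * p} (1≤^ l 1≤r) (*-mono-≤ {2} {p} {1} {p} (prime≥2 pp) (≤-trans (s≤s z≤n) (prime≥2 pp)))) paths
        p²ˡ : (p * p) ^ l ≤ 4 ^ l * (r ^ l * r ^ l)
        p²ˡ = begin
          (p * p) ^ l                       ≤⟨ ^-monoˡ-≤ l (*-mono-≤ p≤2r p≤2r) ⟩
          (2 * r * (2 * r)) ^ l             ≡⟨ cong (_^ l) (eq r) ⟩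
          (4 * (r * r)) ^ l                 ≡⟨ trans (^-distribʳ-* 4 (r * r) l) (cong (4 ^ l *_) (^-distribʳ-* r r l)) ⟩
          4 ^ l * (r ^ l * r ^ l)           ∎
          where
          eq : ∀ r → 2 * r * (2 * r) ≡ 4 * (r * r)
          eq = solve-∀
        many : ∀ K → n ≤ K * (p * p) → n ^ (l + 2) ≤ K ^ (l + 2) * (4 ^ l * 9) * c ^ 2
        many K n≤ = begin
          n ^ (l + 2)                                         ≤⟨ ^-monoˡ-≤ (l + 2) n≤ ⟩
          (K * (p * p)) ^ (l + 2)                             ≡⟨ trans (^-distribʳ-* K (p * p) (l + 2)) (cong (K ^ (l + 2) *_) (^-distribˡ-+-* (p * p) l 2)) ⟩
          K ^ (l + 2) * ((p * p) ^ l * (p * p) ^ 2)           ≤⟨ *-monoʳ-≤ (K ^ (l + 2)) (*-monoˡ-≤ ((p * p) ^ 2) p²ˡ) ⟩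
          K ^ (l + 2) * (4 ^ l * (r ^ l * r ^ l) * (p * p) ^ 2) ≡⟨ eq₁ (K ^ (l + 2)) (4 ^ l) (r ^ l) (p * p) ⟩
          K ^ (l + 2) * 4 ^ l * (r ^ l * (p * p)) ^ 2         ≤⟨ *-monoʳ-≤ (K ^ (l + 2) * 4 ^ l) (^-monoˡ-≤ 2 (≤-trans paths (half-bound N 2≤N))) ⟩
          K ^ (l + 2) * 4 ^ l * (3 * c) ^ 2                   ≡⟨ eq₂ (K ^ (l + 2)) (4 ^ l) c ⟩
          K ^ (l + 2) * (4 ^ l * 9) * c ^ 2                   ∎
          where
          eq₁ : ∀ a f r q → a * (f * (r * r) * (q * (q * 1))) ≡ a * f * (r * q * (r * q * 1))
          eq₁ = solve-∀
          eq₂ : ∀ a f c → a * f * (3 * c * (3 * c * 1)) ≡ a * (f * 9) * (c * (c * 1))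
          eq₂ = solve-∀

lower-half : ∀ l → LowerBound 2 l (l + 2)
lower-half = lower-half-with 16 refl

Θ-from-bounds : ∀ k l a →
  UpperBound k l a → LowerBound k l a → ExThetaHalf k l a
Θ-from-bounds k l a (B , 1≤B , upper) (A , n₀ , 1≤A , lower) =
  A , B , n₀ , 1≤A , 1≤B , λ n n₀≤n → upper n , lower n n₀≤n

theorem1p4 : (k l : ℕ) → 2 ≤ k → 2 ≤ l →
    (3 ≤ k → ExThetaHalf k l (2 * ⌈ l + 1 /2⌉))
    × (k ≡ 2 → ExThetaHalf k l (l + 2))
theorem1p4 k (suc (suc l)) _ (s≤s (s≤s z≤n)) = ceil k , half
  where
  ceil : ∀ k → 3 ≤ k → ExThetaHalf k (2 + l) (2 * ⌈ 2 + l + 1 /2⌉)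
  ceil (suc (suc (suc k))) (s≤s (s≤s (s≤s z≤n))) = Θ-from-bounds (3 + k) (2 + l) (2 * ⌈ 2 + l + 1 /2⌉) (upper-ceil k l)
    (subst (λ i → LowerBound (3 + k) (2 + l) (2 * ⌈ i /2⌉)) (+-comm 1 (2 + l)) (lower-ceil k (2 + l)))
  half : k ≡ 2 → ExThetaHalf k (2 + l) (2 + l + 2)
  half refl = Θ-from-bounds 2 (2 + l) (2 + l + 2) (upper-half 0 (2 + l)) (lower-half (2 + l))
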